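{- Let $p>480$ be a prime and let $N>0$ be an integer with $\gcd(N,p)=1$ which is $(480,p)$-good. Then the Fermat surface $x^N+y^N+z^N=1$ has no solutions $x,y,z\in\mathbb{F}_p(t)$ satisfying $x,y,z\notin\mathbb{F}_p(t^p)$ and $x/y,\ x/z,\ y/z\notin\mathbb{F}_p(t^p)$.
   Context: An integer $N>0$ is called $(X,p)$-good if the congruence $ap^s+b\equiv0\pmod N$ has no solutions in integers $s\ge0$, $0<a,b\le X$. Here $t$ is transcendental over $\mathbb{F}_p$. -}

module Defs where

open import Data.Nat using (ℕ; zero; suc; _+_; _*_; _∸_; _^_; _≤_; _<_; ∣_-_∣)
open import Data.Nat.Divisibility using (_∣_)
open import Data.List using (List; []; _∷_; map; replicate; concatMap)
open import Data.Product using (_×_; _,_; ∃; ∃-syntax; proj₁; proj₂)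
open import Relation.Nullary using (¬_)

Good : ℕ → ℕ → ℕ → Set
Good X p N = ∀ (s a b : ℕ) → 0 < a → a ≤ X → 0 < b → b ≤ X → ¬ (N ∣ (a * p ^ s + b))

_≡[_]_ : ℕ → ℕ → ℕ → Set
a ≡[ p ] b = p ∣ ∣ a - b ∣

-- Polynomials in t, as coefficient lists (constant term first) with natural-number
-- coefficients; they represent elements of F_p[t] via reduction mod p
-- (every element of F_p[t] arises this way).
Poly : Set
Poly = List ℕ

coeff : Poly → ℕ → ℕ
coeff []       _       = 0
coeff (a ∷ _)  zero    = a
coeff (_ ∷ as) (suc i) = coeff as i

addP : Poly → Poly → Poly
addP []       q        = q
addP (a ∷ as) []       = a ∷ as
addP (a ∷ as) (b ∷ bs) = (a + b) ∷ addP as bs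

mulP : Poly → Poly → Poly
mulP []       q = []
mulP (a ∷ as) q = addP (map (a *_) q) (0 ∷ mulP as q)

oneP : Poly
oneP = 1 ∷ []

PEq : ℕ → Poly → Poly → Set
PEq p P Q = ∀ i → coeff P i ≡[ p ] coeff Q i

PNonZero : ℕ → Poly → Set
PNonZero p P = ∃[ i ] ¬ (p ∣ coeff P i)

-- u(t) ↦ u(t^p)
expandP : ℕ → Poly → Poly
expandP p = concatMap (λ c → c ∷ replicate (p ∸ 1) 0)

-- Elements of F_p(t): fractions num/den (den nonzero mod p is imposed separately).
Frac : Set
Frac = Poly × Poly

num den : Frac → Poly
num = proj₁
den = proj₂

ValidF : ℕ → Frac → Set
ValidF p x = PNonZero p (den x)

FEq : ℕ → Frac → Frac → Set
FEq p x y = PEq p (mulP (num x) (den y)) (mulP (num y) (den x))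

oneF : Frac
oneF = oneP , oneP

addF : Frac → Frac → Frac
addF (a , b) (c , d) = addP (mulP a d) (mulP c b) , mulP b d

mulF : Frac → Frac → Frac
mulF (a , b) (c , d) = mulP a c , mulP b d

divF : Frac → Frac → Frac
divF (a , b) (c , d) = mulP a d , mulP b c

powF : Frac → ℕ → Frac
powF x zero    = oneF
powF x (suc n) = mulF x (powF x n)

InFtp : ℕ → Frac → Set
InFtp p x = ∃[ u ] ∃[ v ] (PNonZero p v × FEq p x (expandP p u , expandP p v))

{-# OPTIONS --safe #-}
module Submission where

-- Clear denominators to get Σ ε_i f_i^N = 0 with four polynomials f_i and ε_i = ±1. The hypotheses say that no
-- Wronskian W_ij = f_i f_j′ - f_i′ f_j vanishes. Eliminating f_k between the equation and its derivative gives
-- Σ_{i ≠ k} ε_i f_i^(N-1) W_ik = 0, and the three terms can be written γ a_i^q with q = p^s maximal, so that the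
-- Mason–Stothers inequality applies to the coprime triple (a_i): its degree is bounded by its number of zeros.
-- At a place P compare valuations: ν(γ) + q ν(a_i) = N ν(f_i) + ν(f_k) + (order of dlog (f_i / f_k)).
-- If dlog (f_i / f_k) has order 0 for all i at P, then N divides ν(a_i); such zeros are rare because N is large,
-- hence the degree of (a_i) is at most a constant times the number M of poles of the forms dlog (f_i / f_j).
-- At each such pole two of the f's have minimal valuation and a third one differs from it by a number prime to p;
-- for a suitable k this yields N | ν(a_i) p^s + b with b - 1 the order of a zero of a dlog. Goodness forces ν(a_i) + b
-- above 480, and summing over all poles gives 480 M ≤ 156 M, whereas M > 0.

open import Defs
open import Algebra.Bundles using (CommutativeMonoid; CommutativeRing; RawRing)
open import Data.Empty using (⊥)
open import Data.Fin as Fin using (Fin; punchIn; punchOut)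
open import Data.Fin.Patterns using (0F; 1F; 2F; 3F)
import Data.Fin.Properties as Fin
open import Data.List using (List; []; _∷_; map; replicate; _++_; length; applyUpTo)
open import Data.List.Relation.Unary.All as All using (All; []; _∷_)
open import Data.List.Relation.Unary.AllPairs using (AllPairs; []; _∷_)
open import Data.Maybe using (Maybe; just; nothing)
open import Data.Nat as ℕ using (ℕ; zero; suc; ∣_-_∣; _≤_; _<_; z≤n; s≤s)
open import Data.Nat.Combinatorics using (_C_; nCn≡1; nCk≡n!/k![n-k]!; k![n∸k]!∣n!)
open import Data.Nat.Coprimality using (Coprime)
import Data.Nat.Coprimality as ℕ
import Data.Nat.DivMod as ℕ
import Data.Nat.Divisibility as ℕ
open import Data.Nat.GCD using (module Bézout)
open import Data.Nat.Induction using (<-wellFounded)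
open import Data.Nat.ListAction using () renaming (sum to sumᴸ)
open import Data.Nat.Primality using (Prime; ¬prime[0]; euclidsLemma; prime⇒irreducible; prime⇒nonTrivial; prime⇒nonZero)
import Data.Nat.Properties as ℕ
import Data.Nat.Solver as ℕSolver
open import Data.Product using (_×_; _,_; ∃-syntax; proj₁; proj₂)
open import Data.Sum using (_⊎_; inj₁; inj₂; [_,_]′)
open import Function using (_∘_; flip)
open import Induction.WellFounded using (Acc; acc)
open import Level using (0ℓ)
open import Relation.Binary using (Rel; Setoid; Total; Transitive)
open import Relation.Binary.PropositionalEquality as ≡ using (_≡_; _≢_)
import Relation.Binary.Reasoning.Setoid as SetoidReasoning
open import Relation.Nullary using (¬_; Dec; yes; no; contradiction)
import Relation.Nullary.Decidable as Dec
open import Relation.Nullary.Decidable using (_×-dec_; ¬?)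

-- Everything happens among polynomials, so the place at infinity never occurs: the strict
-- inequality `deg (W f g) < deg f + deg g` stands in for it, and its strictness is what gives
-- `M > 0`. The obstacle is positive characteristic. Mason-Stothers fails for p-th powers, so
-- `q = p^s` is split off first, and this `q` is what meets the `p^s` of goodness. The factor γ is
-- uncontrolled, but it is common to the three terms and cancels when two valuation identities at
-- one place are subtracted. The index k must vary, because which f has minimal valuation depends on
-- the place; every estimate is therefore summed over all four k. M is the largest number of poles
-- (counted with degree) among the pairs (i, j). For fixed k the three degrees of the a_i add up to
-- at most 36 M and the zeros of the three dlogs to at most 3 M, whence 156 = 4 (36 + 3).
-- Factorisation into irreducibles is obtained under a double negation, which suffices for a goal of
-- the form ⊥.

-- A ring solver with integer coefficients for arbitrary commutative rings.

module IntegerSolver (R : CommutativeRing 0ℓ 0ℓ) where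
  open CommutativeRing R
  open import Algebra.Properties.Ring ring using (x[y-z]≈xy-xz; [y-z]x≈yx-zx)
  open import Algebra.Properties.AbelianGroup +-abelianGroup using (⁻¹-∙-comm; ⁻¹-anti-homo‿-; ε⁻¹≈ε)
  open import Algebra.Properties.CommutativeSemigroup +-commutativeSemigroup using (interchange)
  open import Algebra.Properties.Semiring.Mult semiring using (×-homo-+; ×1-homo-*; ×-congˡ)
    renaming (_×_ to _×ₙ_)
  open import Algebra.Solver.Ring.AlmostCommutativeRing
  open import Relation.Binary.Reasoning.Setoid setoid

  -- The integer a - b is represented by the pair (a , b).
  coefficients : RawRing 0ℓ 0ℓ
  coefficients = record
    { Carrier = ℕ × ℕ
    ; _≈_     = _≡_
    ; _+_     = λ (a , b) (c , d) → a ℕ.+ c , b ℕ.+ d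
    ; _*_     = λ (a , b) (c , d) → a ℕ.* c ℕ.+ b ℕ.* d , a ℕ.* d ℕ.+ b ℕ.* c
    ; -_      = λ (a , b) → b , a
    ; 0#      = 0 , 0
    ; 1#      = 1 , 0
    }

  ⟦_⟧ : ℕ × ℕ → Carrier
  ⟦ a , b ⟧ = a ×ₙ 1# - b ×ₙ 1#

  +-difference : ∀ x y z w → (x - y) + (z - w) ≈ (x + z) - (y + w)
  +-difference x y z w = trans (interchange _ _ _ _) (+-congˡ (⁻¹-∙-comm y w))

  *-difference : ∀ x y z w → (x - y) * (z - w) ≈ (x * z + y * w) - (x * w + y * z)
  *-difference x y z w = begin
    (x - y) * (z - w)                     ≈⟨ [y-z]x≈yx-zx (z - w) x y ⟩
    x * (z - w) - y * (z - w)             ≈⟨ +-cong (x[y-z]≈xy-xz x z w) (-‿cong (x[y-z]≈xy-xz y z w)) ⟩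
    (x * z - x * w) - (y * z - y * w)     ≈⟨ +-congˡ (⁻¹-anti-homo‿- _ _) ⟩
    (x * z - x * w) + (y * w - y * z)     ≈⟨ +-difference _ _ _ _ ⟩
    (x * z + y * w) - (x * w + y * z)     ∎

  +-homo : ∀ i j → ⟦ RawRing._+_ coefficients i j ⟧ ≈ ⟦ i ⟧ + ⟦ j ⟧
  +-homo (a , b) (c , d) = begin
    (a ℕ.+ c) ×ₙ 1# - (b ℕ.+ d) ×ₙ 1#                 ≈⟨ +-cong (×-homo-+ 1# a c) (-‿cong (×-homo-+ 1# b d)) ⟩
    (a ×ₙ 1# + c ×ₙ 1#) - (b ×ₙ 1# + d ×ₙ 1#)         ≈⟨ +-difference _ _ _ _ ⟨
    ⟦ a , b ⟧ + ⟦ c , d ⟧                             ∎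

  *-homo : ∀ i j → ⟦ RawRing._*_ coefficients i j ⟧ ≈ ⟦ i ⟧ * ⟦ j ⟧
  *-homo (a , b) (c , d) = begin
    (a ℕ.* c ℕ.+ b ℕ.* d) ×ₙ 1# - (a ℕ.* d ℕ.+ b ℕ.* c) ×ₙ 1#  ≈⟨ +-cong (mixed a c b d) (-‿cong (mixed a d b c)) ⟩
    _                                                          ≈⟨ *-difference _ _ _ _ ⟨
    ⟦ a , b ⟧ * ⟦ c , d ⟧                                      ∎
    where
    mixed : ∀ a c b d → (a ℕ.* c ℕ.+ b ℕ.* d) ×ₙ 1# ≈ (a ×ₙ 1#) * (c ×ₙ 1#) + (b ×ₙ 1#) * (d ×ₙ 1#)
    mixed a c b d = trans (×-homo-+ 1# (a ℕ.* c) _) (+-cong (×1-homo-* a c) (×1-homo-* b d))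

  homomorphism : coefficients -Raw-AlmostCommutative⟶ fromCommutativeRing R
  homomorphism = record
    { ⟦_⟧    = ⟦_⟧
    ; +-homo = +-homo
    ; *-homo = *-homo
    ; -‿homo = λ (a , b) → sym (⁻¹-anti-homo‿- _ _)
    ; 0-homo = -‿inverseʳ 0#
    ; 1-homo = trans (+-cong (+-identityʳ 1#) ε⁻¹≈ε) (+-identityʳ 1#)
    }

  -- Pairs are never reduced, so cancelled coefficients such as `(1 , 1)` have to be recognised as
  -- zero by comparing cross sums.
  weakDec : ∀ i j → Maybe (⟦ i ⟧ ≈ ⟦ j ⟧)
  weakDec (a , b) (c , d) with a ℕ.+ d ℕ.≟ c ℕ.+ b
  ... | no _   = nothing
  ... | yes eq = just (begin
    x - y                  ≈⟨ +-identityʳ _ ⟨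
    (x - y) + 0#           ≈⟨ +-congˡ (-‿inverseʳ w) ⟨
    (x - y) + (w - w)      ≈⟨ +-difference _ _ _ _ ⟩
    (x + w) - (y + w)      ≈⟨ +-cong x+w≈z+y (-‿cong (+-comm y w)) ⟩
    (z + y) - (w + y)      ≈⟨ +-difference _ _ _ _ ⟨
    (z - w) + (y - y)      ≈⟨ +-congˡ (-‿inverseʳ y) ⟩
    (z - w) + 0#           ≈⟨ +-identityʳ _ ⟩
    z - w                  ∎)
    where
    x = a ×ₙ 1#
    y = b ×ₙ 1#
    z = c ×ₙ 1#
    w = d ×ₙ 1#
    x+w≈z+y : x + w ≈ z + y
    x+w≈z+y = trans (sym (×-homo-+ 1# a d)) (trans (×-congˡ eq) (×-homo-+ 1# c b))

  open import Algebra.Solver.Ring coefficients (fromCommutativeRing R) homomorphism weakDec public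
    using (solve; _:=_; _:+_; _:*_; _:-_; :-_)

-- The Frobenius endomorphism.

prime∤! : ∀ {p} → Prime p → ∀ {k} → k ℕ.< p → ¬ (p ℕ.∣ k ℕ.!)
prime∤! pp {zero}  k<p p∣1 = ℕ.>⇒∤ (ℕ.nonTrivial⇒n>1 _ {{prime⇒nonTrivial pp}}) p∣1
prime∤! pp {suc k} k<p p∣k! with euclidsLemma (suc k) (k ℕ.!) pp p∣k!
... | inj₁ d = ℕ.>⇒∤ k<p d
... | inj₂ d = prime∤! pp (ℕ.<-trans (ℕ.n<1+n k) k<p) d

-- p divides p! = C(p,k) k! (p-k)!, but neither factorial on the right, both being of numbers below
-- p.
prime∣binomial : ∀ {p} → Prime p → ∀ {k} → 0 ℕ.< k → k ℕ.< p → p ℕ.∣ (p C k)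
prime∣binomial {p@(suc m)} pp {k} 0<k k<p =
  [ (λ d → d) , (λ d → contradiction d p∤k![p∸k]!) ]′ (euclidsLemma (p C k) _ pp p∣product)
  where
  instance
    _ = ℕ._!*_!≢0 k (p ℕ.∸ k)
  p∣product : p ℕ.∣ (p C k) ℕ.* (k ℕ.! ℕ.* (p ℕ.∸ k) ℕ.!)
  p∣product = ≡.subst (p ℕ.∣_)
    (≡.sym (≡.trans (≡.cong (ℕ._* (k ℕ.! ℕ.* (p ℕ.∸ k) ℕ.!)) (nCk≡n!/k![n-k]! (ℕ.<⇒≤ k<p)))
                    (ℕ.m/n*n≡m (k![n∸k]!∣n! (ℕ.<⇒≤ k<p)))))
    (ℕ.m∣m*n (m ℕ.!))
  p∤k![p∸k]! : ¬ (p ℕ.∣ k ℕ.! ℕ.* (p ℕ.∸ k) ℕ.!)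
  p∤k![p∸k]! d with euclidsLemma (k ℕ.!) _ pp d
  ... | inj₁ d′ = prime∤! pp k<p d′
  ... | inj₂ d′ = prime∤! pp (ℕ.∸-monoʳ-< 0<k (ℕ.<⇒≤ k<p)) d′

module Frobenius (R : CommutativeRing 0ℓ 0ℓ) {p : ℕ} (pp : Prime p) where
  open CommutativeRing R
  open import Algebra.Properties.CommutativeSemiring.Exp commutativeSemiring using (_^_; ^-congʳ)
  open import Algebra.Properties.Semiring.Mult semiring using (×-congˡ; ×-congʳ; ×-assoc-*; ×-assocˡ; ×-homo-1)
    renaming (_×_ to _×ₙ_)
  import Algebra.Properties.CommutativeSemiring.Binomial commutativeSemiring as Binomial
  open import Algebra.Properties.Monoid.Sum +-monoid using (sum; sum-init-last; sum-cong-≋; sum-replicate-zero)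
  open import Relation.Binary.Reasoning.Setoid setoid

  module _ (char : p ×ₙ 1# ≈ 0#) where

    ×-vanishes : ∀ {n} → p ℕ.∣ n → ∀ x → n ×ₙ x ≈ 0#
    ×-vanishes (ℕ.divides q ≡.refl) x = begin
      (q ℕ.* p) ×ₙ x          ≈⟨ ×-assocˡ x q p ⟨
      q ×ₙ (p ×ₙ x)           ≈⟨ ×-congʳ q (×-congʳ p (*-identityˡ x)) ⟨
      q ×ₙ (p ×ₙ (1# * x))    ≈⟨ ×-congʳ q (×-assoc-* p 1# x) ⟨
      q ×ₙ ((p ×ₙ 1#) * x)    ≈⟨ ×-congʳ q (trans (*-congʳ char) (zeroˡ x)) ⟩
      q ×ₙ 0#                 ≈⟨ ×-congʳ q (zeroˡ 0#) ⟨
      q ×ₙ (0# * 0#)          ≈⟨ ×-assoc-* q 0# 0# ⟨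
      (q ×ₙ 0#) * 0#          ≈⟨ zeroʳ _ ⟩
      0#                      ∎

    frobenius-+ : ∀ x y → (x + y) ^ p ≈ x ^ p + y ^ p
    frobenius-+ = go p pp ≡.refl
      where
      -- The prime is generalised to `n`, so that matching it with `suc m` splits the binomial sum
      -- into its two ends and `m` middle terms.
      go : ∀ n → Prime n → n ≡ p → ∀ x y → (x + y) ^ n ≈ x ^ n + y ^ n
      go (suc m) _ n≡p x y = begin
        (x + y) ^ n                                     ≈⟨ Binomial.theorem n x y ⟩
        t Fin.zero + sum (λ k → t (Fin.suc k))          ≈⟨ +-congˡ (sum-init-last {m} (λ k → t (Fin.suc k))) ⟩
        t Fin.zero + (sum middle + t (Fin.fromℕ n))     ≈⟨ +-cong first (+-cong middle≈0 last) ⟩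
        y ^ n + (0# + x ^ n)                            ≈⟨ +-congˡ (+-identityˡ _) ⟩
        y ^ n + x ^ n                                   ≈⟨ +-comm _ _ ⟩
        x ^ n + y ^ n                                   ∎
        where
        n = suc m
        t = Binomial.binomialTerm x y n
        middle = λ (k : Fin m) → t (Fin.suc (Fin.inject₁ k))
        first : t Fin.zero ≈ y ^ n
        first = trans (×-homo-1 _) (*-identityˡ _)
        last : t (Fin.fromℕ n) ≈ x ^ n
        last = begin
          t (Fin.fromℕ n)           ≈⟨ ×-congˡ (≡.trans (≡.cong (n C_) (Fin.toℕ-fromℕ n)) (nCn≡1 n)) ⟩
          1 ×ₙ Binomial.binomial x y n (Fin.fromℕ n)  ≈⟨ ×-homo-1 _ ⟩
          x ^ Fin.toℕ (Fin.fromℕ n) * y ^ (n ℕ.∸ Fin.toℕ (Fin.fromℕ n))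
            ≈⟨ *-cong (^-congʳ x (Fin.toℕ-fromℕ n))
                      (^-congʳ y (≡.trans (≡.cong (n ℕ.∸_) (Fin.toℕ-fromℕ n)) (ℕ.n∸n≡0 n))) ⟩
          x ^ n * 1#                ≈⟨ *-identityʳ _ ⟩
          x ^ n                     ∎
        middle≈0 : sum middle ≈ 0#
        middle≈0 = trans (sum-cong-≋ {m} (λ k → ×-vanishes
          (≡.subst (λ q → q ℕ.∣ (n C suc (Fin.toℕ (Fin.inject₁ k)))) n≡p
            (prime∣binomial (≡.subst Prime (≡.sym n≡p) pp) (ℕ.s≤s ℕ.z≤n)
              (ℕ.s≤s (≡.subst (ℕ._< m) (≡.sym (Fin.toℕ-inject₁ k)) (Fin.toℕ<n k)))))
          _)) (sum-replicate-zero m)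

-- Polynomial rings with a derivation, axiomatically; divisibility and irreducible factors.

module Operations (R : CommutativeRing 0ℓ 0ℓ) where
  open CommutativeRing R
  open import Algebra.Properties.Semiring.Exp semiring public using (_^_)
  open import Algebra.Properties.Semiring.Mult semiring public using () renaming (_×_ to _×ₙ_)

-- The value deg 0# is arbitrary.
record PolynomialRing (p : ℕ) : Set₁ where
  field
    commutativeRing : CommutativeRing 0ℓ 0ℓ
  open CommutativeRing commutativeRing public
  open Operations commutativeRing public
  field
    ≈0?      : ∀ f → Dec (f ≈ 0#)
    1≉0      : ¬ 1# ≈ 0#
    integral : ∀ {f g} → f * g ≈ 0# → f ≈ 0# ⊎ g ≈ 0#
    char     : p ×ₙ 1# ≈ 0#
    deg      : Carrier → ℕ
    deg-cong : ∀ {f g} → f ≈ g → deg f ≡ deg g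
    deg-*    : ∀ {f g} → ¬ f ≈ 0# → ¬ g ≈ 0# → deg (f * g) ≡ deg f ℕ.+ deg g
    deg-+    : ∀ f g → deg (f + g) ℕ.≤ deg f ℕ.⊔ deg g
    divMod   : ∀ f {g} → ¬ g ≈ 0# → ∃[ q ] ∃[ r ] (f ≈ q * g + r × (r ≈ 0# ⊎ deg r ℕ.< deg g))
    D        : Carrier → Carrier
    D-cong   : ∀ {f g} → f ≈ g → D f ≈ D g
    D-+      : ∀ f g → D (f + g) ≈ D f + D g
    D-*      : ∀ f g → D (f * g) ≈ D f * g + f * D g
    D-deg    : ∀ f → D f ≈ 0# ⊎ deg (D f) ℕ.< deg f
    D-root   : ∀ {f} → D f ≈ 0# → ∃[ u ] f ≈ u ^ p

module Theory {p : ℕ} (pp : Prime p) (P : PolynomialRing p) where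
  open PolynomialRing P public
  open import Algebra.Properties.CommutativeSemiring.Exp commutativeSemiring public
    using (^-congˡ; ^-congʳ; ^-homo-*; ^-assocʳ; ^-distrib-*)
  open import Algebra.Properties.Semiring.Mult semiring public using (×-homo-+; ×-congˡ; ×1-homo-*)
  open import Algebra.Properties.Ring ring public using (-‿distribˡ-*; -1*x≈-x; x∙y⁻¹≈ε⇒x≈y; -0#≈0#)
  open import Algebra.Properties.Semiring.Divisibility semiring public using (_∣_; _,_; ∣ʳ-trans; ∣ʳ-refl; ∣ʳ-respʳ-≈; x∣ʳyx; x∣ʳy⇒x∣ʳzy)
  open import Algebra.Properties.Semiring.Primality semiring public using (mkPrime) renaming (Prime to Irr)
  open IntegerSolver commutativeRing public
  open Frobenius commutativeRing pp public
  module ≈-Reasoning = SetoidReasoning setoid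
  open ≈-Reasoning

  ≉-cong : ∀ {f g} → f ≈ g → f ≉ 0# → g ≉ 0#
  ≉-cong f≈g f≉0 g≈0 = f≉0 (trans f≈g g≈0)

  *-≉0 : ∀ {f g} → f ≉ 0# → g ≉ 0# → f * g ≉ 0#
  *-≉0 f≉0 g≉0 fg≈0 = [ f≉0 , g≉0 ]′ (integral fg≈0)

  *-≉0ˡ : ∀ {f g} → f * g ≉ 0# → f ≉ 0#
  *-≉0ˡ fg≉0 f≈0 = fg≉0 (trans (*-congʳ f≈0) (zeroˡ _))

  *-≉0ʳ : ∀ {f g} → f * g ≉ 0# → g ≉ 0#
  *-≉0ʳ fg≉0 g≈0 = fg≉0 (trans (*-congˡ g≈0) (zeroʳ _))

  ^-≉0 : ∀ {f} n → f ≉ 0# → f ^ n ≉ 0#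
  ^-≉0 zero    f≉0 = 1≉0
  ^-≉0 (suc n) f≉0 = *-≉0 f≉0 (^-≉0 n f≉0)

  x-y≈0⇒x≈y : ∀ {x y} → x - y ≈ 0# → x ≈ y
  x-y≈0⇒x≈y {x} {y} = x∙y⁻¹≈ε⇒x≈y x y

  *-cancelʳ : ∀ {f g} h → h ≉ 0# → f * h ≈ g * h → f ≈ g
  *-cancelʳ {f} {g} h h≉0 eq = [ x-y≈0⇒x≈y , (λ h≈0 → contradiction h≈0 h≉0) ]′ (integral (begin
    (f - g) * h    ≈⟨ solve 3 (λ f g h → (f :- g) :* h := f :* h :- g :* h) refl f g h ⟩
    f * h - g * h  ≈⟨ +-congʳ eq ⟩
    g * h - g * h  ≈⟨ -‿inverseʳ _ ⟩
    0#             ∎))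

  *-cancelˡ : ∀ {f g} h → h ≉ 0# → h * f ≈ h * g → f ≈ g
  *-cancelˡ h h≉0 eq = *-cancelʳ h h≉0 (trans (*-comm _ h) (trans eq (*-comm h _)))

  deg-1 : deg 1# ≡ 0
  deg-1 = ℕ.+-cancelˡ-≡ (deg 1#) (deg 1#) 0
    (≡.trans (≡.sym (deg-* 1≉0 1≉0)) (≡.trans (deg-cong (*-identityˡ 1#)) (≡.sym (ℕ.+-identityʳ _))))

  -1*-1≈1 : - 1# * - 1# ≈ 1#
  -1*-1≈1 = trans (solve 1 (λ x → (:- x) :* (:- x) := x :* x) refl 1#) (*-identityˡ 1#)

  -1≉0 : - 1# ≉ 0#
  -1≉0 eq = 1≉0 (begin
    1#               ≈⟨ -1*-1≈1 ⟨
    - 1# * - 1#      ≈⟨ *-congˡ eq ⟩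
    - 1# * 0#        ≈⟨ zeroʳ _ ⟩
    0#               ∎)

  deg--1 : deg (- 1#) ≡ 0
  deg--1 = ℕ.m+n≡0⇒m≡0 _ (≡.trans (≡.sym (deg-* -1≉0 -1≉0))
    (≡.trans (deg-cong -1*-1≈1) deg-1))

  deg-neg : ∀ f → deg (- f) ≡ deg f
  deg-neg f with ≈0? f
  ... | yes f≈0 = deg-cong (trans (-‿cong f≈0) (trans -0#≈0# (sym f≈0)))
  ... | no  f≉0 = ≡.trans (deg-cong (sym (-1*x≈-x f))) (≡.trans (deg-* -1≉0 f≉0) (≡.cong (ℕ._+ deg f) deg--1))

  deg-^ : ∀ {f} n → f ≉ 0# → deg (f ^ n) ≡ n ℕ.* deg f
  deg-^ zero    f≉0 = deg-1
  deg-^ (suc n) f≉0 = ≡.trans (deg-* f≉0 (^-≉0 n f≉0)) (≡.cong (deg _ ℕ.+_) (deg-^ n f≉0))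

  ∣⇒deg≤ : ∀ {f g} → g ≉ 0# → f ∣ g → deg f ℕ.≤ deg g
  ∣⇒deg≤ {f} {g} g≉0 (q , qf≈g) = ≡.subst (deg f ℕ.≤_)
    (≡.trans (≡.sym (deg-* (*-≉0ˡ qf≉0) (*-≉0ʳ qf≉0))) (deg-cong qf≈g)) (ℕ.m≤n+m (deg f) (deg q))
    where qf≉0 = ≉-cong (sym qf≈g) g≉0

  ∣⇒≈0 : ∀ {f g} → deg g ℕ.< deg f → f ∣ g → g ≈ 0#
  ∣⇒≈0 {f} {g} lt f∣g with ≈0? g
  ... | yes g≈0 = g≈0
  ... | no  g≉0 = contradiction (∣⇒deg≤ g≉0 f∣g) (ℕ.<⇒≱ lt)

  ∣-+ : ∀ {f g h} → f ∣ g → f ∣ h → f ∣ g + h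
  ∣-+ (q , eq) (r , eq′) = q + r , trans (distribʳ _ q r) (+-cong eq eq′)

  ∣-*ˡ : ∀ {f g} h → f ∣ g → f ∣ h * g
  ∣-*ˡ = x∣ʳy⇒x∣ʳzy

  ∣-*ʳ : ∀ {f g} h → f ∣ g → f ∣ g * h
  ∣-*ʳ h d = ∣ʳ-respʳ-≈ (*-comm h _) (∣-*ˡ h d)

  ∣-neg : ∀ {f g} → f ∣ g → f ∣ - g
  ∣-neg (q , eq) = - q , trans (sym (-‿distribˡ-* q _)) (-‿cong eq)

  ∣-+-cancelʳ : ∀ {f g h} → f ∣ g + h → f ∣ h → f ∣ g
  ∣-+-cancelʳ {f} {g} {h} d e = ∣ʳ-respʳ-≈ (solve 2 (λ g h → g :+ h :- h := g) refl g h) (∣-+ d (∣-neg e))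

  ∣0 : ∀ f → f ∣ 0#
  ∣0 f = 0# , zeroˡ f

  _∣?_ : ∀ f g → {f ≉ 0#} → Dec (f ∣ g)
  _∣?_ f g {f≉0} with divMod g f≉0
  ... | q , r , g≈qf+r , r-small with ≈0? r
  ...   | yes r≈0 = yes (q , sym (trans g≈qf+r (trans (+-congˡ r≈0) (+-identityʳ _))))
  ...   | no  r≉0 = no λ f∣g → [ r≉0 , (λ lt → r≉0 (∣⇒≈0 lt
            (∣-+-cancelʳ (∣ʳ-respʳ-≈ (trans g≈qf+r (+-comm _ r)) f∣g) (x∣ʳyx f q)))) ]′ r-small

  deg≡0⇒∣1 : ∀ {f} → f ≉ 0# → deg f ≡ 0 → f ∣ 1#
  deg≡0⇒∣1 {f} f≉0 deg≡0 with divMod 1# f≉0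
  ... | q , r , eq , inj₁ r≈0 = q , sym (trans eq (trans (+-congˡ r≈0) (+-identityʳ _)))
  ... | q , r , eq , inj₂ lt  = contradiction (≡.subst (deg r ℕ.<_) deg≡0 lt) λ ()

  record Gcd (f g : Carrier) : Set where
    constructor mkGcd
    field
      d u v : Carrier
      d∣f   : d ∣ f
      d∣g   : d ∣ g
      bézout : d ≈ u * f + v * g

  gcd : ∀ f g → Gcd f g
  gcd f g = go f g (<-wellFounded (deg g))
    where
    divides-g : ∀ f g → g ∣ f → Gcd f g
    divides-g f g g∣f = mkGcd g 0# 1# g∣f ∣ʳ-refl
      (sym (trans (+-cong (zeroˡ f) (*-identityˡ g)) (+-identityˡ g)))
    go : ∀ f g → Acc ℕ._<_ (deg g) → Gcd f g
    go f g (acc rec) with ≈0? g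
    ... | yes g≈0 = mkGcd f 1# 0# ∣ʳ-refl (∣ʳ-respʳ-≈ (sym g≈0) (∣0 f))
            (sym (trans (+-cong (*-identityˡ f) (zeroˡ g)) (+-identityʳ f)))
    ... | no  g≉0 with divMod f g≉0
    ...   | q , r , f≈qg+r , inj₁ r≈0 =
              divides-g f g (q , sym (trans f≈qg+r (trans (+-congˡ r≈0) (+-identityʳ _))))
    ...   | q , r , f≈qg+r , inj₂ r<g with go g r (rec r<g)
    ...     | mkGcd d u v d∣g d∣r eq = mkGcd d v (u - v * q)
                (∣ʳ-respʳ-≈ (sym f≈qg+r) (∣-+ (∣-*ˡ q d∣g) d∣r)) d∣g (begin
        d                                    ≈⟨ eq ⟩
        u * g + v * r                        ≈⟨ solve 5 (λ u g v r q → u :* g :+ v :* r := v :* (q :* g :+ r) :+ (u :- v :* q) :* g) refl u g v r q ⟩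
        v * (q * g + r) + (u - v * q) * g    ≈⟨ +-congʳ (*-congˡ f≈qg+r) ⟨
        v * f + (u - v * q) * g              ∎)

  Irr⇒deg>0 : ∀ {π} → Irr π → 0 ℕ.< deg π
  Irr⇒deg>0 {π} (mkPrime π≉0 π∤1 _) with deg π in eq
  ... | zero  = contradiction (deg≡0⇒∣1 π≉0 eq) π∤1
  ... | suc _ = ℕ.s≤s ℕ.z≤n

  -- The gcd of π and x is a divisor of f. If it has positive degree, minimality makes it associated
  -- to π, so π ∣ x; if it is constant, Bézout turns π ∣ x y into π ∣ y.
  minimal⇒Irr : ∀ {f π} → f ≉ 0# → π ∣ f → 0 ℕ.< deg π →
                (∀ {g} → g ∣ f → 0 ℕ.< deg g → deg π ℕ.≤ deg g) → Irr π
  minimal⇒Irr {f} {π} f≉0 π∣f@(c , cπ≈f) 0<π minimal = mkPrime π≉0 π∤1 split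
    where
    π≉0 : π ≉ 0#
    π≉0 = *-≉0ʳ (≉-cong (sym cπ≈f) f≉0)
    π∤1 : ¬ π ∣ 1#
    π∤1 π∣1 = ℕ.<⇒≱ 0<π (≡.subst (deg π ℕ.≤_) deg-1 (∣⇒deg≤ 1≉0 π∣1))
    split : ∀ {x y} → π ∣ x * y → π ∣ x ⊎ π ∣ y
    split {x} {y} π∣xy with gcd π x
    ... | mkGcd d u v d∣π@(e , ed≈π) d∣x eq with deg d in deg≡
    ...   | zero with deg≡0⇒∣1 {d} (*-≉0ʳ (≉-cong (sym ed≈π) π≉0)) deg≡
    ...     | w , wd≈1 = inj₂ (∣ʳ-respʳ-≈ (begin
              w * (u * y * π + v * (x * y))    ≈⟨ solve 6 (λ w u y π v x → w :* (u :* y :* π :+ v :* (x :* y)) := w :* (u :* π :+ v :* x) :* y) refl w u y π v x ⟩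
              w * (u * π + v * x) * y          ≈⟨ *-congʳ (*-congˡ eq) ⟨
              w * d * y                        ≈⟨ *-congʳ wd≈1 ⟩
              1# * y                           ≈⟨ *-identityˡ y ⟩
              y                                ∎)
              (∣-*ˡ w (∣-+ (x∣ʳyx π (u * y)) (∣-*ˡ v π∣xy))))
    split {x} {y} π∣xy | mkGcd d u v d∣π@(e , ed≈π) d∣x eq | suc n =
      inj₁ (∣ʳ-trans π∣d d∣x)
      where
      ed≉0 : e * d ≉ 0#
      ed≉0 = ≉-cong (sym ed≈π) π≉0
      deg-e : deg e ≡ 0
      deg-e = ℕ.n≤0⇒n≡0 (ℕ.+-cancelʳ-≤ (deg d) (deg e) 0 (≡.subst (ℕ._≤ deg d)
        (≡.trans (deg-cong (sym ed≈π)) (deg-* (*-≉0ˡ ed≉0) (*-≉0ʳ ed≉0)))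
        (minimal (∣ʳ-trans d∣π π∣f) (≡.subst (0 ℕ.<_) (≡.sym deg≡) (ℕ.s≤s ℕ.z≤n)))))
      π∣d : π ∣ d
      π∣d with deg≡0⇒∣1 {e} (*-≉0ˡ ed≉0) deg-e
      ... | w , we≈1 = w , (begin
        w * π        ≈⟨ *-congˡ ed≈π ⟨
        w * (e * d)  ≈⟨ *-assoc w e d ⟨
        w * e * d    ≈⟨ *-congʳ we≈1 ⟩
        1# * d       ≈⟨ *-identityˡ d ⟩
        d            ∎)

  -- Without an irreducible factor every divisor of positive degree would have a smaller one, by
  -- `minimal⇒Irr`; descent on the degree excludes this, but exhibits no factor.
  irreducible-factor : ∀ {f} → f ≉ 0# → 0 ℕ.< deg f → ¬ ¬ (∃[ π ] (Irr π × π ∣ f))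
  irreducible-factor {f} f≉0 0<f none = go f ∣ʳ-refl 0<f (<-wellFounded (deg f))
    where
    go : ∀ g → g ∣ f → 0 ℕ.< deg g → Acc ℕ._<_ (deg g) → ⊥
    go g g∣f 0<g (acc rec) = none (g , minimal⇒Irr f≉0 g∣f 0<g (λ {h} h∣f 0<h →
      ℕ.≮⇒≥ (λ h<g → go h h∣f 0<h (rec h<g))) , g∣f)

-- Places, valuations and degrees of divisors.

-- The order of the pole of dlog (f / g) at a place where f and g have valuations `e` and `m`: the
-- pole is at most simple, with residue `e - m` modulo p.
ramification : ℕ → ℕ → ℕ → ℕ
ramification p e m with p ℕ.∣? ∣ e - m ∣
... | yes _ = 0
... | no  _ = 1

module Valuation {p : ℕ} (pp : Prime p) (R : PolynomialRing p) where
  open Theory pp R public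

  record Place : Set where
    constructor place
    field
      prime   : Carrier
      isPrime : Irr prime

    open Irr isPrime public renaming (p≉0 to prime≉0; p∤1 to prime∤1; split-∣ to prime-split)

  open Place

  factor-out : ∀ P {f} → f ≉ 0# → ∃[ k ] ∃[ g ] (f ≈ prime P ^ k * g × ¬ prime P ∣ g)
  factor-out P {f} f≉0 = go f f≉0 (<-wellFounded (deg f))
    where
    π = prime P
    go : ∀ f → f ≉ 0# → Acc ℕ._<_ (deg f) → ∃[ k ] ∃[ g ] (f ≈ π ^ k * g × ¬ π ∣ g)
    go f f≉0 (acc rec) with _∣?_ π f {prime≉0 P}
    ... | no  π∤f = 0 , f , sym (*-identityˡ f) , π∤f
    ... | yes (q , qπ≈f) with go q q≉0 (rec q<f)
      where
      q≉0 : q ≉ 0#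
      q≉0 = *-≉0ˡ (≉-cong (sym qπ≈f) f≉0)
      q<f : deg q ℕ.< deg f
      q<f = ≡.subst (deg q ℕ.<_) (≡.trans (≡.sym (deg-* q≉0 (prime≉0 P))) (deg-cong qπ≈f))
        (ℕ.m<m+n (deg q) (Irr⇒deg>0 (isPrime P)))
    ...   | k , g , q≈ , π∤g = suc k , g , (let open ≈-Reasoning in begin
      f                  ≈⟨ qπ≈f ⟨
      q * π              ≈⟨ *-congʳ q≈ ⟩
      π ^ k * g * π      ≈⟨ solve 3 (λ x g π → x :* g :* π := π :* x :* g) refl (π ^ k) g π ⟩
      π ^ suc k * g      ∎) , π∤g

  -- ν P f is only meaningful for f ≉ 0#; it is 0 otherwise.
  abstract
    ν : Place → Carrier → ℕ
    ν P f with ≈0? f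
    ... | yes _   = 0
    ... | no  f≉0 = proj₁ (factor-out P f≉0)

    ν-factor : ∀ P {f} → f ≉ 0# → ∃[ g ] (f ≈ prime P ^ ν P f * g × ¬ prime P ∣ g)
    ν-factor P {f} f≉0 with ≈0? f
    ... | yes f≈0  = contradiction f≈0 f≉0
    ... | no  f≉0′ = proj₂ (factor-out P f≉0′)

  ∤-* : ∀ P {f g} → ¬ prime P ∣ f → ¬ prime P ∣ g → ¬ prime P ∣ f * g
  ∤-* P π∤f π∤g π∣fg = [ π∤f , π∤g ]′ (prime-split P π∣fg)

  ∤⇒≉0 : ∀ {f g} → ¬ f ∣ g → g ≉ 0#
  ∤⇒≉0 {f} f∤g g≈0 = f∤g (∣ʳ-respʳ-≈ (sym g≈0) (∣0 f))

  ^-exponent-unique : ∀ P k l {g h} → prime P ^ k * g ≈ prime P ^ l * h →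
                      ¬ prime P ∣ g → ¬ prime P ∣ h → k ≡ l
  ^-exponent-unique P zero zero eq π∤g π∤h = ≡.refl
  ^-exponent-unique P zero (suc l) {g} {h} eq π∤g π∤h = contradiction
    (∣ʳ-respʳ-≈ (trans (sym eq) (*-identityˡ g)) (∣-*ʳ h (∣-*ʳ _ ∣ʳ-refl))) π∤g
  ^-exponent-unique P (suc k) zero {g} {h} eq π∤g π∤h = contradiction
    (∣ʳ-respʳ-≈ (trans eq (*-identityˡ h)) (∣-*ʳ g (∣-*ʳ _ ∣ʳ-refl))) π∤h
  ^-exponent-unique P (suc k) (suc l) eq π∤g π∤h = ≡.cong suc (^-exponent-unique P k l
    (*-cancelˡ (prime P) (prime≉0 P) (trans (sym (*-assoc _ _ _)) (trans eq (*-assoc _ _ _)))) π∤g π∤h)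

  -- `ν` is abstract; the rules for it go through this uniqueness, by exhibiting a cofactor prime to
  -- the place.
  ν-unique : ∀ P k {f g} → f ≈ prime P ^ k * g → ¬ prime P ∣ g → ν P f ≡ k
  ν-unique P k {f} {g} f≈ π∤g with ν-factor P f≉0
    where
    f≉0 : f ≉ 0#
    f≉0 = ≉-cong (sym f≈) (*-≉0 (^-≉0 k (prime≉0 P)) (∤⇒≉0 π∤g))
  ... | h , f≈h , π∤h = ^-exponent-unique P _ k (trans (sym f≈h) f≈) π∤h π∤g

  ν-cong : ∀ P {f g} → f ≉ 0# → f ≈ g → ν P f ≡ ν P g
  ν-cong P f≉0 f≈g with ν-factor P f≉0
  ... | h , f≈h , π∤h = ≡.sym (ν-unique P _ (trans (sym f≈g) f≈h) π∤h)

  ν-* : ∀ P {f g} → f ≉ 0# → g ≉ 0# → ν P (f * g) ≡ ν P f ℕ.+ ν P g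
  ν-* P {f} {g} f≉0 g≉0 with ν-factor P f≉0 | ν-factor P g≉0
  ... | a , f≈ , π∤a | b , g≈ , π∤b = ν-unique P (ν P f ℕ.+ ν P g) (let open ≈-Reasoning in begin
    f * g                                          ≈⟨ *-cong f≈ g≈ ⟩
    (π ^ ν P f * a) * (π ^ ν P g * b)              ≈⟨ solve 4 (λ x a y b → (x :* a) :* (y :* b) := (x :* y) :* (a :* b)) refl _ a _ b ⟩
    (π ^ ν P f * π ^ ν P g) * (a * b)              ≈⟨ *-congʳ (^-homo-* π (ν P f) (ν P g)) ⟨
    π ^ (ν P f ℕ.+ ν P g) * (a * b)                ∎) (∤-* P π∤a π∤b)
    where π = prime P

  ν-∤ : ∀ P {f} → ¬ prime P ∣ f → ν P f ≡ 0
  ν-∤ P π∤f = ν-unique P 0 (sym (*-identityˡ _)) π∤f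

  ν-∣1 : ∀ P {f} → f ∣ 1# → ν P f ≡ 0
  ν-∣1 P f∣1 = ν-∤ P (λ π∣f → prime∤1 P (∣ʳ-trans π∣f f∣1))

  ν-^ : ∀ P {f} n → f ≉ 0# → ν P (f ^ n) ≡ n ℕ.* ν P f
  ν-^ P zero    f≉0 = ν-∣1 P ∣ʳ-refl
  ν-^ P (suc n) f≉0 = ≡.trans (ν-* P f≉0 (^-≉0 n f≉0)) (≡.cong (ν P _ ℕ.+_) (ν-^ P n f≉0))

  ν≥1⇒∣ : ∀ P {f} → ν P f ≢ 0 → prime P ∣ f
  ν≥1⇒∣ P {f} ν≢0 with _∣?_ (prime P) f {prime≉0 P}
  ... | yes d   = d
  ... | no  π∤f = contradiction (ν-∤ P π∤f) ν≢0

  ^ν∣ : ∀ P {f} k → f ≉ 0# → k ℕ.≤ ν P f → prime P ^ k ∣ f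
  ^ν∣ P {f} k f≉0 k≤ν with ν-factor P f≉0
  ... | g , f≈ , _ = ∣ʳ-respʳ-≈ (sym f≈) (∣-*ʳ g (≡.subst (λ n → prime P ^ k ∣ prime P ^ n) (ℕ.m+[n∸m]≡n k≤ν)
        (∣ʳ-respʳ-≈ (sym (^-homo-* (prime P) k (ν P f ℕ.∸ k))) (∣-*ʳ _ ∣ʳ-refl))))

  ^∣⇒≤ν : ∀ P {f} k → f ≉ 0# → prime P ^ k ∣ f → k ℕ.≤ ν P f
  ^∣⇒≤ν P {f} k f≉0 (q , qπ^k≈f) with ν-factor P (*-≉0ˡ (≉-cong (sym qπ^k≈f) f≉0))
  ... | g , q≈ , π∤g = ≡.subst (k ℕ.≤_) (≡.sym (ν-unique P (k ℕ.+ ν P q) (let open ≈-Reasoning in begin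
    f                              ≈⟨ qπ^k≈f ⟨
    q * π ^ k                      ≈⟨ *-congʳ q≈ ⟩
    π ^ ν P q * g * π ^ k          ≈⟨ solve 3 (λ x g y → x :* g :* y := y :* x :* g) refl _ g _ ⟩
    π ^ k * π ^ ν P q * g          ≈⟨ *-congʳ (^-homo-* π k (ν P q)) ⟨
    π ^ (k ℕ.+ ν P q) * g          ∎) π∤g)) (ℕ.m≤m+n k (ν P q))
    where π = prime P

  degₚ : Place → ℕ
  degₚ P = deg (prime P)

  ⟨_⟩ : (Place → ℕ) → List Place → ℕ
  ⟨ φ ⟩ S = sumᴸ (map (λ P → degₚ P ℕ.* φ P) S)

  -- One-sided, which is enough because both elements are prime; see `prime-∤-sym`.
  Distinct : Place → Place → Set
  Distinct P Q = ¬ prime Q ∣ prime P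

  -- Says that S contains all zeros of f without quantifying over places: for distinct entries the
  -- sum never exceeds the degree (`⟨ν⟩≤deg`), so equality means that no zero is missing.
  Full : List Place → Carrier → Set
  Full S f = ⟨ (λ P → ν P f) ⟩ S ≡ deg f

  ⟨⟩-congᴬ : ∀ {φ ψ S} → All (λ P → φ P ≡ ψ P) S → ⟨ φ ⟩ S ≡ ⟨ ψ ⟩ S
  ⟨⟩-congᴬ             []         = ≡.refl
  ⟨⟩-congᴬ {S = P ∷ S} (eq ∷ eqs) = ≡.cong₂ ℕ._+_ (≡.cong (degₚ P ℕ.*_) eq) (⟨⟩-congᴬ eqs)

  ⟨⟩-mono : ∀ {φ ψ} → (∀ P → φ P ℕ.≤ ψ P) → ∀ S → ⟨ φ ⟩ S ℕ.≤ ⟨ ψ ⟩ S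
  ⟨⟩-mono le []      = ℕ.z≤n
  ⟨⟩-mono le (P ∷ S) = ℕ.+-mono-≤ (ℕ.*-monoʳ-≤ (degₚ P) (le P)) (⟨⟩-mono le S)

  ⟨⟩-cong : ∀ {φ ψ} → (∀ P → φ P ≡ ψ P) → ∀ S → ⟨ φ ⟩ S ≡ ⟨ ψ ⟩ S
  ⟨⟩-cong eq S = ⟨⟩-congᴬ (All.universal eq S)

  ⟨0⟩ : ∀ S → ⟨ (λ _ → 0) ⟩ S ≡ 0
  ⟨0⟩ []      = ≡.refl
  ⟨0⟩ (P ∷ S) = ≡.cong₂ ℕ._+_ (ℕ.*-zeroʳ (degₚ P)) (⟨0⟩ S)

  open import Algebra.Properties.CommutativeSemigroup ℕ.+-commutativeSemigroup using (interchange)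

  ⟨⟩-+ : ∀ φ ψ S → ⟨ (λ P → φ P ℕ.+ ψ P) ⟩ S ≡ ⟨ φ ⟩ S ℕ.+ ⟨ ψ ⟩ S
  ⟨⟩-+ φ ψ []      = ≡.refl
  ⟨⟩-+ φ ψ (P ∷ S) rewrite ⟨⟩-+ φ ψ S | ℕ.*-distribˡ-+ (degₚ P) (φ P) (ψ P) =
    interchange (degₚ P ℕ.* φ P) (degₚ P ℕ.* ψ P) (⟨ φ ⟩ S) (⟨ ψ ⟩ S)

  ⟨⟩-* : ∀ n φ S → ⟨ (λ P → n ℕ.* φ P) ⟩ S ≡ n ℕ.* ⟨ φ ⟩ S
  ⟨⟩-* n φ []      = ≡.sym (ℕ.*-zeroʳ n)
  ⟨⟩-* n φ (P ∷ S) rewrite ⟨⟩-* n φ S | ℕ.*-distribˡ-+ n (degₚ P ℕ.* φ P) (⟨ φ ⟩ S) =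
    ≡.cong (ℕ._+ n ℕ.* ⟨ φ ⟩ S) (x∙yz≈y∙xz (degₚ P) n (φ P))
    where open import Algebra.Properties.CommutativeSemigroup ℕ.*-commutativeSemigroup using (x∙yz≈y∙xz)

  -- Primes of distinct places do not divide each other, so removing the P-part leaves the other
  -- valuations alone; this drives the inductions over lists of places.
  peel : ∀ P k {f g S} → All (Distinct P) S → g ≉ 0# → f ≈ prime P ^ k * g →
         All (λ Q → ν Q f ≡ ν Q g) S
  peel P k {f} {g} dist g≉0 f≈ = All.map (λ {Q} Q∤P → let open ≡.≡-Reasoning in begin
    ν Q f                              ≡⟨ ν-cong Q (≉-cong (sym f≈) π^k*g≉0) f≈ ⟩
    ν Q (prime P ^ k * g)              ≡⟨ ν-* Q (^-≉0 k (prime≉0 P)) g≉0 ⟩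
    ν Q (prime P ^ k) ℕ.+ ν Q g        ≡⟨ ≡.cong (ℕ._+ ν Q g) (ν-^ Q k (prime≉0 P)) ⟩
    k ℕ.* ν Q (prime P) ℕ.+ ν Q g      ≡⟨ ≡.cong (λ n → k ℕ.* n ℕ.+ ν Q g) (ν-∤ Q Q∤P) ⟩
    k ℕ.* 0 ℕ.+ ν Q g                  ≡⟨ ≡.cong (ℕ._+ ν Q g) (ℕ.*-zeroʳ k) ⟩
    ν Q g                              ∎) dist
    where π^k*g≉0 = *-≉0 (^-≉0 k (prime≉0 P)) g≉0

  deg-peel : ∀ P k {f g} → g ≉ 0# → f ≈ prime P ^ k * g → deg f ≡ degₚ P ℕ.* k ℕ.+ deg g
  deg-peel P k {g = g} g≉0 f≈ = ≡.trans (deg-cong f≈) (≡.trans (deg-* (^-≉0 k (prime≉0 P)) g≉0)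
    (≡.cong (ℕ._+ deg g) (≡.trans (deg-^ k (prime≉0 P)) (ℕ.*-comm k (degₚ P)))))

  ⟨ν⟩≤deg : ∀ {S} → AllPairs Distinct S → ∀ {f} → f ≉ 0# → ⟨ (λ P → ν P f) ⟩ S ℕ.≤ deg f
  ⟨ν⟩≤deg []                          f≉0 = ℕ.z≤n
  ⟨ν⟩≤deg {P ∷ S} (dist ∷ dists) {f} f≉0 with ν-factor P f≉0
  ... | g , f≈ , π∤g = let open ℕ.≤-Reasoning in begin
    degₚ P ℕ.* ν P f ℕ.+ ⟨ (λ Q → ν Q f) ⟩ S   ≡⟨ ≡.cong (degₚ P ℕ.* ν P f ℕ.+_) (⟨⟩-congᴬ (peel P (ν P f) dist (∤⇒≉0 π∤g) f≈)) ⟩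
    degₚ P ℕ.* ν P f ℕ.+ ⟨ (λ Q → ν Q g) ⟩ S   ≤⟨ ℕ.+-monoʳ-≤ (degₚ P ℕ.* ν P f) (⟨ν⟩≤deg dists (∤⇒≉0 π∤g)) ⟩
    degₚ P ℕ.* ν P f ℕ.+ deg g                 ≡⟨ deg-peel P (ν P f) (∤⇒≉0 π∤g) f≈ ⟨
    deg f                                      ∎

  prime-∤-sym : ∀ P Q → ¬ prime P ∣ prime Q → ¬ prime Q ∣ prime P
  prime-∤-sym P Q P∤Q (c , cQ≈P) with prime-split P {c} {prime Q} (∣ʳ-respʳ-≈ (sym cQ≈P) ∣ʳ-refl)
  ... | inj₂ P∣Q        = P∤Q P∣Q
  ... | inj₁ (e , eP≈c) = prime∤1 Q (e , *-cancelˡ (prime P) (prime≉0 P) (let open ≈-Reasoning in begin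
    prime P * (e * prime Q)    ≈⟨ solve 3 (λ π e q → π :* (e :* q) := e :* π :* q) refl (prime P) e (prime Q) ⟩
    e * prime P * prime Q      ≈⟨ *-congʳ eP≈c ⟩
    c * prime Q                ≈⟨ cQ≈P ⟩
    prime P                    ≈⟨ *-identityʳ _ ⟨
    prime P * 1#               ∎))

  factorisation : ∀ {f} → f ≉ 0# → ¬ ¬ (∃[ S ] (AllPairs Distinct S × Full S f))
  factorisation {f} f≉0 none = go f f≉0 (<-wellFounded (deg f)) (λ (S , dist , _ , full) → none (S , dist , full))
    where
    -- That the places divide `f` is carried along because it separates a new place from the earlier
    -- ones: those divide the cofactor `g`, the new prime does not.
    go : ∀ f → f ≉ 0# → Acc ℕ._<_ (deg f) →
         ¬ ¬ (∃[ S ] (AllPairs Distinct S × All (λ Q → prime Q ∣ f) S × Full S f))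
    go f f≉0 (acc rec) none with deg f ℕ.≟ 0
    ... | yes deg≡0 = none ([] , [] , [] , ≡.sym deg≡0)
    ... | no  deg≢0 = irreducible-factor f≉0 (ℕ.n≢0⇒n>0 deg≢0) step
      where
      step : ¬ (∃[ π ] (Irr π × π ∣ f))
      step (π , π-irr , π∣f) with ν-factor (place π π-irr) f≉0
      ... | g , f≈ , π∤g = go g g≉0 (rec g<f) λ (S , dist , S∣g , full) →
            none (P ∷ S , All.map (λ {Q} Q∣g → prime-∤-sym P Q (λ P∣Q → π∤g (∣ʳ-trans P∣Q Q∣g))) S∣g ∷ dist
                 , π∣f ∷ All.map (λ Q∣g → ∣ʳ-respʳ-≈ (sym f≈) (∣-*ˡ _ Q∣g)) S∣g
                 , full′ S dist S∣g full)
        where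
        P = place π π-irr
        g≉0 = ∤⇒≉0 π∤g
        k≢0 : ν P f ≢ 0
        k≢0 k≡0 = π∤g (∣ʳ-respʳ-≈ (trans f≈ (trans (*-congʳ (^-congʳ π k≡0)) (*-identityˡ g))) π∣f)
        g<f : deg g ℕ.< deg f
        g<f = ≡.subst (deg g ℕ.<_) (≡.sym (deg-peel P (ν P f) g≉0 f≈))
          (ℕ.m<n+m (deg g) (ℕ.*-mono-< {0} {_} {0} (Irr⇒deg>0 π-irr) (ℕ.n≢0⇒n>0 k≢0)))
        full′ : ∀ S → AllPairs Distinct S → All (λ Q → prime Q ∣ g) S → Full S g → Full (P ∷ S) f
        full′ S dist S∣g full = ≡.trans
          (≡.cong (degₚ P ℕ.* ν P f ℕ.+_) (≡.trans (⟨⟩-congᴬ (peel P (ν P f)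
            (All.map (λ {Q} Q∣g → prime-∤-sym P Q (λ P∣Q → π∤g (∣ʳ-trans P∣Q Q∣g))) S∣g) g≉0 f≈)) full))
          (≡.sym (deg-peel P (ν P f) g≉0 f≈))

  Full-* : ∀ {S f g} → f ≉ 0# → g ≉ 0# → Full S f → Full S g → Full S (f * g)
  Full-* {S} {f} {g} f≉0 g≉0 full-f full-g = let open ≡.≡-Reasoning in begin
    ⟨ (λ P → ν P (f * g)) ⟩ S                       ≡⟨ ⟨⟩-cong (λ P → ν-* P f≉0 g≉0) S ⟩
    ⟨ (λ P → ν P f ℕ.+ ν P g) ⟩ S                   ≡⟨ ⟨⟩-+ (λ P → ν P f) (λ P → ν P g) S ⟩
    ⟨ (λ P → ν P f) ⟩ S ℕ.+ ⟨ (λ P → ν P g) ⟩ S     ≡⟨ ≡.cong₂ ℕ._+_ full-f full-g ⟩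
    deg f ℕ.+ deg g                                 ≡⟨ deg-* f≉0 g≉0 ⟨
    deg (f * g)                                     ∎

  Full-1 : ∀ {S} → Full S 1#
  Full-1 {S} = ≡.trans (⟨⟩-cong (λ P → ν-∣1 P ∣ʳ-refl) S) (≡.trans (⟨0⟩ S) (≡.sym deg-1))

  Full-^ : ∀ {S f} n → f ≉ 0# → Full S f → Full S (f ^ n)
  Full-^ {S} zero    f≉0 full = Full-1 {S}
  Full-^ {S} (suc n) f≉0 full = Full-* {S} f≉0 (^-≉0 n f≉0) full (Full-^ {S} n f≉0 full)

  -- Valuations and degrees are additive and `⟨ν⟩≤deg` bounds both factors, so equality for a
  -- product forces equality for each. One list for a large product thus serves all its divisors.
  Full-∣ : ∀ {S f g} → AllPairs Distinct S → g ≉ 0# → f ∣ g → Full S g → Full S f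
  Full-∣ {S} {f} {g} dist g≉0 (q , qf≈g) full = ℕ.≤-antisym (⟨ν⟩≤deg dist f≉0)
    (ℕ.+-cancelˡ-≤ (deg q) _ _ (let open ℕ.≤-Reasoning in begin
      deg q ℕ.+ deg f                                 ≡⟨ deg-* q≉0 f≉0 ⟨
      deg (q * f)                                     ≡⟨ deg-cong qf≈g ⟩
      deg g                                           ≡⟨ full ⟨
      ⟨ (λ P → ν P g) ⟩ S                             ≡⟨ ⟨⟩-cong (λ P → ≡.trans (ν-cong P g≉0 (sym qf≈g)) (ν-* P q≉0 f≉0)) S ⟩
      ⟨ (λ P → ν P q ℕ.+ ν P f) ⟩ S                   ≡⟨ ⟨⟩-+ (λ P → ν P q) (λ P → ν P f) S ⟩
      ⟨ (λ P → ν P q) ⟩ S ℕ.+ ⟨ (λ P → ν P f) ⟩ S     ≤⟨ ℕ.+-monoˡ-≤ _ (⟨ν⟩≤deg dist q≉0) ⟩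
      deg q ℕ.+ ⟨ (λ P → ν P f) ⟩ S                   ∎))
    where
    q≉0 = *-≉0ˡ (≉-cong (sym qf≈g) g≉0)
    f≉0 = *-≉0ʳ (≉-cong (sym qf≈g) g≉0)

-- Derivations, Wronskians and the order of a logarithmic derivative.

prime⇒coprime′ : ∀ {p n} → Prime p → ¬ p ℕ.∣ n → ℕ.Coprime n p
prime⇒coprime′ pp p∤n (d∣n , d∣p) with prime⇒irreducible pp d∣p
... | inj₁ d≡1    = d≡1
... | inj₂ ≡.refl = contradiction d∣n p∤n

module Wronskian {p : ℕ} (pp : Prime p) (R : PolynomialRing p) where
  open Valuation pp R public
  open Place
  open import Algebra.Properties.Ring ring using (x+x≈x⇒x≈0)
  open import Algebra.Properties.AbelianGroup +-abelianGroup using (inverseʳ-unique)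

  D-0 : D 0# ≈ 0#
  D-0 = x+x≈x⇒x≈0 (D 0#) (trans (sym (D-+ 0# 0#)) (D-cong (+-identityˡ 0#)))

  D-1 : D 1# ≈ 0#
  D-1 = x+x≈x⇒x≈0 (D 1#) (trans (sym (+-cong (*-identityʳ _) (*-identityˡ _)))
    (trans (sym (D-* 1# 1#)) (D-cong (*-identityˡ 1#))))

  D-neg : ∀ f → D (- f) ≈ - D f
  D-neg f = inverseʳ-unique (D f) (D (- f)) (trans (sym (D-+ f (- f))) (trans (D-cong (-‿inverseʳ f)) D-0))

  -- The extra factor `f` keeps the exponent `n - 1` out of the statement.
  f*D-^ : ∀ f n → f * D (f ^ n) ≈ (n ×ₙ 1#) * f ^ n * D f
  f*D-^ f zero    = let open ≈-Reasoning in begin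
    f * D 1#             ≈⟨ *-congˡ D-1 ⟩
    f * 0#               ≈⟨ zeroʳ f ⟩
    0#                   ≈⟨ zeroˡ _ ⟨
    0# * D f             ≈⟨ *-congʳ (zeroˡ _) ⟨
    0# * 1# * D f        ∎
  f*D-^ f (suc n) = let open ≈-Reasoning in begin
    f * D (f * f ^ n)                                 ≈⟨ *-congˡ (D-* f (f ^ n)) ⟩
    f * (D f * f ^ n + f * D (f ^ n))                 ≈⟨ *-congˡ (+-congˡ (f*D-^ f n)) ⟩
    f * (D f * f ^ n + (n ×ₙ 1#) * f ^ n * D f)       ≈⟨ *-congˡ (+-congʳ (*-identityˡ _)) ⟨
    f * (1# * (D f * f ^ n) + (n ×ₙ 1#) * f ^ n * D f)
      ≈⟨ solve 5 (λ f d x n o → f :* (o :* (d :* x) :+ n :* x :* d) := (o :+ n) :* (f :* x) :* d) refl f (D f) (f ^ n) (n ×ₙ 1#) 1# ⟩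
    (1# + n ×ₙ 1#) * (f * f ^ n) * D f                ∎

  D-^ : ∀ {f} n → f ≉ 0# → D (f ^ suc n) ≈ (suc n ×ₙ 1#) * (f ^ n * D f)
  D-^ {f} n f≉0 = *-cancelˡ f f≉0 (trans (f*D-^ f (suc n))
    (solve 4 (λ f x d c → c :* (f :* x) :* d := f :* (c :* (x :* d))) refl f (f ^ n) (D f) (suc n ×ₙ 1#)))

  ×-unit : ∀ {n} → ¬ p ℕ.∣ n → n ×ₙ 1# ∣ 1#
  ×-unit {n} p∤n with ℕ.coprime-Bézout (prime⇒coprime′ pp p∤n)
  ... | Bézout.+- x y eq = x ×ₙ 1# , (let open ≈-Reasoning in begin
    (x ×ₙ 1#) * (n ×ₙ 1#)        ≈⟨ ×1-homo-* x n ⟨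
    (x ℕ.* n) ×ₙ 1#              ≈⟨ ×-congˡ (≡.sym eq) ⟩
    1# + (y ℕ.* p) ×ₙ 1#         ≈⟨ +-congˡ (×-vanishes char (ℕ.divides y ≡.refl) 1#) ⟩
    1# + 0#                      ≈⟨ +-identityʳ 1# ⟩
    1#                           ∎)
  ... | Bézout.-+ x y eq = - (x ×ₙ 1#) , (let open ≈-Reasoning in begin
    - (x ×ₙ 1#) * (n ×ₙ 1#)                ≈⟨ solve 3 (λ x n o → (:- x) :* n := o :- (o :+ x :* n)) refl (x ×ₙ 1#) (n ×ₙ 1#) 1# ⟩
    1# - (1# + (x ×ₙ 1#) * (n ×ₙ 1#))      ≈⟨ +-congˡ (-‿cong (+-congˡ (×1-homo-* x n))) ⟨
    1# - (suc (x ℕ.* n)) ×ₙ 1#             ≈⟨ +-congˡ (-‿cong (×-congˡ eq)) ⟩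
    1# - (y ℕ.* p) ×ₙ 1#                   ≈⟨ +-congˡ (-‿cong (×-vanishes char (ℕ.divides y ≡.refl) 1#)) ⟩
    1# - 0#                                ≈⟨ trans (+-congˡ -0#≈0#) (+-identityʳ 1#) ⟩
    1#                                     ∎)

  ×-difference : ∀ m n → (m ×ₙ 1# - n ×ₙ 1# ≈ ∣ m - n ∣ ×ₙ 1#) ⊎ (m ×ₙ 1# - n ×ₙ 1# ≈ - (∣ m - n ∣ ×ₙ 1#))
  ×-difference m n with ℕ.≤-total m n
  ... | inj₁ m≤n = inj₂ (let open ≈-Reasoning in begin
    m ×ₙ 1# - n ×ₙ 1#                              ≈⟨ +-congˡ (-‿cong (×-congˡ (≡.sym (ℕ.m+[n∸m]≡n m≤n)))) ⟩
    m ×ₙ 1# - (m ℕ.+ (n ℕ.∸ m)) ×ₙ 1#              ≈⟨ +-congˡ (-‿cong (×-homo-+ 1# m (n ℕ.∸ m))) ⟩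
    m ×ₙ 1# - (m ×ₙ 1# + (n ℕ.∸ m) ×ₙ 1#)          ≈⟨ solve 2 (λ x y → x :- (x :+ y) := :- y) refl _ _ ⟩
    - ((n ℕ.∸ m) ×ₙ 1#)                            ≈⟨ -‿cong (×-congˡ (≡.sym (ℕ.m≤n⇒∣m-n∣≡n∸m m≤n))) ⟩
    - (∣ m - n ∣ ×ₙ 1#)                            ∎)
  ... | inj₂ n≤m = inj₁ (let open ≈-Reasoning in begin
    m ×ₙ 1# - n ×ₙ 1#                              ≈⟨ +-congʳ (×-congˡ (≡.sym (ℕ.m+[n∸m]≡n n≤m))) ⟩
    (n ℕ.+ (m ℕ.∸ n)) ×ₙ 1# - n ×ₙ 1#              ≈⟨ +-congʳ (×-homo-+ 1# n (m ℕ.∸ n)) ⟩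
    n ×ₙ 1# + (m ℕ.∸ n) ×ₙ 1# - n ×ₙ 1#            ≈⟨ solve 2 (λ x y → x :+ y :- x := y) refl _ _ ⟩
    (m ℕ.∸ n) ×ₙ 1#                                ≈⟨ ×-congˡ (≡.sym (ℕ.m≤n⇒∣n-m∣≡n∸m n≤m)) ⟩
    ∣ m - n ∣ ×ₙ 1#                                ∎)

  -- `W f g / (f g)` is dlog (g / f), so `W f g` vanishes exactly when f / g has derivative zero.
  W : Carrier → Carrier → Carrier
  W f g = f * D g - D f * g

  W-cong : ∀ {f f′ g g′} → f ≈ f′ → g ≈ g′ → W f g ≈ W f′ g′
  W-cong f≈ g≈ = +-cong (*-cong f≈ (D-cong g≈)) (-‿cong (*-cong (D-cong f≈) g≈))

  deg-W : ∀ {f g} → f ≉ 0# → g ≉ 0# → W f g ≉ 0# → deg (W f g) ℕ.< deg f ℕ.+ deg g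
  deg-W {f} {g} f≉0 g≉0 W≉0 = difference small₁ small₂ W≉0
    where
    n = deg f ℕ.+ deg g
    small₁ : f * D g ≈ 0# ⊎ deg (f * D g) ℕ.< n
    small₁ with ≈0? (D g) | D-deg g
    ... | yes Dg≈0 | _          = inj₁ (trans (*-congˡ Dg≈0) (zeroʳ f))
    ... | no  Dg≉0 | inj₁ Dg≈0  = contradiction Dg≈0 Dg≉0
    ... | no  Dg≉0 | inj₂ lt    = inj₂ (≡.subst (ℕ._< n) (≡.sym (deg-* f≉0 Dg≉0)) (ℕ.+-monoʳ-< (deg f) lt))
    small₂ : D f * g ≈ 0# ⊎ deg (D f * g) ℕ.< n
    small₂ with ≈0? (D f) | D-deg f
    ... | yes Df≈0 | _          = inj₁ (trans (*-congʳ Df≈0) (zeroˡ g))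
    ... | no  Df≉0 | inj₁ Df≈0  = contradiction Df≈0 Df≉0
    ... | no  Df≉0 | inj₂ lt    = inj₂ (≡.subst (ℕ._< n) (≡.sym (deg-* Df≉0 g≉0)) (ℕ.+-monoˡ-< (deg g) lt))
    difference : ∀ {x y} → x ≈ 0# ⊎ deg x ℕ.< n → y ≈ 0# ⊎ deg y ℕ.< n → x - y ≉ 0# → deg (x - y) ℕ.< n
    difference {x} {y} (inj₁ x≈0) (inj₁ y≈0) ≉0 =
      contradiction (trans (+-cong x≈0 (-‿cong y≈0)) (-‿inverseʳ 0#)) ≉0
    difference {x} {y} (inj₁ x≈0) (inj₂ lt) _ = ≡.subst (ℕ._< n)
      (≡.trans (≡.sym (deg-neg y)) (deg-cong (sym (trans (+-congʳ x≈0) (+-identityˡ _))))) lt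
    difference {x} {y} (inj₂ lt) (inj₁ y≈0) _ = ≡.subst (ℕ._< n)
      (deg-cong (sym (trans (+-congˡ (trans (-‿cong y≈0) -0#≈0#)) (+-identityʳ _)))) lt
    difference {x} {y} (inj₂ lt) (inj₂ lt′) _ = ℕ.≤-<-trans (deg-+ x (- y))
      (ℕ.⊔-lub lt (≡.subst (ℕ._< n) (≡.sym (deg-neg y)) lt′))

  ν-prime : ∀ P → ν P (prime P) ≡ 1
  ν-prime P = ν-unique P 1 (sym (trans (*-identityʳ _) (*-identityʳ _))) (prime∤1 P)

  ^-≉0⁻ : ∀ {f} n .{{_ : ℕ.NonZero n}} → f ^ n ≉ 0# → f ≉ 0#
  ^-≉0⁻ (suc n) = *-≉0ˡ

  -- F_p is perfect: an element with vanishing derivative is a p-th power, so primes are separable.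
  prime∤Dprime : ∀ P → ¬ prime P ∣ D (prime P)
  prime∤Dprime P π∣Dπ with D-root ([ (λ z → z) , (λ lt → ∣⇒≈0 lt π∣Dπ) ]′ (D-deg (prime P)))
  ... | u , π≈u^p = ℕ.>⇒∤ (ℕ.nonTrivial⇒n>1 p {{prime⇒nonTrivial pp}}) (ℕ.divides (ν P u)
    (let open ≡.≡-Reasoning in begin
      1                  ≡⟨ ν-prime P ⟨
      ν P (prime P)      ≡⟨ ν-cong P (prime≉0 P) π≈u^p ⟩
      ν P (u ^ p)        ≡⟨ ν-^ P p (^-≉0⁻ p {{prime⇒nonZero pp}} (≉-cong π≈u^p (prime≉0 P))) ⟩
      p ℕ.* ν P u        ≡⟨ ℕ.*-comm p _ ⟩
      ν P u ℕ.* p        ∎))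

  -- The order of dlog (f / g) is `z - r`. With f = π^e a and g = π^m b one gets π W f g = π^(e+m)
  -- C, where C = (m - e) π′ a b + π W a b; as π divides neither π′ nor a b, it divides C exactly
  -- when p divides m - e.
  ν-W : ∀ P {f g} → f ≉ 0# → g ≉ 0# → W f g ≉ 0# →
        let r = ramification p (ν P f) (ν P g) in
        ∃[ z ] (ν P (W f g) ℕ.+ r ≡ ν P f ℕ.+ ν P g ℕ.+ z × (r ≡ 1 → z ≡ 0))
  ν-W P {f} {g} f≉0 g≉0 W≉0 with ν-factor P f≉0 | ν-factor P g≉0
  ... | a , f≈ , π∤a | b , g≈ , π∤b = answer
    where
    π = prime P
    e = ν P f
    m = ν P g
    E = π ^ e
    M = π ^ m
    c = m ×ₙ 1# - e ×ₙ 1#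
    C = c * (D π * (a * b)) + π * W a b
    π*W≈ : π * W f g ≈ π ^ (e ℕ.+ m) * C
    π*W≈ = let open ≈-Reasoning in begin
      π * W f g                  ≈⟨ *-congˡ (W-cong f≈ g≈) ⟩
      π * W (E * a) (M * b)      ≈⟨ *-congˡ (+-cong (*-congˡ (D-* M b)) (-‿cong (*-congʳ (D-* E a)))) ⟩
      π * (E * a * (D M * b + M * D b) - (D E * a + E * D a) * (M * b))
        ≈⟨ solve 9 (λ π E M a b DE DM Da Db →
             π :* (E :* a :* (DM :* b :+ M :* Db) :- (DE :* a :+ E :* Da) :* (M :* b)) :=
             E :* a :* b :* (π :* DM) :- M :* a :* b :* (π :* DE) :+ E :* M :* (π :* (a :* Db :- Da :* b)))
           refl π E M a b (D E) (D M) (D a) (D b) ⟩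
      E * a * b * (π * D M) - M * a * b * (π * D E) + E * M * (π * W a b)
        ≈⟨ +-congʳ (+-cong (*-congˡ (f*D-^ π m)) (-‿cong (*-congˡ (f*D-^ π e)))) ⟩
      E * a * b * ((m ×ₙ 1#) * M * D π) - M * a * b * ((e ×ₙ 1#) * E * D π) + E * M * (π * W a b)
        ≈⟨ solve 8 (λ E M a b m e Dπ w →
             E :* a :* b :* (m :* M :* Dπ) :- M :* a :* b :* (e :* E :* Dπ) :+ E :* M :* w :=
             E :* M :* ((m :- e) :* (Dπ :* (a :* b)) :+ w))
           refl E M a b (m ×ₙ 1#) (e ×ₙ 1#) (D π) (π * W a b) ⟩
      E * M * C                  ≈⟨ *-congʳ (^-homo-* π e m) ⟨
      π ^ (e ℕ.+ m) * C          ∎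
    C≉0 : C ≉ 0#
    C≉0 = *-≉0ʳ (≉-cong π*W≈ (*-≉0 (prime≉0 P) W≉0))
    νC : suc (ν P (W f g)) ≡ e ℕ.+ m ℕ.+ ν P C
    νC = let open ≡.≡-Reasoning in begin
      1 ℕ.+ ν P (W f g)               ≡⟨ ≡.cong (ℕ._+ ν P (W f g)) (ν-prime P) ⟨
      ν P π ℕ.+ ν P (W f g)           ≡⟨ ν-* P (prime≉0 P) W≉0 ⟨
      ν P (π * W f g)                 ≡⟨ ν-cong P (*-≉0 (prime≉0 P) W≉0) π*W≈ ⟩
      ν P (π ^ (e ℕ.+ m) * C)         ≡⟨ ν-* P (^-≉0 (e ℕ.+ m) (prime≉0 P)) C≉0 ⟩
      ν P (π ^ (e ℕ.+ m)) ℕ.+ ν P C   ≡⟨ ≡.cong (ℕ._+ ν P C) (≡.trans (ν-^ P (e ℕ.+ m) (prime≉0 P)) (≡.trans (≡.cong ((e ℕ.+ m) ℕ.*_) (ν-prime P)) (ℕ.*-identityʳ _))) ⟩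
      e ℕ.+ m ℕ.+ ν P C               ∎
    answer : ∃[ z ] (ν P (W f g) ℕ.+ ramification p e m ≡ e ℕ.+ m ℕ.+ z × (ramification p e m ≡ 1 → z ≡ 0))
    answer with p ℕ.∣? ∣ e - m ∣
    -- One factor π of `C` pays for the π that was multiplied onto the Wronskian, hence the
    -- predecessor.
    ... | yes p∣ = ℕ.pred (ν P C) , eq , λ ()
      where
      c≈0 : c ≈ 0#
      c≈0 = [ (λ x → trans x 0′) , (λ x → trans x (trans (-‿cong 0′) -0#≈0#)) ]′ (×-difference m e)
        where
        0′ : ∣ m - e ∣ ×ₙ 1# ≈ 0#
        0′ = ×-vanishes char (≡.subst (p ℕ.∣_) (ℕ.∣-∣-comm e m) p∣) 1#
      1≤νC : 1 ℕ.≤ ν P C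
      1≤νC = ^∣⇒≤ν P 1 C≉0 (∣ʳ-respʳ-≈ (sym (trans (+-congʳ (trans (*-congʳ c≈0) (zeroˡ _))) (+-identityˡ _)))
        (∣-*ʳ _ (1# , trans (*-identityˡ _) (*-identityʳ π))))
      eq : ν P (W f g) ℕ.+ 0 ≡ e ℕ.+ m ℕ.+ ℕ.pred (ν P C)
      eq = ℕ.suc-injective (≡.trans (≡.cong suc (ℕ.+-identityʳ _)) (≡.trans νC
        (≡.trans (≡.cong (e ℕ.+ m ℕ.+_) (≡.sym (ℕ.suc-pred _ {{ℕ.>-nonZero 1≤νC}}))) (ℕ.+-suc _ _))))
    ... | no p∤ = 0 , ≡.trans (ℕ.+-comm _ 1) (≡.trans νC (≡.cong (e ℕ.+ m ℕ.+_) (ν-∤ P π∤C))) , λ _ → ≡.refl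
      where
      unit : ∣ m - e ∣ ×ₙ 1# ∣ 1#
      unit = ×-unit (λ p∣ → p∤ (≡.subst (p ℕ.∣_) (ℕ.∣-∣-comm m e) p∣))
      π∤c : ¬ π ∣ c
      π∤c π∣c = prime∤1 P (∣ʳ-trans ([ (λ x → ∣ʳ-respʳ-≈ x π∣c) , (λ x → ∣ʳ-respʳ-≈ (trans (-‿cong x) (-‿involutive _)) (∣-neg π∣c)) ]′ (×-difference m e)) unit)
        where open import Algebra.Properties.Ring ring using (-‿involutive)
      π∤C : ¬ π ∣ C
      π∤C π∣C = ∤-* P π∤c (∤-* P (prime∤Dprime P) (∤-* P π∤a π∤b))
        (∣-+-cancelʳ π∣C (∣-*ʳ _ ∣ʳ-refl))

-- The Mason-Stothers inequality after extraction of p-power roots.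

module MasonStothers {p : ℕ} (pp : Prime p) (R : PolynomialRing p) where
  open Wronskian pp R public
  open Place
  open import Algebra.Properties.AbelianGroup +-abelianGroup using (inverseʳ-unique)

  instance
    p≢0 : ℕ.NonZero p
    p≢0 = prime⇒nonZero pp

  1<p : 1 ℕ.< p
  1<p = ℕ.nonTrivial⇒n>1 p {{prime⇒nonTrivial pp}}

  rotate : ∀ {a b c} → a + b + c ≈ 0# → b + c + a ≈ 0#
  rotate {a} {b} {c} a+b+c≈0 = trans (solve 3 (λ a b c → b :+ c :+ a := a :+ b :+ c) refl a b c) a+b+c≈0

  third≈ : ∀ {a b c} → a + b + c ≈ 0# → c ≈ - (a + b)
  third≈ {a} {b} {c} = inverseʳ-unique (a + b) c

  -- Substituting c = -(a + b) shows that a triple with sum zero has a single Wronskian, which may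
  -- be computed from whichever two members are convenient at a place.
  W-rotate : ∀ {a b c} → a + b + c ≈ 0# → W b c ≈ W a b
  W-rotate {a} {b} {c} a+b+c≈0 = let open ≈-Reasoning in begin
    b * D c - D b * c                      ≈⟨ +-cong (*-congˡ (trans (D-cong (third≈ a+b+c≈0)) (trans (D-neg (a + b)) (-‿cong (D-+ a b)))))
                                                     (-‿cong (*-congˡ (third≈ a+b+c≈0))) ⟩
    b * - (D a + D b) - D b * - (a + b)    ≈⟨ solve 4 (λ a b x y → b :* (:- (x :+ y)) :- y :* (:- (a :+ b)) := a :* y :- x :* b) refl a b (D a) (D b) ⟩
    a * D b - D a * b                      ∎

  support : Carrier → Place → ℕ
  support a P = 1 ℕ.⊓ ν P a

  -- A pole of dlog (a / b) sits at a zero of a or of b, so the supports absorb the possible loss of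
  -- 1.
  ν≤W : ∀ P {a b} → a ≉ 0# → b ≉ 0# → W a b ≉ 0# →
        ν P a ℕ.+ ν P b ℕ.≤ ν P (W a b) ℕ.+ (support a P ℕ.+ support b P)
  ν≤W P {a} {b} a≉0 b≉0 W≉0 with ν-W P a≉0 b≉0 W≉0
  ... | z , eq , _ = bound (ν P a) (ν P b) (ν P (W a b)) z (ramification≤1 (ν P a) (ν P b)) eq
    where
    ramification≤1 : ∀ e m → ramification p e m ℕ.≤ 1
    ramification≤1 e m with p ℕ.∣? ∣ e - m ∣
    ... | yes _ = ℕ.z≤n
    ... | no  _ = ℕ.≤-refl
    weaken : ∀ e m w z s {r} → r ℕ.≤ 1 → 1 ℕ.≤ s → w ℕ.+ r ≡ e ℕ.+ m ℕ.+ z → e ℕ.+ m ℕ.≤ w ℕ.+ s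
    weaken e m w z s {r} r≤1 1≤s eq = let open ℕ.≤-Reasoning in begin
      e ℕ.+ m            ≤⟨ ℕ.m≤m+n (e ℕ.+ m) z ⟩
      e ℕ.+ m ℕ.+ z      ≡⟨ eq ⟨
      w ℕ.+ r            ≤⟨ ℕ.+-monoʳ-≤ w (ℕ.≤-trans r≤1 1≤s) ⟩
      w ℕ.+ s            ∎
    bound : ∀ e m w z {r} → r ℕ.≤ 1 → w ℕ.+ r ≡ e ℕ.+ m ℕ.+ z →
            e ℕ.+ m ℕ.≤ w ℕ.+ (1 ℕ.⊓ e ℕ.+ 1 ℕ.⊓ m)
    bound zero    zero    w z r≤1 eq = ℕ.z≤n
    bound zero    (suc m) w z r≤1 eq = weaken 0 (suc m) w z 1 r≤1 ℕ.≤-refl eq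
    bound (suc e) m       w z r≤1 eq = weaken (suc e) m w z (1 ℕ.+ 1 ℕ.⊓ m) r≤1 (ℕ.s≤s ℕ.z≤n) eq

  record Coprime₃ (a b c : Carrier) : Set where
    constructor coprime₃
    field
      a≉0   : a ≉ 0#
      b≉0   : b ≉ 0#
      c≉0   : c ≉ 0#
      sum≈0 : a + b + c ≈ 0#
      ab    : ∀ P → ν P a ≡ 0 ⊎ ν P b ≡ 0
      bc    : ∀ P → ν P b ≡ 0 ⊎ ν P c ≡ 0
      ca    : ∀ P → ν P c ≡ 0 ⊎ ν P a ≡ 0

  Coprime₃-rotate : ∀ {a b c} → Coprime₃ a b c → Coprime₃ b c a
  Coprime₃-rotate (coprime₃ a≉0 b≉0 c≉0 sum≈0 ab bc ca) = coprime₃ b≉0 c≉0 a≉0 (rotate sum≈0) bc ca ab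

  -- At every place a or b has valuation 0, and the Wronskian of the remaining pair bounds the sum
  -- of all three valuations by ν(W) plus the supports. Summed over S, deg W is at most deg a + deg
  -- b, and only deg c is left.
  mason : ∀ {a b c S} → Coprime₃ a b c → W a b ≉ 0# → AllPairs Distinct S →
          Full S a → Full S b → Full S c →
          deg c ℕ.≤ ⟨ (λ P → support a P ℕ.+ support b P ℕ.+ support c P) ⟩ S
  mason {a} {b} {c} {S} (coprime₃ a≉0 b≉0 c≉0 sum≈0 ab bc ca) W≉0 distinct full-a full-b full-c =
    ℕ.+-cancelˡ-≤ (deg a ℕ.+ deg b) _ _ (let open ℕ.≤-Reasoning in begin
      deg a ℕ.+ deg b ℕ.+ deg c                     ≡⟨ ≡.cong₂ ℕ._+_ (≡.cong₂ ℕ._+_ full-a full-b) full-c ⟨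
      ⟨ νa ⟩ S ℕ.+ ⟨ νb ⟩ S ℕ.+ ⟨ νc ⟩ S            ≡⟨ ≡.cong (ℕ._+ ⟨ νc ⟩ S) (⟨⟩-+ νa νb S) ⟨
      ⟨ (λ P → νa P ℕ.+ νb P) ⟩ S ℕ.+ ⟨ νc ⟩ S      ≡⟨ ⟨⟩-+ (λ P → νa P ℕ.+ νb P) νc S ⟨
      ⟨ (λ P → νa P ℕ.+ νb P ℕ.+ νc P) ⟩ S          ≤⟨ ⟨⟩-mono local S ⟩
      ⟨ (λ P → νw P ℕ.+ n P) ⟩ S                    ≡⟨ ⟨⟩-+ νw n S ⟩
      ⟨ νw ⟩ S ℕ.+ ⟨ n ⟩ S                          ≤⟨ ℕ.+-monoˡ-≤ (⟨ n ⟩ S) (ℕ.≤-trans (⟨ν⟩≤deg distinct W≉0) (ℕ.<⇒≤ (deg-W a≉0 b≉0 W≉0))) ⟩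
      deg a ℕ.+ deg b ℕ.+ ⟨ n ⟩ S                   ∎)
    where
    νa = λ P → ν P a
    νb = λ P → ν P b
    νc = λ P → ν P c
    νw = λ P → ν P (W a b)
    n = λ P → support a P ℕ.+ support b P ℕ.+ support c P
    Wbc≈ : W b c ≈ W a b
    Wbc≈ = W-rotate sum≈0
    Wca≈ : W c a ≈ W a b
    Wca≈ = trans (W-rotate (rotate sum≈0)) Wbc≈
    Wbc≉0 = ≉-cong (sym Wbc≈) W≉0
    Wca≉0 = ≉-cong (sym Wca≈) W≉0
    at-a : ∀ {x y z w} → x ≡ 0 → y ℕ.+ z ℕ.≤ w ℕ.+ (1 ℕ.⊓ y ℕ.+ 1 ℕ.⊓ z) →
           x ℕ.+ y ℕ.+ z ℕ.≤ w ℕ.+ (1 ℕ.⊓ x ℕ.+ 1 ℕ.⊓ y ℕ.+ 1 ℕ.⊓ z)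
    at-a ≡.refl le = le
    at-b : ∀ {x y z w} → y ≡ 0 → z ℕ.+ x ℕ.≤ w ℕ.+ (1 ℕ.⊓ z ℕ.+ 1 ℕ.⊓ x) →
           x ℕ.+ y ℕ.+ z ℕ.≤ w ℕ.+ (1 ℕ.⊓ x ℕ.+ 1 ℕ.⊓ y ℕ.+ 1 ℕ.⊓ z)
    at-b {x} {_} {z} ≡.refl le rewrite ℕ.+-identityʳ x | ℕ.+-identityʳ (1 ℕ.⊓ x)
      | ℕ.+-comm x z | ℕ.+-comm (1 ℕ.⊓ x) (1 ℕ.⊓ z) = le
    local : ∀ P → νa P ℕ.+ νb P ℕ.+ νc P ℕ.≤ νw P ℕ.+ n P
    local P with ab P | bc P
    ... | inj₁ a0 | _       = at-a {w = νw P} a0 (≡.subst (λ w → _ ℕ.≤ w ℕ.+ (support b P ℕ.+ support c P)) (ν-cong P Wbc≉0 Wbc≈) (ν≤W P b≉0 c≉0 Wbc≉0))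
    ... | inj₂ b0 | _       = at-b {x = νa P} {z = νc P} {w = νw P} b0 (≡.subst (λ w → _ ℕ.≤ w ℕ.+ (support c P ℕ.+ support a P)) (ν-cong P Wca≉0 Wca≈) (ν≤W P c≉0 a≉0 Wca≉0))

  -- The second alternative of `nondegenerate` is where root extraction would never stop: elements
  -- of degree 0 have derivative zero and remain p-th powers forever. The required degree bounds are
  -- then trivial.
  record PrimitiveRoot (x y z : Carrier) : Set where
    field
      s            : ℕ
      γ a b c      : Carrier
      x≈           : x ≈ γ * a ^ (p ℕ.^ s)
      y≈           : y ≈ γ * b ^ (p ℕ.^ s)
      z≈           : z ≈ γ * c ^ (p ℕ.^ s)
      coprime      : Coprime₃ a b c
      nondegenerate : W a b ≉ 0# ⊎ (deg a ≡ 0 × deg b ≡ 0 × deg c ≡ 0)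

  bézout⇒coprime : ∀ {a b u v} → u * a + v * b ≈ 1# → ∀ P → prime P ∣ a → ¬ prime P ∣ b
  bézout⇒coprime eq P π∣a π∣b = prime∤1 P (∣ʳ-respʳ-≈ eq (∣-+ (∣-*ˡ _ π∣a) (∣-*ˡ _ π∣b)))

  coprime⇒ν : ∀ {f g} → (∀ P → prime P ∣ f → ¬ prime P ∣ g) → ∀ P → ν P f ≡ 0 ⊎ ν P g ≡ 0
  coprime⇒ν {f} {g} h P with ν P f ℕ.≟ 0 | ν P g ℕ.≟ 0
  ... | yes eq | _      = inj₁ eq
  ... | no  _  | yes eq = inj₂ eq
  ... | no  ne | no ne′ = contradiction (ν≥1⇒∣ P ne′) (h P (ν≥1⇒∣ P ne))

  bézout⇒Coprime₃ : ∀ {a b c u v} → a ≉ 0# → b ≉ 0# → c ≉ 0# → a + b + c ≈ 0# → u * a + v * b ≈ 1# → Coprime₃ a b c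
  bézout⇒Coprime₃ {a} {b} {c} a≉0 b≉0 c≉0 sum≈0 eq = coprime₃ a≉0 b≉0 c≉0 sum≈0
    (coprime⇒ν ab)
    (coprime⇒ν (λ P π∣b π∣c → ab P (third (rotate sum≈0) π∣b π∣c) π∣b))
    (coprime⇒ν (λ P π∣c π∣a → ab P π∣a (third (rotate (rotate sum≈0)) π∣c π∣a)))
    where
    ab : ∀ P → prime P ∣ a → ¬ prime P ∣ b
    ab = bézout⇒coprime eq
    third : ∀ {π x y z} → x + y + z ≈ 0# → π ∣ x → π ∣ y → π ∣ z
    third x+y+z≈0 π∣x π∣y = ∣ʳ-respʳ-≈ (sym (third≈ x+y+z≈0)) (∣-neg (∣-+ π∣x π∣y))

  ∣D⇒D≈0 : ∀ {f} → f ∣ D f → D f ≈ 0#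
  ∣D⇒D≈0 {f} f∣Df = [ (λ z → z) , (λ lt → ∣⇒≈0 lt f∣Df) ]′ (D-deg f)

  -- Bézout turns W a b = 0 into a ∣ D a, while D lowers the degree.
  W≈0⇒D≈0ˡ : ∀ {a b u v} → u * a + v * b ≈ 1# → W a b ≈ 0# → D a ≈ 0#
  W≈0⇒D≈0ˡ {a} {b} {u} {v} eq W≈0 = ∣D⇒D≈0 (u * D a + v * D b , (let open ≈-Reasoning in begin
    (u * D a + v * D b) * a                ≈⟨ solve 6 (λ u v a b x y → (u :* x :+ v :* y) :* a := x :* (u :* a :+ v :* b) :+ v :* (a :* y :- x :* b)) refl u v a b (D a) (D b) ⟩
    D a * (u * a + v * b) + v * W a b      ≈⟨ +-cong (*-congˡ eq) (*-congˡ W≈0) ⟩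
    D a * 1# + v * 0#                      ≈⟨ +-cong (*-identityʳ _) (zeroʳ v) ⟩
    D a + 0#                               ≈⟨ +-identityʳ _ ⟩
    D a                                    ∎))

  W-antisym : ∀ a b → W b a ≈ - W a b
  W-antisym a b = solve 4 (λ a b x y → b :* x :- y :* a := :- (a :* y :- x :* b)) refl a b (D a) (D b)

  W≈0⇒D≈0ʳ : ∀ {a b u v} → u * a + v * b ≈ 1# → W a b ≈ 0# → D b ≈ 0#
  W≈0⇒D≈0ʳ {a} {b} eq W≈0 = W≈0⇒D≈0ˡ (trans (+-comm _ _) eq)
    (trans (W-antisym a b) (trans (-‿cong W≈0) -0#≈0#))

  0^≈0 : ∀ n .{{_ : ℕ.NonZero n}} → 0# ^ n ≈ 0#
  0^≈0 (suc n) = zeroˡ _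

  frobenius-sum : ∀ {a b c} → a + b + c ≈ 0# → a ^ p + b ^ p + c ^ p ≈ 0#
  frobenius-sum {a} {b} {c} eq = let open ≈-Reasoning in begin
    a ^ p + b ^ p + c ^ p    ≈⟨ +-congʳ (frobenius-+ char a b) ⟨
    (a + b) ^ p + c ^ p      ≈⟨ frobenius-+ char (a + b) c ⟨
    (a + b + c) ^ p          ≈⟨ ^-congˡ p eq ⟩
    0# ^ p                   ≈⟨ 0^≈0 p ⟩
    0#                       ∎

  ^-split : ∀ {f g} → f ≈ g ^ p → ∃[ h ] f ≈ h * g
  ^-split {f} {g} f≈ = go p f≈
    where
    go : ∀ n .{{_ : ℕ.NonZero n}} → f ≈ g ^ n → ∃[ h ] f ≈ h * g
    go (suc n) eq = g ^ n , trans eq (*-comm g _)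

  -- Coprimality is kept as a Bézout identity rather than place by place: the identity is what makes
  -- the derivatives vanish, and it passes to p-th roots, since a p-th power is a multiple of its
  -- root.
  record CoprimeSum (a b c : Carrier) : Set where
    constructor coprimeSum
    field
      a≉0    : a ≉ 0#
      b≉0    : b ≉ 0#
      c≉0    : c ≉ 0#
      sum≈0  : a + b + c ≈ 0#
      u v    : Carrier
      bézout : u * a + v * b ≈ 1#

  unrooted : ∀ {a b c} → CoprimeSum a b c →
             W a b ≉ 0# ⊎ (deg a ≡ 0 × deg b ≡ 0 × deg c ≡ 0) → PrimitiveRoot a b c
  unrooted (coprimeSum a≉0 b≉0 c≉0 sum≈0 u v bez) alt = record
    { s = 0 ; γ = 1# ; x≈ = one ; y≈ = one ; z≈ = one
    ; coprime = bézout⇒Coprime₃ a≉0 b≉0 c≉0 sum≈0 bez ; nondegenerate = alt }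
    where
    one : ∀ {f} → f ≈ 1# * f ^ 1
    one {f} = sym (trans (*-identityˡ _) (*-identityʳ f))

  constant : ∀ {a b c} → CoprimeSum a b c → deg a ℕ.+ deg b ≡ 0 → PrimitiveRoot a b c
  constant {a} {b} {c} t degs≡0 = unrooted t (inj₂ (deg-a , deg-b , ℕ.n≤0⇒n≡0 deg-c))
    where
    deg-a = ℕ.m+n≡0⇒m≡0 (deg a) degs≡0
    deg-b = ℕ.m+n≡0⇒n≡0 (deg a) degs≡0
    deg-c : deg c ℕ.≤ 0
    deg-c = let open ℕ.≤-Reasoning in begin
      deg c                ≡⟨ deg-cong (third≈ (CoprimeSum.sum≈0 t)) ⟩
      deg (- (a + b))      ≡⟨ deg-neg (a + b) ⟩
      deg (a + b)          ≤⟨ deg-+ a b ⟩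
      deg a ℕ.⊔ deg b      ≡⟨ ≡.cong₂ ℕ._⊔_ deg-a deg-b ⟩
      0                    ∎

  -- Roots of a and b suffice: additivity of Frobenius makes -(a₁ + b₁) a root of c. The degrees get
  -- divided by p, so the recursive call, passed in as a parameter, is on a smaller sum.
  descend : ∀ {a b c a₁ b₁} → CoprimeSum a b c → deg a ℕ.+ deg b ≢ 0 → a ≈ a₁ ^ p → b ≈ b₁ ^ p →
            (CoprimeSum a₁ b₁ (- (a₁ + b₁)) → deg a₁ ℕ.+ deg b₁ ℕ.< deg a ℕ.+ deg b →
             PrimitiveRoot a₁ b₁ (- (a₁ + b₁))) →
            PrimitiveRoot a b c
  descend {a} {b} {c} {a₁} {b₁} (coprimeSum a≉0 b≉0 c≉0 sum≈0 u v bez) degs≢0 a≈ b≈ rec =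
    lift (rec (coprimeSum a₁≉0 b₁≉0 c₁≉0 sum₁≈0 (u * h) (v * k) bez₁) smaller)
    where
    c₁ = - (a₁ + b₁)
    a₁≉0 = ^-≉0⁻ p (≉-cong a≈ a≉0)
    b₁≉0 = ^-≉0⁻ p (≉-cong b≈ b≉0)
    sum₁≈0 : a₁ + b₁ + c₁ ≈ 0#
    sum₁≈0 = -‿inverseʳ (a₁ + b₁)
    c≈ : c ≈ c₁ ^ p
    c≈ = trans (third≈ sum≈0) (sym (third≈ (trans (+-congʳ (+-cong a≈ b≈)) (frobenius-sum sum₁≈0))))
    c₁≉0 = ^-≉0⁻ p (≉-cong c≈ c≉0)
    h = proj₁ (^-split a≈)
    k = proj₁ (^-split b≈)
    bez₁ : (u * h) * a₁ + (v * k) * b₁ ≈ 1#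
    bez₁ = trans (+-cong (trans (*-assoc u h a₁) (*-congˡ (sym (proj₂ (^-split a≈)))))
                         (trans (*-assoc v k b₁) (*-congˡ (sym (proj₂ (^-split b≈)))))) bez
    p*degs : deg a ℕ.+ deg b ≡ p ℕ.* (deg a₁ ℕ.+ deg b₁)
    p*degs = ≡.trans (≡.cong₂ ℕ._+_ (≡.trans (deg-cong a≈) (deg-^ p a₁≉0)) (≡.trans (deg-cong b≈) (deg-^ p b₁≉0)))
                     (≡.sym (ℕ.*-distribˡ-+ p (deg a₁) (deg b₁)))
    degs₁≢0 : deg a₁ ℕ.+ deg b₁ ≢ 0
    degs₁≢0 eq = degs≢0 (≡.trans p*degs (≡.trans (≡.cong (p ℕ.*_) eq) (ℕ.*-zeroʳ p)))
    smaller : deg a₁ ℕ.+ deg b₁ ℕ.< deg a ℕ.+ deg b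
    smaller = ≡.subst (deg a₁ ℕ.+ deg b₁ ℕ.<_) (≡.trans (ℕ.*-comm _ p) (≡.sym p*degs))
      (ℕ.m<m*n _ p {{ℕ.≢-nonZero degs₁≢0}} 1<p)
    lift : PrimitiveRoot a₁ b₁ c₁ → PrimitiveRoot a b c
    lift r = record
      { s = suc s ; γ = γ ^ p ; x≈ = power a≈ x≈ ; y≈ = power b≈ y≈ ; z≈ = power c≈ z≈
      ; coprime = coprime ; nondegenerate = nondegenerate }
      where
      open PrimitiveRoot r
      power : ∀ {f f₁ g} → f ≈ f₁ ^ p → f₁ ≈ γ * g ^ (p ℕ.^ s) → f ≈ γ ^ p * g ^ (p ℕ.^ suc s)
      power {f} {f₁} {g} f≈ f₁≈ = let open ≈-Reasoning in begin
        f                                ≈⟨ f≈ ⟩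
        f₁ ^ p                           ≈⟨ ^-congˡ p f₁≈ ⟩
        (γ * g ^ (p ℕ.^ s)) ^ p          ≈⟨ ^-distrib-* γ _ p ⟩
        γ ^ p * (g ^ (p ℕ.^ s)) ^ p      ≈⟨ *-congˡ (^-assocʳ g (p ℕ.^ s) p) ⟩
        γ ^ p * g ^ (p ℕ.^ s ℕ.* p)      ≈⟨ *-congˡ (^-congʳ g (ℕ.*-comm (p ℕ.^ s) p)) ⟩
        γ ^ p * g ^ (p ℕ.^ suc s)        ∎

  -- As long as the Wronskian vanishes, coprimality forces both derivatives to vanish
  -- and a p-th root can be extracted.
  root : ∀ {a b c} → CoprimeSum a b c → PrimitiveRoot a b c
  root {a} {b} t = go t (<-wellFounded (deg a ℕ.+ deg b))
    where
    go : ∀ {a b c} → CoprimeSum a b c → Acc ℕ._<_ (deg a ℕ.+ deg b) → PrimitiveRoot a b c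
    cases : ∀ {a b c} → CoprimeSum a b c → Acc ℕ._<_ (deg a ℕ.+ deg b) →
            Dec (W a b ≈ 0#) → Dec (deg a ℕ.+ deg b ≡ 0) → PrimitiveRoot a b c
    go {a} {b} t rs = cases t rs (≈0? (W a b)) (deg a ℕ.+ deg b ℕ.≟ 0)
    cases t rs        (no W≉0)  _            = unrooted t (inj₁ W≉0)
    cases t rs        (yes _)   (yes degs≡0) = constant t degs≡0
    cases t (acc rec) (yes W≈0) (no degs≢0)  = descend t degs≢0
      (proj₂ (D-root (W≈0⇒D≈0ˡ (CoprimeSum.bézout t) W≈0)))
      (proj₂ (D-root (W≈0⇒D≈0ʳ (CoprimeSum.bézout t) W≈0)))
      (λ t₁ lt → go t₁ (rec lt))

  -- The gcd of x and y divides z as well, and is absorbed into γ.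
  primitiveRoot : ∀ {x y z} → x ≉ 0# → y ≉ 0# → z ≉ 0# → x + y + z ≈ 0# → PrimitiveRoot x y z
  primitiveRoot {x} {y} {z} x≉0 y≉0 z≉0 sum≈0 with gcd x y
  ... | mkGcd d u v (a , ad≈x) (b , bd≈y) bez = record
    { s = s ; γ = γ * d ; x≈ = scale ad≈x x≈ ; y≈ = scale bd≈y y≈ ; z≈ = scale cd≈z z≈
    ; coprime = coprime ; nondegenerate = nondegenerate }
    where
    d≉0 = *-≉0ʳ (≉-cong (sym ad≈x) x≉0)
    c = - (a + b)
    cd≈z : c * d ≈ z
    cd≈z = let open ≈-Reasoning in begin
      - (a + b) * d          ≈⟨ solve 3 (λ a b d → (:- (a :+ b)) :* d := :- (a :* d :+ b :* d)) refl a b d ⟩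
      - (a * d + b * d)      ≈⟨ -‿cong (+-cong ad≈x bd≈y) ⟩
      - (x + y)              ≈⟨ third≈ sum≈0 ⟨
      z                      ∎
    r : PrimitiveRoot a b c
    r = root (coprimeSum (*-≉0ˡ (≉-cong (sym ad≈x) x≉0)) (*-≉0ˡ (≉-cong (sym bd≈y) y≉0)) (*-≉0ˡ (≉-cong (sym cd≈z) z≉0))
      (-‿inverseʳ (a + b)) u v (*-cancelʳ d d≉0 (let open ≈-Reasoning in begin
        (u * a + v * b) * d          ≈⟨ solve 5 (λ u a v b d → (u :* a :+ v :* b) :* d := u :* (a :* d) :+ v :* (b :* d)) refl u a v b d ⟩
        u * (a * d) + v * (b * d)    ≈⟨ +-cong (*-congˡ ad≈x) (*-congˡ bd≈y) ⟩
        u * x + v * y                ≈⟨ bez ⟨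
        d                            ≈⟨ *-identityˡ d ⟨
        1# * d                       ∎)))
    open PrimitiveRoot r hiding (a; b; c)
    scale : ∀ {f a g} → a * d ≈ f → a ≈ γ * g ^ (p ℕ.^ s) → f ≈ γ * d * g ^ (p ℕ.^ s)
    scale {f} {a} {g} ad≈f a≈ = let open ≈-Reasoning in begin
      f                              ≈⟨ ad≈f ⟨
      a * d                          ≈⟨ *-congʳ a≈ ⟩
      γ * g ^ (p ℕ.^ s) * d          ≈⟨ solve 3 (λ γ h d → γ :* h :* d := γ :* d :* h) refl γ _ d ⟩
      γ * d * g ^ (p ℕ.^ s)          ∎

-- Arithmetic of the valuations at a single place, and numerical lemmas.

open import Algebra.Properties.Monoid.Sum ℕ.+-0-monoid using (sum)
open ℕSolver.+-*-Solver using (con) renaming (solve to solveℕ; _:=_ to _≔_; _:+_ to _⊕_; _:*_ to _⊗_)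

extremum : (_≼_ : Rel ℕ 0ℓ) → Total _≼_ → Transitive _≼_ → ∀ n (t : Fin (suc n) → ℕ) → ∃[ i ] (∀ j → t j ≼ t i)
extremum _≼_ total trans zero    t = 0F , λ { 0F → [ (λ z → z) , (λ z → z) ]′ (total (t 0F) (t 0F)) }
extremum _≼_ total trans (suc n) t with extremum _≼_ total trans n (t ∘ Fin.suc)
... | i , max with total (t 0F) (t (Fin.suc i))
...   | inj₁ le = Fin.suc i , λ { 0F → le ; (Fin.suc j) → max j }
...   | inj₂ ge = 0F , λ { 0F → [ (λ z → z) , (λ z → z) ]′ (total (t 0F) (t 0F)) ; (Fin.suc j) → trans (max j) ge }

maximum₂ : ∀ n (t : Fin (suc n) → Fin (suc n) → ℕ) → ∃[ i ] ∃[ j ] (∀ k l → t k l ≤ t i j)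
maximum₂ n t with extremum ℕ._≤_ ℕ.≤-total ℕ.≤-trans n (λ i → t i (proj₁ (row i)))
  where row = λ i → extremum ℕ._≤_ ℕ.≤-total ℕ.≤-trans n (t i)
... | i , max = i , proj₁ (row i) , λ k l → ℕ.≤-trans (proj₂ (row k) l) (max k)
  where row = λ i → extremum ℕ._≤_ ℕ.≤-total ℕ.≤-trans n (t i)

≤-sum : ∀ {n} (t : Fin n → ℕ) i → t i ≤ sum t
≤-sum t 0F          = ℕ.m≤m+n (t 0F) _
≤-sum t (Fin.suc i) = ℕ.≤-trans (≤-sum (t ∘ Fin.suc) i) (ℕ.m≤n+m _ (t 0F))

sum-≤ : ∀ {n} (t : Fin n → ℕ) {B} → (∀ i → t i ≤ B) → sum t ≤ n ℕ.* B
sum-≤ {zero}  t le = z≤n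
sum-≤ {suc n} t le = ℕ.+-mono-≤ (le 0F) (sum-≤ (t ∘ Fin.suc) (le ∘ Fin.suc))

∣-∣-∣ : ∀ {p a b c} → p ℕ.∣ ∣ a - c ∣ → p ℕ.∣ ∣ b - c ∣ → c ≤ a → c ≤ b → p ℕ.∣ ∣ a - b ∣
∣-∣-∣ {p} {a} {b} {c} p∣a-c p∣b-c c≤a c≤b = ≡.subst (p ℕ.∣_) eq (difference
    (≡.subst (p ℕ.∣_) (ℕ.m≤n⇒∣n-m∣≡n∸m c≤a) p∣a-c) (≡.subst (p ℕ.∣_) (ℕ.m≤n⇒∣n-m∣≡n∸m c≤b) p∣b-c))
  where
  difference : ∀ {x y} → p ℕ.∣ x → p ℕ.∣ y → p ℕ.∣ ∣ x - y ∣
  difference (ℕ.divides q ≡.refl) (ℕ.divides r ≡.refl) = ℕ.divides ∣ q - r ∣ (≡.sym (ℕ.*-distribʳ-∣-∣ p q r))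
  eq : ∣ a ℕ.∸ c - b ℕ.∸ c ∣ ≡ ∣ a - b ∣
  eq = let open ≡.≡-Reasoning in begin
    ∣ a ℕ.∸ c - b ℕ.∸ c ∣                          ≡⟨ ℕ.∣m+n-m+o∣≡∣n-o∣ c _ _ ⟨
    ∣ c ℕ.+ (a ℕ.∸ c) - c ℕ.+ (b ℕ.∸ c) ∣          ≡⟨ ≡.cong₂ ∣_-_∣ (ℕ.m+[n∸m]≡n c≤a) (ℕ.m+[n∸m]≡n c≤b) ⟩
    ∣ a - b ∣                                      ∎

-- At one place: e x and e′ are the valuations of f_x and f_k, while c and α x are those of γ and of the
-- primitive root a_x; z x and ρ x count the zeros and poles of dlog (f_x / f_k).
module Local {N q : ℕ} (N⊥q : ℕ.Coprime N q) (e′ : ℕ) (c : ℕ) (e α z ρ : Fin 3 → ℕ)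
             (balance : ∀ x → c ℕ.+ q ℕ.* α x ℕ.+ ρ x ≡ N ℕ.* e x ℕ.+ e′ ℕ.+ z x)
             (disjoint : ∀ {x y} → x ≢ y → α x ≡ 0 ⊎ α y ≡ 0) where

  total : ℕ
  total = sum (λ x → z x ℕ.+ ρ x)

  N∣α : ∀ {x y} → α y ≡ 0 → (∀ x → z x ≡ 0) → (∀ x → ρ x ≡ 0) → N ℕ.∣ α x
  N∣α {x} {y} αy≡0 z≡0 ρ≡0 = ℕ.coprime-divisor N⊥q (ℕ.∣m+n∣m⇒∣n (ℕ.divides (e x) (≡.trans eq (ℕ.*-comm N (e x)))) (ℕ.m∣m*n (e y)))
    where
    balance₀ : ∀ x → c ℕ.+ q ℕ.* α x ≡ N ℕ.* e x ℕ.+ e′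
    balance₀ x with balance x
    ... | eq rewrite z≡0 x | ρ≡0 x = ≡.trans (≡.sym (ℕ.+-identityʳ _)) (≡.trans eq (ℕ.+-identityʳ _))
    c≡ : c ≡ N ℕ.* e y ℕ.+ e′
    c≡ = ≡.trans (≡.sym (≡.trans (≡.cong (λ n → c ℕ.+ q ℕ.* n) αy≡0) (≡.trans (≡.cong (c ℕ.+_) (ℕ.*-zeroʳ q)) (ℕ.+-identityʳ c)))) (balance₀ y)
    eq : N ℕ.* e y ℕ.+ q ℕ.* α x ≡ N ℕ.* e x
    eq = ℕ.+-cancelʳ-≡ e′ _ _ (≡.trans (solveℕ 3 (λ a b d → a ⊕ b ⊕ d ≔ a ⊕ d ⊕ b) ≡.refl (N ℕ.* e y) (q ℕ.* α x) e′)
      (≡.trans (≡.cong (ℕ._+ q ℕ.* α x) (≡.sym c≡)) (balance₀ x)))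

  -- A zero of a_x either lies at a point counted by `total`, or has a multiplicity divisible by N
  -- and hence at least N.
  weight : ∀ {x y} → α y ≡ 0 → N ℕ.* (1 ℕ.⊓ α x) ≤ N ℕ.* total ℕ.+ α x
  weight {x} {y} αy≡0 with total ℕ.≟ 0 | α x in αx≡
  ... | _      | zero  = ≡.subst (_≤ N ℕ.* total ℕ.+ 0) (≡.sym (ℕ.*-zeroʳ N)) z≤n
  ... | no ≢0  | suc m = ℕ.≤-trans (ℕ.*-monoʳ-≤ N (ℕ.n≢0⇒n>0 ≢0)) (ℕ.m≤m+n _ _)
  ... | yes ≡0 | suc m = ℕ.≤-trans (ℕ.≤-reflexive (ℕ.*-identityʳ N))
    (ℕ.≤-trans (ℕ.∣⇒≤ (≡.subst (N ℕ.∣_) αx≡ (N∣α αy≡0 (λ x → ℕ.m+n≡0⇒m≡0 (z x) (zero-at x)) (λ x → ℕ.m+n≡0⇒n≡0 (z x) (zero-at x)))))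
               (ℕ.m≤n+m _ _))
    where
    zero-at : ∀ x → z x ℕ.+ ρ x ≡ 0
    zero-at x = ℕ.n≤0⇒n≡0 (≡.subst (z x ℕ.+ ρ x ≤_) ≡0 (≤-sum (λ x → z x ℕ.+ ρ x) x))

  -- Disjointness leaves at most one nonzero α, to which `weight` applies. Summed over places: N
  -- times the number of zeros of the triple is at most N times the number of exceptional points
  -- plus the sum of the three degrees.
  support-bound : N ℕ.* (1 ℕ.⊓ α 0F ℕ.+ 1 ℕ.⊓ α 1F ℕ.+ 1 ℕ.⊓ α 2F) ≤ N ℕ.* total ℕ.+ (α 0F ℕ.+ α 1F ℕ.+ α 2F)
  support-bound with disjoint {0F} {1F} (λ ()) | disjoint {1F} {2F} (λ ()) | disjoint {2F} {0F} (λ ())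
  ... | inj₁ a | inj₁ b | _      = only a b (weight {2F} {0F} a)
    where
    only : ∀ {x y} {w} → x ≡ 0 → y ≡ 0 → N ℕ.* (1 ℕ.⊓ w) ≤ N ℕ.* total ℕ.+ w →
           N ℕ.* (1 ℕ.⊓ x ℕ.+ 1 ℕ.⊓ y ℕ.+ 1 ℕ.⊓ w) ≤ N ℕ.* total ℕ.+ (x ℕ.+ y ℕ.+ w)
    only ≡.refl ≡.refl le = le
  ... | inj₁ a | inj₂ d | _      = only a d (weight {1F} {0F} a)
    where
    only : ∀ {x y} {w} → x ≡ 0 → y ≡ 0 → N ℕ.* (1 ℕ.⊓ w) ≤ N ℕ.* total ℕ.+ w →
           N ℕ.* (1 ℕ.⊓ x ℕ.+ 1 ℕ.⊓ w ℕ.+ 1 ℕ.⊓ y) ≤ N ℕ.* total ℕ.+ (x ℕ.+ w ℕ.+ y)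
    only {w = w} ≡.refl ≡.refl le rewrite ℕ.+-identityʳ (1 ℕ.⊓ w) | ℕ.+-identityʳ w = le
  ... | inj₂ b | _      | inj₁ d = only b d (weight {0F} {1F} b)
    where
    only : ∀ {x y} {w} → x ≡ 0 → y ≡ 0 → N ℕ.* (1 ℕ.⊓ w) ≤ N ℕ.* total ℕ.+ w →
           N ℕ.* (1 ℕ.⊓ w ℕ.+ 1 ℕ.⊓ x ℕ.+ 1 ℕ.⊓ y) ≤ N ℕ.* total ℕ.+ (w ℕ.+ x ℕ.+ y)
    only {w = w} ≡.refl ≡.refl le rewrite ℕ.+-identityʳ (1 ℕ.⊓ w) | ℕ.+-identityʳ (1 ℕ.⊓ w) | ℕ.+-identityʳ w | ℕ.+-identityʳ w = le
  ... | inj₂ b | _      | inj₂ a = only a b (weight {2F} {0F} a)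
    where
    only : ∀ {x y} {w} → x ≡ 0 → y ≡ 0 → N ℕ.* (1 ℕ.⊓ w) ≤ N ℕ.* total ℕ.+ w →
           N ℕ.* (1 ℕ.⊓ x ℕ.+ 1 ℕ.⊓ y ℕ.+ 1 ℕ.⊓ w) ≤ N ℕ.* total ℕ.+ (x ℕ.+ y ℕ.+ w)
    only ≡.refl ≡.refl le = le

  module _ {X p s : ℕ} (q≡ : q ≡ p ℕ.^ s) (good : Good X p N) (X<N : X < N) where

    -- Otherwise N divides α x · p^s + (1 + z y), since N (e x - e′) = q α x + 1 + z y.
    goodness : ∀ {x y} → x ≢ y → e y ≡ e′ → e′ < e x → ρ x ≡ 1 → z x ≡ 0 → ρ y ≡ 0 → X ≤ α x ℕ.+ z y
    goodness {x} {y} x≢y ey≡e′ e′<ex ρx≡1 zx≡0 ρy≡0 = ℕ.≮⇒≥ impossible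
      where
      d = e x ℕ.∸ e′
      0<d : 0 < d
      0<d = ℕ.m<n⇒0<n∸m e′<ex
      equation : q ℕ.* α x ℕ.+ suc (z y) ≡ N ℕ.* d ℕ.+ q ℕ.* α y
      equation = ℕ.+-cancelˡ-≡ (c ℕ.+ N ℕ.* e′ ℕ.+ e′) _ _ (let open ≡.≡-Reasoning in begin
        c ℕ.+ N ℕ.* e′ ℕ.+ e′ ℕ.+ (q ℕ.* α x ℕ.+ (1 ℕ.+ z y))
          ≡⟨ solveℕ 6 (λ c n e q o z → c ⊕ n ⊕ e ⊕ (q ⊕ (o ⊕ z)) ≔ (c ⊕ q ⊕ o) ⊕ (n ⊕ e ⊕ z)) ≡.refl c (N ℕ.* e′) e′ (q ℕ.* α x) 1 (z y) ⟩
        (c ℕ.+ q ℕ.* α x ℕ.+ 1) ℕ.+ (N ℕ.* e′ ℕ.+ e′ ℕ.+ z y)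
          ≡⟨ ≡.cong₂ ℕ._+_ at-x at-y ⟩
        (N ℕ.* (e′ ℕ.+ d) ℕ.+ e′) ℕ.+ (c ℕ.+ q ℕ.* α y)
          ≡⟨ solveℕ 5 (λ N e d c q → N ⊗ (e ⊕ d) ⊕ e ⊕ (c ⊕ q) ≔ c ⊕ N ⊗ e ⊕ e ⊕ (N ⊗ d ⊕ q)) ≡.refl N e′ d c (q ℕ.* α y) ⟩
        c ℕ.+ N ℕ.* e′ ℕ.+ e′ ℕ.+ (N ℕ.* d ℕ.+ q ℕ.* α y) ∎)
        where
        at-x : c ℕ.+ q ℕ.* α x ℕ.+ 1 ≡ N ℕ.* (e′ ℕ.+ d) ℕ.+ e′
        at-x = ≡.trans (≡.cong (c ℕ.+ q ℕ.* α x ℕ.+_) (≡.sym ρx≡1)) (≡.trans (balance x)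
          (≡.trans (≡.cong (N ℕ.* e x ℕ.+ e′ ℕ.+_) zx≡0) (≡.trans (ℕ.+-identityʳ _)
            (≡.cong (λ n → N ℕ.* n ℕ.+ e′) (≡.sym (ℕ.m+[n∸m]≡n (ℕ.<⇒≤ e′<ex)))))))
        at-y : N ℕ.* e′ ℕ.+ e′ ℕ.+ z y ≡ c ℕ.+ q ℕ.* α y
        at-y = ≡.trans (≡.cong (λ n → N ℕ.* n ℕ.+ e′ ℕ.+ z y) (≡.sym ey≡e′)) (≡.trans (≡.sym (balance y))
          (≡.trans (≡.cong (c ℕ.+ q ℕ.* α y ℕ.+_) ρy≡0) (ℕ.+-identityʳ _)))
      impossible : ¬ (α x ℕ.+ z y < X)
      impossible lt with α x ℕ.≟ 0
      -- `Good` speaks of positive a, so α x = 0 is treated apart: then `1 + z y` alone is at least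
      -- N d, hence exceeds X.
      ... | yes αx≡0 = ℕ.<⇒≱ (ℕ.≤-<-trans (ℕ.m≤n+m (z y) (α x)) lt) (ℕ.≤-pred (let open ℕ.≤-Reasoning in begin
          suc X                              ≤⟨ X<N ⟩
          N                                  ≤⟨ ℕ.m≤m*n N d {{ℕ.>-nonZero 0<d}} ⟩
          N ℕ.* d                            ≤⟨ ℕ.m≤m+n (N ℕ.* d) _ ⟩
          N ℕ.* d ℕ.+ q ℕ.* α y              ≡⟨ equation ⟨
          q ℕ.* α x ℕ.+ suc (z y)            ≡⟨ ≡.cong (λ n → q ℕ.* n ℕ.+ suc (z y)) αx≡0 ⟩
          q ℕ.* 0 ℕ.+ suc (z y)              ≡⟨ ≡.cong (ℕ._+ suc (z y)) (ℕ.*-zeroʳ q) ⟩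
          suc (z y)                          ∎))
      ... | no  αx≢0 = good s (α x) (suc (z y)) (ℕ.n≢0⇒n>0 αx≢0) (ℕ.<⇒≤ (ℕ.≤-<-trans (ℕ.m≤m+n (α x) (z y)) lt))
          (s≤s z≤n) (ℕ.≤-<-trans (ℕ.m≤n+m (z y) (α x)) lt)
          (ℕ.divides d (let open ≡.≡-Reasoning in begin
            α x ℕ.* p ℕ.^ s ℕ.+ suc (z y)    ≡⟨ ≡.cong (ℕ._+ suc (z y)) (≡.trans (≡.cong (α x ℕ.*_) (≡.sym q≡)) (ℕ.*-comm (α x) q)) ⟩
            q ℕ.* α x ℕ.+ suc (z y)          ≡⟨ equation ⟩
            N ℕ.* d ℕ.+ q ℕ.* α y            ≡⟨ ≡.cong (λ n → N ℕ.* d ℕ.+ q ℕ.* n) αy≡0 ⟩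
            N ℕ.* d ℕ.+ q ℕ.* 0              ≡⟨ ≡.trans (≡.cong (N ℕ.* d ℕ.+_) (ℕ.*-zeroʳ q)) (ℕ.+-identityʳ _) ⟩
            N ℕ.* d                          ≡⟨ ℕ.*-comm N d ⟩
            d ℕ.* N                          ∎))
        where
        αy≡0 : α y ≡ 0
        αy≡0 = [ (λ αx≡0 → contradiction αx≡0 αx≢0) , (λ z → z) ]′ (disjoint x≢y)

ramified⇒∤ : ∀ {p} e m → ramification p e m ≡ 1 → ¬ p ℕ.∣ ∣ e - m ∣
ramified⇒∤ {p} e m eq with p ℕ.∣? ∣ e - m ∣
... | yes _  = contradiction eq λ ()
... | no  p∤ = p∤

∤⇒ramified : ∀ {p} e m → ¬ p ℕ.∣ ∣ e - m ∣ → ramification p e m ≡ 1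
∤⇒ramified {p} e m p∤ with p ℕ.∣? ∣ e - m ∣
... | yes p∣ = contradiction p∣ p∤
... | no  _  = ≡.refl

unramified : ∀ {p} e → ramification p e e ≡ 0
unramified {p} e with p ℕ.∣? ∣ e - e ∣
... | yes _  = ≡.refl
... | no  p∤ = contradiction (≡.subst (p ℕ.∣_) (≡.sym (ℕ.∣n-n∣≡0 e)) (p ℕ.∣0)) p∤

ramification-0-1 : ∀ p e m → ramification p e m ≡ 0 ⊎ ramification p e m ≡ 1
ramification-0-1 p e m with p ℕ.∣? ∣ e - m ∣
... | yes _ = inj₁ ≡.refl
... | no  _ = inj₂ ≡.refl

-- The index k has minimal valuation and y is a second index attaining it, by `twice`. For x take i
-- or j: if p divided both e i - e k and e j - e k, it would divide e i - e j.
ramified-triple : ∀ {p} (e : Fin 4 → ℕ) → (∀ i → ∃[ j ] (j ≢ i × e j ≤ e i)) →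
  ∀ i j → ¬ p ℕ.∣ ∣ e i - e j ∣ →
  ∃[ k ] ∃[ x ] ∃[ y ] (x ≢ y × e (punchIn k y) ≡ e k × e k < e (punchIn k x) × ¬ p ℕ.∣ ∣ e (punchIn k x) - e k ∣)
ramified-triple {p} e twice i j p∤ = found (p ℕ.∣? ∣ e i - e k ∣) (p ℕ.∣? ∣ e j - e k ∣)
  where
  minimum = extremum ℕ._≥_ (flip ℕ.≤-total) (flip ℕ.≤-trans) 3 e
  k = proj₁ minimum
  e≥ : ∀ j → e k ≤ e j
  e≥ = proj₂ minimum
  l = proj₁ (twice k)
  l≢k : l ≢ k
  l≢k = proj₁ (proj₂ (twice k))
  el≡ek : e l ≡ e k
  el≡ek = ℕ.≤-antisym (proj₂ (proj₂ (twice k))) (e≥ l)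
  p∣self : ∀ {m} → m ≡ e k → p ℕ.∣ ∣ m - e k ∣
  p∣self ≡.refl = ≡.subst (p ℕ.∣_) (≡.sym (ℕ.∣n-n∣≡0 (e k))) (p ℕ.∣0)
  at : ∀ i → ¬ p ℕ.∣ ∣ e i - e k ∣ →
    ∃[ k ] ∃[ x ] ∃[ y ] (x ≢ y × e (punchIn k y) ≡ e k × e k < e (punchIn k x) × ¬ p ℕ.∣ ∣ e (punchIn k x) - e k ∣)
  at i p∤ = k , punchOut k≢i , punchOut k≢l , distinct
          , ≡.trans (≡.cong e (Fin.punchIn-punchOut k≢l)) el≡ek
          , ≡.subst (λ m → e k < e m) (≡.sym (Fin.punchIn-punchOut k≢i)) (ℕ.≤∧≢⇒< (e≥ i) (λ eq → p∤ (p∣self (≡.sym eq))))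
          , ≡.subst (λ m → ¬ p ℕ.∣ ∣ e m - e k ∣) (≡.sym (Fin.punchIn-punchOut k≢i)) p∤
    where
    k≢i : k ≢ i
    k≢i ≡.refl = p∤ (p∣self ≡.refl)
    k≢l : k ≢ l
    k≢l eq = l≢k (≡.sym eq)
    distinct : punchOut k≢i ≢ punchOut k≢l
    distinct eq = p∤ (p∣self (≡.trans (≡.cong e (Fin.punchOut-injective k≢i k≢l eq)) el≡ek))
  found : Dec (p ℕ.∣ ∣ e i - e k ∣) → Dec (p ℕ.∣ ∣ e j - e k ∣) →
    ∃[ k ] ∃[ x ] ∃[ y ] (x ≢ y × e (punchIn k y) ≡ e k × e k < e (punchIn k x) × ¬ p ℕ.∣ ∣ e (punchIn k x) - e k ∣)
  found (no p∤)  _        = at i p∤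
  found (yes _)  (no p∤)  = at j p∤
  found (yes p∣) (yes p∣′) = contradiction (∣-∣-∣ {p} {e i} {e j} {e k} p∣ p∣′ (e≥ i) (e≥ j)) p∤

-- Otherwise s = 0 and a = b = N would solve the congruence.
Good⇒X<N : ∀ {X p N} → 0 < N → Good X p N → X < N
Good⇒X<N {X} {p} {N} 0<N good = ℕ.≰⇒> λ N≤X → good 0 N N 0<N N≤X 0<N N≤X (ℕ.∣m∣n⇒∣m+n (ℕ.m∣m*n 1) ℕ.∣-refl)

coprime-^ : ∀ {N p} s → ℕ.Coprime N p → ℕ.Coprime N (p ℕ.^ s)
coprime-^ zero    N⊥p (_ , d∣1) = ℕ.∣1⇒≡1 d∣1
coprime-^ (suc s) N⊥p {d} (d∣N , d∣p*p^s) = coprime-^ s N⊥p (d∣N , ℕ.coprime-divisor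
  (λ (x∣d , x∣p) → N⊥p (ℕ.∣-trans x∣d d∣N , x∣p)) d∣p*p^s)

3*2≡6 : ∀ m → 3 ℕ.* (m ℕ.+ m) ≡ 6 ℕ.* m
3*2≡6 = solveℕ 1 (λ m → con 3 ⊗ (m ⊕ m) ≔ con 6 ⊗ m) ≡.refl

4*39≡156 : ∀ m → 4 ℕ.* (36 ℕ.* m ℕ.+ 3 ℕ.* m) ≡ 156 ℕ.* m
4*39≡156 m = ≡.trans (≡.cong (4 ℕ.*_) (≡.sym (ℕ.*-distribʳ-+ m 36 3))) (≡.sym (ℕ.*-assoc 4 39 m))

-- Doubling gives 2 N Λ ≤ 6 N n ≤ 36 N M + 6 Λ, and 6 Λ is absorbed by one of the two copies of N Λ.
-- In the application n counts the zeros of the triple (a_i) and Λ is the sum of its three degrees.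
absorb : ∀ N n M Λ → 6 ≤ N → Λ ≤ 3 ℕ.* n → N ℕ.* n ≤ N ℕ.* (6 ℕ.* M) ℕ.+ Λ → Λ ≤ 36 ℕ.* M
absorb N n M Λ 6≤N Λ≤3n Nn≤ = ℕ.*-cancelˡ-≤ N {{ℕ.>-nonZero (ℕ.≤-trans (s≤s z≤n) 6≤N)}}
  (ℕ.+-cancelʳ-≤ (N ℕ.* Λ) _ _ (let open ℕ.≤-Reasoning in begin
    N ℕ.* Λ ℕ.+ N ℕ.* Λ                                ≤⟨ ℕ.+-mono-≤ NΛ≤ NΛ≤ ⟩
    N ℕ.* (3 ℕ.* n) ℕ.+ N ℕ.* (3 ℕ.* n)                ≡⟨ solveℕ 2 (λ N n → N ⊗ (con 3 ⊗ n) ⊕ N ⊗ (con 3 ⊗ n) ≔ con 6 ⊗ (N ⊗ n)) ≡.refl N n ⟩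
    6 ℕ.* (N ℕ.* n)                                    ≤⟨ ℕ.*-monoʳ-≤ 6 Nn≤ ⟩
    6 ℕ.* (N ℕ.* (6 ℕ.* M) ℕ.+ Λ)                      ≡⟨ solveℕ 3 (λ N M Λ → con 6 ⊗ (N ⊗ (con 6 ⊗ M) ⊕ Λ) ≔ N ⊗ (con 36 ⊗ M) ⊕ con 6 ⊗ Λ) ≡.refl N M Λ ⟩
    N ℕ.* (36 ℕ.* M) ℕ.+ 6 ℕ.* Λ                       ≤⟨ ℕ.+-monoʳ-≤ _ (ℕ.*-monoˡ-≤ Λ 6≤N) ⟩
    N ℕ.* (36 ℕ.* M) ℕ.+ N ℕ.* Λ                       ∎))
  where
  NΛ≤ : N ℕ.* Λ ≤ N ℕ.* (3 ℕ.* n)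
  NΛ≤ = ℕ.*-monoʳ-≤ N Λ≤3n

-- The global estimate for four polynomials with Σ ε_i f_i^N = 0.

module FermatSum {p : ℕ} (pp : Prime p) (R : PolynomialRing p) where
  open MasonStothers pp R public
  open Place
  open import Algebra.Properties.CommutativeMonoid.Sum +-commutativeMonoid
    using (∑-distrib-+) renaming (sum to Σᵣ; sum-remove to Σᵣ-remove; sum-cong-≋ to Σᵣ-cong)
  open import Algebra.Properties.Semiring.Sum semiring using (*-distribˡ-sum)
  open import Algebra.Properties.CommutativeMonoid.Sum *-commutativeMonoid
    using () renaming (sum to Πᵣ)

  ∣-Σ : ∀ {n d} (t : Fin n → Carrier) → (∀ i → d ∣ t i) → d ∣ Σᵣ t
  ∣-Σ {zero}  t d∣t = ∣0 _
  ∣-Σ {suc n} t d∣t = ∣-+ (d∣t 0F) (∣-Σ (t ∘ Fin.suc) (d∣t ∘ Fin.suc))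

  ∣-Π : ∀ {n} (t : Fin n → Carrier) i → t i ∣ Πᵣ t
  ∣-Π t 0F          = ∣-*ʳ _ ∣ʳ-refl
  ∣-Π t (Fin.suc i) = ∣-*ˡ _ (∣-Π (t ∘ Fin.suc) i)

  Π-≉0 : ∀ {n} (t : Fin n → Carrier) → (∀ i → t i ≉ 0#) → Πᵣ t ≉ 0#
  Π-≉0 {zero}  t t≉0 = 1≉0
  Π-≉0 {suc n} t t≉0 = *-≉0 (t≉0 0F) (Π-≉0 (t ∘ Fin.suc) (t≉0 ∘ Fin.suc))

  D-Σ : ∀ {n} (t : Fin n → Carrier) → D (Σᵣ t) ≈ Σᵣ (D ∘ t)
  D-Σ {zero}  t = D-0
  D-Σ {suc n} t = trans (D-+ (t 0F) _) (+-congˡ (D-Σ (t ∘ Fin.suc)))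

  ⟨sum⟩ : ∀ {n} (φ : Fin n → Place → ℕ) S → ⟨ (λ P → sum (λ i → φ i P)) ⟩ S ≡ sum (λ i → ⟨ φ i ⟩ S)
  ⟨sum⟩ {zero}  φ S = ⟨0⟩ S
  ⟨sum⟩ {suc n} φ S = ≡.trans (⟨⟩-+ (φ 0F) (λ P → sum (λ i → φ (Fin.suc i) P)) S)
    (≡.cong (⟨ φ 0F ⟩ S ℕ.+_) (⟨sum⟩ (φ ∘ Fin.suc) S))

  module Equation
    {n : ℕ} (N⊥p : Coprime (suc n) p) {X : ℕ} (156<X : 156 < X) (good : Good X p (suc n))
    (ε f : Fin 4 → Carrier) (ε∣1 : ∀ i → ε i ∣ 1#) (Dε≈0 : ∀ i → D (ε i) ≈ 0#)
    (f≉0 : ∀ i → f i ≉ 0#) (W≉0 : ∀ {i j} → i ≢ j → W (f i) (f j) ≉ 0#)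
    (sum≈0 : Σᵣ (λ i → ε i * f i ^ suc n) ≈ 0#) where

    N : ℕ
    N = suc n

    X<N : X < N
    X<N = Good⇒X<N (s≤s z≤n) good

    ε≉0 : ∀ i → ε i ≉ 0#
    ε≉0 i ε≈0 = 1≉0 (trans (sym (proj₂ (unit (ε∣1 i)))) (trans (*-congˡ ε≈0) (zeroʳ _)))
      where
      unit : ∀ {e} → e ∣ 1# → ∃[ q ] q * e ≈ 1#
      unit (q , eq) = q , eq

    p∤N : ¬ p ℕ.∣ N
    p∤N p∣N = ℕ.<⇒≢ 1<p (≡.sym (N⊥p (p∣N , ℕ.∣-refl)))

    -- Differentiating the equation produces a common factor N, which is nonzero in characteristic p
    -- and can be cancelled.
    D-sum≈0 : Σᵣ (λ i → ε i * (f i ^ n * D (f i))) ≈ 0#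
    D-sum≈0 = [ (λ N≈0 → contradiction N≈0 N≉0) , (λ z → z) ]′ (integral (let open ≈-Reasoning in begin
      (N ×ₙ 1#) * Σᵣ (λ i → ε i * (f i ^ n * D (f i)))      ≈⟨ *-distribˡ-sum (N ×ₙ 1#) (λ i → ε i * (f i ^ n * D (f i))) ⟩
      Σᵣ (λ i → (N ×ₙ 1#) * (ε i * (f i ^ n * D (f i))))    ≈⟨ Σᵣ-cong D-term ⟨
      Σᵣ (λ i → D (ε i * f i ^ N))                          ≈⟨ D-Σ (λ i → ε i * f i ^ N) ⟨
      D (Σᵣ (λ i → ε i * f i ^ N))                          ≈⟨ D-cong sum≈0 ⟩
      D 0#                                                  ≈⟨ D-0 ⟩
      0#                                                    ∎))
      where
      N≉0 : N ×ₙ 1# ≉ 0#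
      N≉0 N≈0 = 1≉0 (trans (sym (proj₂ u)) (trans (*-congˡ N≈0) (zeroʳ _)))
        where
        u : ∃[ q ] q * (N ×ₙ 1#) ≈ 1#
        u with ×-unit p∤N
        ... | q , eq = q , eq
      D-term : ∀ i → D (ε i * f i ^ N) ≈ (N ×ₙ 1#) * (ε i * (f i ^ n * D (f i)))
      D-term i = let open ≈-Reasoning in begin
        D (ε i * f i ^ N)                                    ≈⟨ D-* (ε i) (f i ^ N) ⟩
        D (ε i) * f i ^ N + ε i * D (f i ^ N)                ≈⟨ +-cong (trans (*-congʳ (Dε≈0 i)) (zeroˡ _)) (*-congˡ (D-^ n (f≉0 i))) ⟩
        0# + ε i * ((N ×ₙ 1#) * (f i ^ n * D (f i)))         ≈⟨ +-identityˡ _ ⟩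
        ε i * ((N ×ₙ 1#) * (f i ^ n * D (f i)))              ≈⟨ solve 3 (λ e c x → e :* (c :* x) := c :* (e :* x)) refl (ε i) (N ×ₙ 1#) _ ⟩
        (N ×ₙ 1#) * (ε i * (f i ^ n * D (f i)))              ∎

    T : Fin 4 → Fin 4 → Carrier
    T k i = ε i * (f i ^ n * W (f i) (f k))

    -- Eliminating f_k between the equation and its derivative.
    T-sum : ∀ k → Σᵣ (T k) ≈ 0#
    T-sum k = let open ≈-Reasoning in begin
      Σᵣ (T k)
        ≈⟨ Σᵣ-cong (λ i → solve 6 (λ e f x df h dh → e :* (x :* (f :* dh :- df :* h)) := dh :* (e :* (f :* x)) :+ (:- h) :* (e :* (x :* df)))
             refl (ε i) (f i) (f i ^ n) (D (f i)) (f k) (D (f k))) ⟩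
      Σᵣ (λ i → D (f k) * (ε i * f i ^ N) + - f k * (ε i * (f i ^ n * D (f i))))
        ≈⟨ ∑-distrib-+ (λ i → D (f k) * (ε i * f i ^ N)) (λ i → - f k * (ε i * (f i ^ n * D (f i)))) ⟩
      Σᵣ (λ i → D (f k) * (ε i * f i ^ N)) + Σᵣ (λ i → - f k * (ε i * (f i ^ n * D (f i))))
        ≈⟨ +-cong (sym (*-distribˡ-sum (D (f k)) (λ i → ε i * f i ^ N))) (sym (*-distribˡ-sum (- f k) (λ i → ε i * (f i ^ n * D (f i))))) ⟩
      D (f k) * Σᵣ (λ i → ε i * f i ^ N) + - f k * Σᵣ (λ i → ε i * (f i ^ n * D (f i)))
        ≈⟨ +-cong (trans (*-congˡ sum≈0) (zeroʳ _)) (trans (*-congˡ D-sum≈0) (zeroʳ _)) ⟩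
      0# + 0#
        ≈⟨ +-identityʳ 0# ⟩
      0# ∎

    other : Fin 4 → Fin 3 → Fin 4
    other = punchIn

    other≢ : ∀ k x → other k x ≢ k
    other≢ k x = Fin.punchInᵢ≢i k x

    Y : Fin 4 → Fin 3 → Carrier
    Y k x = T k (other k x)

    Y≉0 : ∀ k x → Y k x ≉ 0#
    Y≉0 k x = *-≉0 (ε≉0 _) (*-≉0 (^-≉0 n (f≉0 _)) (W≉0 (other≢ k x)))

    Y-sum : ∀ k → Y k 0F + Y k 1F + Y k 2F ≈ 0#
    Y-sum k = let open ≈-Reasoning in begin
      Y k 0F + Y k 1F + Y k 2F            ≈⟨ trans (+-assoc _ _ _) (+-congˡ (+-congˡ (sym (+-identityʳ _)))) ⟩
      Σᵣ (Y k)                            ≈⟨ +-identityˡ _ ⟨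
      0# + Σᵣ (Y k)                       ≈⟨ +-congʳ (trans (*-congˡ (trans (*-congˡ W≈0) (zeroʳ _))) (zeroʳ _)) ⟨
      T k k + Σᵣ (Y k)                    ≈⟨ Σᵣ-remove {i = k} (T k) ⟨
      Σᵣ (T k)                            ≈⟨ T-sum k ⟩
      0#                                  ∎
      where
      W≈0 : W (f k) (f k) ≈ 0#
      W≈0 = trans (+-congˡ (-‿cong (*-comm _ _))) (-‿inverseʳ _)

    abstract
      rooted : ∀ k → PrimitiveRoot (Y k 0F) (Y k 1F) (Y k 2F)
      rooted k = primitiveRoot (Y≉0 k 0F) (Y≉0 k 1F) (Y≉0 k 2F) (Y-sum k)

    module _ (k : Fin 4) where
      open PrimitiveRoot (rooted k) public using (s; γ; coprime; nondegenerate)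
      open PrimitiveRoot (rooted k) using (a; b; c; x≈; y≈; z≈)
      open Coprime₃ coprime renaming (sum≈0 to a+b+c≈0)

      q : ℕ
      q = p ℕ.^ s

      instance
        q≢0 : ℕ.NonZero q
        q≢0 = ℕ.m^n≢0 p s

      A : Fin 3 → Carrier
      A 0F = a
      A 1F = b
      A 2F = c

      A≉0 : ∀ x → A x ≉ 0#
      A≉0 0F = a≉0
      A≉0 1F = b≉0
      A≉0 2F = c≉0

      Y≈ : ∀ x → Y k x ≈ γ * A x ^ q
      Y≈ 0F = x≈
      Y≈ 1F = y≈
      Y≈ 2F = z≈

      γ≉0 : γ ≉ 0#
      γ≉0 = *-≉0ˡ (≉-cong (Y≈ 0F) (Y≉0 k 0F))

      A∣Y : ∀ x → A x ∣ Y k x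
      A∣Y x = ∣ʳ-respʳ-≈ (sym (Y≈ x)) (∣-*ˡ γ (∣-^ q))
        where
        ∣-^ : ∀ {g} m .{{_ : ℕ.NonZero m}} → g ∣ g ^ m
        ∣-^ (suc m) = ∣-*ʳ _ ∣ʳ-refl

      A-disjoint : ∀ P {x y} → x ≢ y → ν P (A x) ≡ 0 ⊎ ν P (A y) ≡ 0
      A-disjoint P {0F} {0F} x≢y = contradiction ≡.refl x≢y
      A-disjoint P {0F} {1F} x≢y = ab P
      A-disjoint P {0F} {2F} x≢y = [ inj₂ , inj₁ ]′ (ca P)
      A-disjoint P {1F} {0F} x≢y = [ inj₂ , inj₁ ]′ (ab P)
      A-disjoint P {1F} {1F} x≢y = contradiction ≡.refl x≢y
      A-disjoint P {1F} {2F} x≢y = bc P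
      A-disjoint P {2F} {0F} x≢y = ca P
      A-disjoint P {2F} {1F} x≢y = [ inj₂ , inj₁ ]′ (bc P)
      A-disjoint P {2F} {2F} x≢y = contradiction ≡.refl x≢y

      supports : Place → ℕ
      supports P = 1 ℕ.⊓ ν P (A 0F) ℕ.+ 1 ℕ.⊓ ν P (A 1F) ℕ.+ 1 ℕ.⊓ ν P (A 2F)

      deg-A : ∀ {S} → AllPairs Distinct S → (∀ x → Full S (A x)) → ∀ x → deg (A x) ≤ ⟨ supports ⟩ S
      deg-A {S} dist full x = by nondegenerate x
        where
        by : W a b ≉ 0# ⊎ (deg a ≡ 0 × deg b ≡ 0 × deg c ≡ 0) → ∀ x → deg (A x) ≤ ⟨ supports ⟩ S
        by (inj₂ (deg-a , _ , _)) 0F = ≡.subst (_≤ ⟨ supports ⟩ S) (≡.sym deg-a) z≤n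
        by (inj₂ (_ , deg-b , _)) 1F = ≡.subst (_≤ ⟨ supports ⟩ S) (≡.sym deg-b) z≤n
        by (inj₂ (_ , _ , deg-c)) 2F = ≡.subst (_≤ ⟨ supports ⟩ S) (≡.sym deg-c) z≤n
        by (inj₁ W≉0) 2F = mason coprime W≉0 dist (full 0F) (full 1F) (full 2F)
        by (inj₁ W≉0) 0F = ≡.subst (deg a ≤_) (⟨⟩-cong (λ P → cycle (support b P) (support c P) (support a P)) S)
          (mason (Coprime₃-rotate coprime) (≉-cong (sym (W-rotate a+b+c≈0)) W≉0) dist (full 1F) (full 2F) (full 0F))
          where
          cycle : ∀ x y z → x ℕ.+ y ℕ.+ z ≡ z ℕ.+ x ℕ.+ y
          cycle x y z = ≡.trans (ℕ.+-comm (x ℕ.+ y) z) (≡.sym (ℕ.+-assoc z x y))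
        by (inj₁ W≉0) 1F = ≡.subst (deg b ≤_) (⟨⟩-cong (λ P → cycle (support c P) (support a P) (support b P)) S)
          (mason (Coprime₃-rotate (Coprime₃-rotate coprime))
            (≉-cong (sym (trans (W-rotate (rotate a+b+c≈0)) (W-rotate a+b+c≈0))) W≉0) dist (full 2F) (full 0F) (full 1F))
          where
          cycle : ∀ x y z → x ℕ.+ y ℕ.+ z ≡ y ℕ.+ z ℕ.+ x
          cycle x y z = ≡.trans (ℕ.+-assoc x y z) (ℕ.+-comm x (y ℕ.+ z))

    e : Place → Fin 4 → ℕ
    e P i = ν P (f i)

    r : Fin 4 → Fin 4 → Place → ℕ
    r i j P = ramification p (e P i) (e P j)

    abstract
      ν-Wᵢⱼ : ∀ k x P → ∃[ z ] (ν P (W (f (other k x)) (f k)) ℕ.+ r (other k x) k P ≡ e P (other k x) ℕ.+ e P k ℕ.+ z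
                                × (r (other k x) k P ≡ 1 → z ≡ 0))
      ν-Wᵢⱼ k x P = ν-W P (f≉0 (other k x)) (f≉0 k) (W≉0 (other≢ k x))

    z : ∀ k → Fin 3 → Place → ℕ
    z k x P = proj₁ (ν-Wᵢⱼ k x P)

    -- Two evaluations of the valuation of `Y k x`. The n = N - 1 copies of f_i in the power and the
    -- one contained in the order of the Wronskian make up the coefficient N.
    balance : ∀ k P x → ν P (γ k) ℕ.+ q k ℕ.* ν P (A k x) ℕ.+ r (other k x) k P ≡ N ℕ.* e P (other k x) ℕ.+ e P k ℕ.+ z k x P
    balance k P x = let open ≡.≡-Reasoning in begin
      ν P (γ k) ℕ.+ q k ℕ.* ν P (A k x) ℕ.+ r i k P     ≡⟨ ≡.cong (ℕ._+ r i k P) νY ⟨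
      n ℕ.* e P i ℕ.+ w ℕ.+ r i k P                     ≡⟨ ℕ.+-assoc (n ℕ.* e P i) w _ ⟩
      n ℕ.* e P i ℕ.+ (w ℕ.+ r i k P)                   ≡⟨ ≡.cong (n ℕ.* e P i ℕ.+_) (proj₁ (proj₂ (ν-Wᵢⱼ k x P))) ⟩
      n ℕ.* e P i ℕ.+ (e P i ℕ.+ e P k ℕ.+ z k x P)     ≡⟨ solveℕ 4 (λ x e m z → x ⊕ (e ⊕ m ⊕ z) ≔ e ⊕ x ⊕ m ⊕ z) ≡.refl (n ℕ.* e P i) (e P i) (e P k) (z k x P) ⟩
      N ℕ.* e P i ℕ.+ e P k ℕ.+ z k x P                 ∎
      where
      i = other k x
      w = ν P (W (f i) (f k))
      νY : n ℕ.* e P i ℕ.+ w ≡ ν P (γ k) ℕ.+ q k ℕ.* ν P (A k x)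
      νY = let open ≡.≡-Reasoning in begin
        n ℕ.* e P i ℕ.+ w                              ≡⟨ ≡.cong (ℕ._+ w) (ν-^ P n (f≉0 i)) ⟨
        ν P (f i ^ n) ℕ.+ w                            ≡⟨ ν-* P (^-≉0 n (f≉0 i)) (W≉0 (other≢ k x)) ⟨
        ν P (f i ^ n * W (f i) (f k))                  ≡⟨ ≡.cong (ℕ._+ ν P (f i ^ n * W (f i) (f k))) (ν-∣1 P (ε∣1 i)) ⟨
        ν P (ε i) ℕ.+ ν P (f i ^ n * W (f i) (f k))    ≡⟨ ν-* P (ε≉0 i) (*-≉0 (^-≉0 n (f≉0 i)) (W≉0 (other≢ k x))) ⟨
        ν P (Y k x)                                    ≡⟨ ν-cong P (Y≉0 k x) (Y≈ k x) ⟩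
        ν P (γ k * A k x ^ q k)                        ≡⟨ ν-* P (γ≉0 k) (^-≉0 (q k) (A≉0 k x)) ⟩
        ν P (γ k) ℕ.+ ν P (A k x ^ q k)                ≡⟨ ≡.cong (ν P (γ k) ℕ.+_) (ν-^ P (q k) (A≉0 k x)) ⟩
        ν P (γ k) ℕ.+ q k ℕ.* ν P (A k x)              ∎

    -- If every other term had larger valuation than the i-th, a power of the prime too high for the
    -- i-th term would divide the others, hence also that term, as the sum is zero.
    minimum-twice : ∀ P i → ∃[ j ] (j ≢ i × e P j ≤ e P i)
    minimum-twice P i = by (Fin.any? (λ j → ¬? (j Fin.≟ i) ×-dec (e P j ℕ.≤? e P i)))
      where
      t = λ j → ε j * f j ^ N
      t≉0 : ∀ j → t j ≉ 0#
      t≉0 j = *-≉0 (ε≉0 j) (^-≉0 N (f≉0 j))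
      ν-t : ∀ j → ν P (t j) ≡ N ℕ.* e P j
      ν-t j = ≡.trans (ν-* P (ε≉0 j) (^-≉0 N (f≉0 j))) (≡.cong₂ ℕ._+_ (ν-∣1 P (ε∣1 j)) (ν-^ P N (f≉0 j)))
      by : Dec (∃[ j ] (j ≢ i × e P j ≤ e P i)) → ∃[ j ] (j ≢ i × e P j ≤ e P i)
      by (yes found) = found
      by (no none)   = contradiction (≡.subst (m ≤_) (ν-t i) (^∣⇒≤ν P m (t≉0 i) π^m∣tᵢ)) (ℕ.<⇒≱ (ℕ.n<1+n _))
        where
        m = suc (N ℕ.* e P i)
        π^m∣others : ∀ x → prime P ^ m ∣ t (punchIn i x)
        π^m∣others x = ^ν∣ P m (t≉0 _) (≡.subst (m ≤_) (≡.sym (ν-t _)) (ℕ.*-monoʳ-< N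
          (ℕ.≰⇒> (λ le → none (punchIn i x , Fin.punchInᵢ≢i i x , le)))))
        π^m∣tᵢ : prime P ^ m ∣ t i
        π^m∣tᵢ = ∣-+-cancelʳ (∣ʳ-respʳ-≈ (trans (sym sum≈0) (Σᵣ-remove {i = i} t)) (∣0 _))
          (∣-Σ (λ x → t (punchIn i x)) π^m∣others)

    -- Everything that can pay for a pole at P. The sum runs over all k and x because the indices
    -- supplied by `ramified-triple` change with the place.
    Φ : Place → ℕ
    Φ P = sum (λ k → sum (λ x → ν P (A k x)) ℕ.+ sum (λ x → z k x P))

    -- Goodness does not apply to an arbitrary pair (i, j); `ramified-triple` trades its pole for
    -- one of some dlog (f_x / f_k) with f_k of minimal valuation, where it does.
    X*r≤Φ : ∀ P i j → X ℕ.* r i j P ≤ Φ P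
    X*r≤Φ P i j = by (ramification-0-1 p (e P i) (e P j))
      where
      by : r i j P ≡ 0 ⊎ r i j P ≡ 1 → X ℕ.* r i j P ≤ Φ P
      by (inj₁ eq) = ≡.subst (_≤ Φ P) (≡.sym (≡.trans (≡.cong (X ℕ.*_) eq) (ℕ.*-zeroʳ X))) z≤n
      by (inj₂ eq) = ≡.subst (_≤ Φ P) (≡.sym (≡.trans (≡.cong (X ℕ.*_) eq) (ℕ.*-identityʳ X)))
        (witness (ramified-triple (e P) (minimum-twice P) i j (ramified⇒∤ (e P i) (e P j) eq)))
        where
        witness : ∃[ k ] ∃[ x ] ∃[ y ] (x ≢ y × e P (other k y) ≡ e P k × e P k < e P (other k x) × ¬ p ℕ.∣ ∣ e P (other k x) - e P k ∣) →
                  X ≤ Φ P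
        witness (k , x , y , x≢y , ey≡ , ek< , p∤) = let open ℕ.≤-Reasoning in begin
          X                                                              ≤⟨ Local.goodness (coprime-^ (s k) N⊥p) (e P k) (ν P (γ k)) (λ x → e P (other k x))
                                                                              (λ x → ν P (A k x)) (λ x → z k x P) (λ x → r (other k x) k P) (balance k P) (A-disjoint k P)
                                                                              {p = p} {s = s k} ≡.refl good X<N x≢y ey≡ ek< ρx≡1 (proj₂ (proj₂ (ν-Wᵢⱼ k x P)) ρx≡1) ρy≡0 ⟩
          ν P (A k x) ℕ.+ z k y P                                        ≤⟨ ℕ.+-mono-≤ (≤-sum (λ x → ν P (A k x)) x) (≤-sum (λ x → z k x P) y) ⟩
          sum (λ x → ν P (A k x)) ℕ.+ sum (λ x → z k x P)                ≤⟨ ≤-sum (λ k → sum (λ x → ν P (A k x)) ℕ.+ sum (λ x → z k x P)) k ⟩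
          Φ P                                                            ∎
          where
          ρx≡1 : r (other k x) k P ≡ 1
          ρx≡1 = ∤⇒ramified (e P (other k x)) (e P k) p∤
          ρy≡0 : r (other k y) k P ≡ 0
          ρy≡0 = ≡.trans (≡.cong (λ m → ramification p m (e P k)) ey≡) (unramified (e P k))

    module WithPlaces {S : List Place} (dist : AllPairs Distinct S)
                      (full-f : ∀ i → Full S (f i)) (full-A : ∀ k x → Full S (A k x)) where

      ρ : Fin 4 → Fin 4 → ℕ
      ρ i j = ⟨ r i j ⟩ S

      module WithMaximum (i₀ j₀ : Fin 4) {M : ℕ} (M≡ρ : M ≡ ρ i₀ j₀) (ρ≤M : ∀ i j → ρ i j ≤ M) where

        -- On the affine line each of these dlogs has fewer zeros than poles, because the degree of
        -- a Wronskian is smaller than the sum of the two degrees.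
        z<ρ : ∀ k x → ⟨ z k x ⟩ S < ρ (other k x) k
        z<ρ k x = ℕ.+-cancelˡ-< (deg (f i) ℕ.+ deg (f k)) _ _ (let open ℕ.≤-Reasoning in begin-strict
          deg (f i) ℕ.+ deg (f k) ℕ.+ ⟨ z k x ⟩ S                 ≡⟨ ≡.cong (ℕ._+ ⟨ z k x ⟩ S) (≡.cong₂ ℕ._+_ (full-f i) (full-f k)) ⟨
          ⟨ ν′ i ⟩ S ℕ.+ ⟨ ν′ k ⟩ S ℕ.+ ⟨ z k x ⟩ S               ≡⟨ ≡.cong (ℕ._+ ⟨ z k x ⟩ S) (⟨⟩-+ (ν′ i) (ν′ k) S) ⟨
          ⟨ (λ P → ν′ i P ℕ.+ ν′ k P) ⟩ S ℕ.+ ⟨ z k x ⟩ S         ≡⟨ ⟨⟩-+ (λ P → ν′ i P ℕ.+ ν′ k P) (z k x) S ⟨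
          ⟨ (λ P → ν′ i P ℕ.+ ν′ k P ℕ.+ z k x P) ⟩ S             ≡⟨ ⟨⟩-cong (λ P → proj₁ (proj₂ (ν-Wᵢⱼ k x P))) S ⟨
          ⟨ (λ P → νW P ℕ.+ r i k P) ⟩ S                          ≡⟨ ⟨⟩-+ νW (r i k) S ⟩
          ⟨ νW ⟩ S ℕ.+ ρ i k                                      ≤⟨ ℕ.+-monoˡ-≤ (ρ i k) (⟨ν⟩≤deg dist (W≉0 (other≢ k x))) ⟩
          deg (W (f i) (f k)) ℕ.+ ρ i k                           <⟨ ℕ.+-monoˡ-< (ρ i k) (deg-W (f≉0 i) (f≉0 k) (W≉0 (other≢ k x))) ⟩
          deg (f i) ℕ.+ deg (f k) ℕ.+ ρ i k                       ∎)
          where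
          i = other k x
          ν′ = λ i P → e P i
          νW = λ P → ν P (W (f i) (f k))

        z≤M : ∀ k x → ⟨ z k x ⟩ S ≤ M
        z≤M k x = ℕ.≤-trans (ℕ.<⇒≤ (z<ρ k x)) (ρ≤M (other k x) k)

        0<M : 0 < M
        0<M = ℕ.≤-trans (ℕ.≤-<-trans z≤n (z<ρ 0F 0F)) (ρ≤M (other 0F 0F) 0F)

        νA : Fin 4 → Fin 3 → Place → ℕ
        νA k x P = ν P (A k x)

        total : Fin 4 → Place → ℕ
        total k P = sum (λ x → z k x P ℕ.+ r (other k x) k P)

        total≤6M : ∀ k → ⟨ total k ⟩ S ≤ 6 ℕ.* M
        total≤6M k = let open ℕ.≤-Reasoning in begin
          ⟨ total k ⟩ S                                               ≡⟨ ⟨sum⟩ (λ x P → z k x P ℕ.+ r (other k x) k P) S ⟩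
          sum (λ x → ⟨ (λ P → z k x P ℕ.+ r (other k x) k P) ⟩ S)     ≤⟨ sum-≤ _ (λ x → ℕ.≤-trans (ℕ.≤-reflexive (⟨⟩-+ (z k x) (r (other k x) k) S))
                                                                           (ℕ.+-mono-≤ (z≤M k x) (ρ≤M (other k x) k))) ⟩
          3 ℕ.* (M ℕ.+ M)                                             ≡⟨ 3*2≡6 M ⟩
          6 ℕ.* M                                                     ∎

        deg-A≤36M : ∀ k → sum (λ x → ⟨ νA k x ⟩ S) ≤ 36 ℕ.* M
        -- The chain 6 ≤ 6 + 151 = 157 ≤ X < N supplies the hypothesis 6 ≤ N of `absorb`.
        deg-A≤36M k = absorb N (⟨ supports k ⟩ S) M _ (ℕ.≤-trans (ℕ.m≤m+n 6 151) (ℕ.≤-trans 156<X (ℕ.<⇒≤ X<N)))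
          (sum-≤ (λ x → ⟨ νA k x ⟩ S) (λ x → ≡.subst (_≤ ⟨ supports k ⟩ S) (≡.sym (full-A k x)) (deg-A k dist (full-A k) x)))
          (let open ℕ.≤-Reasoning in begin
            N ℕ.* ⟨ supports k ⟩ S                                        ≡⟨ ⟨⟩-* N (supports k) S ⟨
            ⟨ (λ P → N ℕ.* supports k P) ⟩ S                              ≤⟨ ⟨⟩-mono local S ⟩
            ⟨ (λ P → N ℕ.* total k P ℕ.+ sum (λ x → νA k x P)) ⟩ S        ≡⟨ ⟨⟩-+ (λ P → N ℕ.* total k P) (λ P → sum (λ x → νA k x P)) S ⟩
            ⟨ (λ P → N ℕ.* total k P) ⟩ S ℕ.+ ⟨ (λ P → sum (λ x → νA k x P)) ⟩ S   ≡⟨ ≡.cong₂ ℕ._+_ (⟨⟩-* N (total k) S) (⟨sum⟩ (νA k) S) ⟩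
            N ℕ.* ⟨ total k ⟩ S ℕ.+ sum (λ x → ⟨ νA k x ⟩ S)              ≤⟨ ℕ.+-monoˡ-≤ _ (ℕ.*-monoʳ-≤ N (total≤6M k)) ⟩
            N ℕ.* (6 ℕ.* M) ℕ.+ sum (λ x → ⟨ νA k x ⟩ S)                  ∎)
          where
          regroup : ∀ x y z → x ℕ.+ y ℕ.+ z ≡ x ℕ.+ (y ℕ.+ (z ℕ.+ 0))
          regroup x y z = ≡.trans (ℕ.+-assoc x y z) (≡.cong (λ w → x ℕ.+ (y ℕ.+ w)) (≡.sym (ℕ.+-identityʳ z)))
          local : ∀ P → N ℕ.* supports k P ≤ N ℕ.* total k P ℕ.+ sum (λ x → νA k x P)
          local P = ≡.subst (λ w → N ℕ.* supports k P ≤ N ℕ.* total k P ℕ.+ w) (regroup (νA k 0F P) (νA k 1F P) (νA k 2F P))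
            (Local.support-bound (coprime-^ (s k) N⊥p) (e P k) (ν P (γ k)) (λ x → e P (other k x))
              (λ x → νA k x P) (λ x → z k x P) (λ x → r (other k x) k P) (balance k P) (A-disjoint k P))

        Φ≤ : ⟨ Φ ⟩ S ≤ 156 ℕ.* M
        Φ≤ = let open ℕ.≤-Reasoning in begin
          ⟨ Φ ⟩ S                     ≡⟨ ⟨sum⟩ (λ k P → sum (λ x → νA k x P) ℕ.+ sum (λ x → z k x P)) S ⟩
          sum (λ k → ⟨ (λ P → sum (λ x → νA k x P) ℕ.+ sum (λ x → z k x P)) ⟩ S)   ≤⟨ sum-≤ _ each ⟩
          4 ℕ.* (36 ℕ.* M ℕ.+ 3 ℕ.* M)  ≡⟨ 4*39≡156 M ⟩
          156 ℕ.* M                   ∎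
          where
          each : ∀ k → ⟨ (λ P → sum (λ x → νA k x P) ℕ.+ sum (λ x → z k x P)) ⟩ S ≤ 36 ℕ.* M ℕ.+ 3 ℕ.* M
          each k = let open ℕ.≤-Reasoning in begin
            ⟨ (λ P → sum (λ x → νA k x P) ℕ.+ sum (λ x → z k x P)) ⟩ S              ≡⟨ ⟨⟩-+ (λ P → sum (λ x → νA k x P)) (λ P → sum (λ x → z k x P)) S ⟩
            ⟨ (λ P → sum (λ x → νA k x P)) ⟩ S ℕ.+ ⟨ (λ P → sum (λ x → z k x P)) ⟩ S ≡⟨ ≡.cong₂ ℕ._+_ (⟨sum⟩ (νA k) S) (⟨sum⟩ (z k) S) ⟩
            sum (λ x → ⟨ νA k x ⟩ S) ℕ.+ sum (λ x → ⟨ z k x ⟩ S)                    ≤⟨ ℕ.+-mono-≤ (deg-A≤36M k) (sum-≤ _ (z≤M k)) ⟩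
            36 ℕ.* M ℕ.+ 3 ℕ.* M                                                    ∎

        absurd : ⊥
        absurd = ℕ.<⇒≱ 156<X (ℕ.*-cancelʳ-≤ X 156 M {{ℕ.>-nonZero 0<M}} (let open ℕ.≤-Reasoning in begin
          X ℕ.* M                             ≡⟨ ≡.cong (X ℕ.*_) M≡ρ ⟩
          X ℕ.* ρ i₀ j₀                       ≡⟨ ⟨⟩-* X (r i₀ j₀) S ⟨
          ⟨ (λ P → X ℕ.* r i₀ j₀ P) ⟩ S       ≤⟨ ⟨⟩-mono {λ P → X ℕ.* r i₀ j₀ P} {Φ} (λ P → X*r≤Φ P i₀ j₀) S ⟩
          ⟨ Φ ⟩ S                               ≤⟨ Φ≤ ⟩
          156 ℕ.* M                             ∎))

      absurd : ⊥
      absurd = conclude (maximum₂ 3 ρ)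
        where
        conclude : ∃[ i ] ∃[ j ] (∀ k l → ρ k l ≤ ρ i j) → ⊥
        conclude (i₀ , j₀ , max) = WithMaximum.absurd i₀ j₀ ≡.refl max

    absurd : ⊥
    -- A single list of places has to serve all `f i` and all `A k x`; every one of them divides the
    -- product factored here.
    absurd = factorisation Π≉0 λ (S , dist , full) → WithPlaces.absurd {S} dist
      (λ i → Full-∣ {S} dist Π≉0 (∣-*ʳ _ (∣-Π f i)) full)
      (λ k x → Full-∣ {S} dist Π≉0 (∣ʳ-trans (A∣Y k x) (∣ʳ-trans (∣-Π (Y k) x) (∣-*ˡ _ (∣-Π (λ k → Πᵣ (Y k)) k)))) full)
      where
      Π≉0 : Πᵣ f * Πᵣ (λ k → Πᵣ (Y k)) ≉ 0#
      Π≉0 = *-≉0 (Π-≉0 f f≉0) (Π-≉0 (λ k → Πᵣ (Y k)) (λ k → Π-≉0 (Y k) (Y≉0 k)))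

-- The ring F_p[t] of coefficient lists modulo p.

module Modular (p : ℕ) .{{_ : ℕ.NonZero p}} where

  infix 4 _≡ₚ_
  _≡ₚ_ : ℕ → ℕ → Set
  a ≡ₚ b = a ≡[ p ] b

  %-≤ : ∀ {a b} → a ≤ b → p ℕ.∣ b ℕ.∸ a → a ℕ.% p ≡ b ℕ.% p
  %-≤ {a} {b} a≤b (ℕ.divides q eq) = ≡.trans (≡.sym (ℕ.[m+kn]%n≡m%n a q p))
    (≡.cong (ℕ._% p) (≡.trans (≡.cong (a ℕ.+_) (≡.sym eq)) (ℕ.m+[n∸m]≡n a≤b)))

  to% : ∀ {a b} → a ≡ₚ b → a ℕ.% p ≡ b ℕ.% p
  to% {a} {b} p∣ with ℕ.≤-total a b
  ... | inj₁ a≤b = %-≤ a≤b (≡.subst (p ℕ.∣_) (ℕ.m≤n⇒∣m-n∣≡n∸m a≤b) p∣)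
  ... | inj₂ b≤a = ≡.sym (%-≤ b≤a (≡.subst (p ℕ.∣_) (ℕ.m≤n⇒∣n-m∣≡n∸m b≤a) p∣))

  from% : ∀ {a b} → a ℕ.% p ≡ b ℕ.% p → a ≡ₚ b
  from% {a} {b} eq = ℕ.divides ∣ a ℕ./ p - b ℕ./ p ∣ (let open ≡.≡-Reasoning in begin
    ∣ a - b ∣                                                              ≡⟨ ≡.cong₂ ∣_-_∣ (ℕ.m≡m%n+[m/n]*n a p) (ℕ.m≡m%n+[m/n]*n b p) ⟩
    ∣ a ℕ.% p ℕ.+ a ℕ./ p ℕ.* p - b ℕ.% p ℕ.+ b ℕ./ p ℕ.* p ∣              ≡⟨ ≡.cong (λ x → ∣ x ℕ.+ a ℕ./ p ℕ.* p - b ℕ.% p ℕ.+ b ℕ./ p ℕ.* p ∣) eq ⟩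
    ∣ b ℕ.% p ℕ.+ a ℕ./ p ℕ.* p - b ℕ.% p ℕ.+ b ℕ./ p ℕ.* p ∣              ≡⟨ ℕ.∣m+n-m+o∣≡∣n-o∣ (b ℕ.% p) _ _ ⟩
    ∣ a ℕ./ p ℕ.* p - b ℕ./ p ℕ.* p ∣                                      ≡⟨ ℕ.*-distribʳ-∣-∣ p (a ℕ./ p) (b ℕ./ p) ⟨
    ∣ a ℕ./ p - b ℕ./ p ∣ ℕ.* p                                            ∎)

  ≡⇒≡ₚ : ∀ {a b} → a ≡ b → a ≡ₚ b
  ≡⇒≡ₚ {a} ≡.refl = from% {a} ≡.refl

  ≡ₚ-sym : ∀ {a b} → a ≡ₚ b → b ≡ₚ a
  ≡ₚ-sym {a} {b} = ≡.subst (p ℕ.∣_) (ℕ.∣-∣-comm a b)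

  ≡ₚ-trans : ∀ {a b c} → a ≡ₚ b → b ≡ₚ c → a ≡ₚ c
  ≡ₚ-trans {a} {b} {c} p∣ p∣′ = from% {a} {c} (≡.trans (to% {a} {b} p∣) (to% {b} {c} p∣′))

  +-congₚ : ∀ {a b c d} → a ≡ₚ b → c ≡ₚ d → a ℕ.+ c ≡ₚ b ℕ.+ d
  +-congₚ {a} {b} {c} {d} e e′ = from% {a ℕ.+ c} {b ℕ.+ d} (≡.trans (ℕ.%-distribˡ-+ a c p)
    (≡.trans (≡.cong₂ (λ x y → (x ℕ.+ y) ℕ.% p) (to% {a} {b} e) (to% {c} {d} e′)) (≡.sym (ℕ.%-distribˡ-+ b d p))))

  *-congₚ : ∀ {a b c d} → a ≡ₚ b → c ≡ₚ d → a ℕ.* c ≡ₚ b ℕ.* d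
  *-congₚ {a} {b} {c} {d} e e′ = from% {a ℕ.* c} {b ℕ.* d} (≡.trans (ℕ.%-distribˡ-* a c p)
    (≡.trans (≡.cong₂ (λ x y → (x ℕ.* y) ℕ.% p) (to% {a} {b} e) (to% {c} {d} e′)) (≡.sym (ℕ.%-distribˡ-* b d p))))

  ∣⇒≡ₚ0 : ∀ {a} → p ℕ.∣ a → a ≡ₚ 0
  ∣⇒≡ₚ0 {a} = ≡.subst (p ℕ.∣_) (≡.sym (ℕ.∣-∣-identityʳ a))

  ≡ₚ0⇒∣ : ∀ {a} → a ≡ₚ 0 → p ℕ.∣ a
  ≡ₚ0⇒∣ {a} = ≡.subst (p ℕ.∣_) (ℕ.∣-∣-identityʳ a)

  ∣-resp-≡ₚ : ∀ {a b} → a ≡ₚ b → p ℕ.∣ a → p ℕ.∣ b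
  ∣-resp-≡ₚ {a} {b} a≡b p∣a = ≡ₚ0⇒∣ {b} (≡ₚ-trans {b} {a} {0} (≡ₚ-sym {a} {b} a≡b) (∣⇒≡ₚ0 p∣a))

module PolynomialsModulo (m : ℕ) (pp : Prime (suc m)) where
  p = suc m
  open Modular p

  infix 4 _≈_
  -- `PEq` unfolds to a statement about coefficients from which P and Q cannot be inferred; the
  -- record keeps them visible to unification.
  record _≈_ (P Q : Poly) : Set where
    constructor mk≈
    field at : PEq p P Q
  open _≈_ public

  coeff-add : ∀ P Q i → coeff (addP P Q) i ≡ coeff P i ℕ.+ coeff Q i
  coeff-add []      Q       i       = ≡.refl
  coeff-add (a ∷ P) []      zero    = ≡.sym (ℕ.+-identityʳ a)
  coeff-add (a ∷ P) []      (suc i) = ≡.sym (ℕ.+-identityʳ _)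
  coeff-add (a ∷ P) (b ∷ Q) zero    = ≡.refl
  coeff-add (a ∷ P) (b ∷ Q) (suc i) = coeff-add P Q i

  scale : ℕ → Poly → Poly
  scale a = map (a ℕ.*_)

  coeff-scale : ∀ a Q i → coeff (scale a Q) i ≡ a ℕ.* coeff Q i
  coeff-scale a []      i       = ≡.sym (ℕ.*-zeroʳ a)
  coeff-scale a (b ∷ Q) zero    = ≡.refl
  coeff-scale a (b ∷ Q) (suc i) = coeff-scale a Q i

  ≡⇒≈ : ∀ {P Q} → (∀ i → coeff P i ≡ coeff Q i) → P ≈ Q
  ≡⇒≈ {P} {Q} eq = mk≈ λ i → ≡⇒≡ₚ {coeff P i} (eq i)

  setoid : Setoid 0ℓ 0ℓ
  setoid = record
    { Carrier = Poly ; _≈_ = _≈_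
    ; isEquivalence = record
      { refl  = λ {P} → ≡⇒≈ {P} {P} λ _ → ≡.refl
      ; sym   = λ {P} {Q} e → mk≈ λ i → ≡ₚ-sym {coeff P i} {coeff Q i} (at e i)
      ; trans = λ {P} {Q} {R} e e′ → mk≈ λ i → ≡ₚ-trans {coeff P i} {coeff Q i} {coeff R i} (at e i) (at e′ i) } }

  open Setoid setoid using (refl; sym; trans)
  module ≈-Reasoning = SetoidReasoning setoid

  by-coeff : ∀ {P Q} (f g : ℕ → ℕ) → (∀ i → coeff P i ≡ f i) → (∀ i → coeff Q i ≡ g i) →
             (∀ i → f i ≡ₚ g i) → P ≈ Q
  by-coeff f g P≡ Q≡ f≡g = mk≈ λ i → ≡.subst₂ _≡ₚ_ (≡.sym (P≡ i)) (≡.sym (Q≡ i)) (f≡g i)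

  add-cong : ∀ {P P′ Q Q′} → P ≈ P′ → Q ≈ Q′ → addP P Q ≈ addP P′ Q′
  add-cong {P} {P′} {Q} {Q′} e e′ = by-coeff _ _ (coeff-add P Q) (coeff-add P′ Q′)
    λ i → +-congₚ {coeff P i} {coeff P′ i} {coeff Q i} {coeff Q′ i} (at e i) (at e′ i)

  add-comm : ∀ P Q → addP P Q ≈ addP Q P
  add-comm P Q = ≡⇒≈ λ i → ≡.trans (coeff-add P Q i) (≡.trans (ℕ.+-comm (coeff P i) _) (≡.sym (coeff-add Q P i)))

  add-assoc : ∀ P Q R → addP (addP P Q) R ≈ addP P (addP Q R)
  add-assoc P Q R = ≡⇒≈ λ i → let open ≡.≡-Reasoning in begin
    coeff (addP (addP P Q) R) i                ≡⟨ coeff-add (addP P Q) R i ⟩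
    coeff (addP P Q) i ℕ.+ coeff R i           ≡⟨ ≡.cong (ℕ._+ coeff R i) (coeff-add P Q i) ⟩
    coeff P i ℕ.+ coeff Q i ℕ.+ coeff R i      ≡⟨ ℕ.+-assoc (coeff P i) _ _ ⟩
    coeff P i ℕ.+ (coeff Q i ℕ.+ coeff R i)    ≡⟨ ≡.cong (coeff P i ℕ.+_) (coeff-add Q R i) ⟨
    coeff P i ℕ.+ coeff (addP Q R) i           ≡⟨ coeff-add P (addP Q R) i ⟨
    coeff (addP P (addP Q R)) i                ∎

  add-[] : ∀ P → addP P [] ≈ P
  add-[] P = add-comm P []

  +-commutativeMonoid : CommutativeMonoid 0ℓ 0ℓ
  +-commutativeMonoid = record
    { Carrier = Poly ; _≈_ = _≈_ ; _∙_ = addP ; ε = []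
    ; isCommutativeMonoid = record
      { isMonoid = record
        { isSemigroup = record
          { isMagma = record { isEquivalence = Setoid.isEquivalence setoid ; ∙-cong = add-cong }
          ; assoc = add-assoc }
        ; identity = (λ P → refl) , add-[] }
      ; comm = add-comm } }

  open import Algebra.Properties.CommutativeSemigroup (CommutativeMonoid.commutativeSemigroup +-commutativeMonoid)
    using (interchange; x∙yz≈y∙xz)

  ∷-cong : ∀ {a b P Q} → a ≡ₚ b → P ≈ Q → a ∷ P ≈ b ∷ Q
  ∷-cong a≡b e = mk≈ λ { zero → a≡b ; (suc i) → at e i }

  0∷-cong : ∀ {P Q} → P ≈ Q → 0 ∷ P ≈ 0 ∷ Q
  0∷-cong = ∷-cong (≡⇒≡ₚ {0} ≡.refl)

  0∷[]≈[] : 0 ∷ [] ≈ []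
  0∷[]≈[] = ≡⇒≈ λ { zero → ≡.refl ; (suc i) → ≡.refl }

  scale-cong : ∀ {a b P Q} → a ≡ₚ b → P ≈ Q → scale a P ≈ scale b Q
  scale-cong {a} {b} {P} {Q} a≡b e = by-coeff _ _ (coeff-scale a P) (coeff-scale b Q)
    λ i → *-congₚ {a} {b} {coeff P i} {coeff Q i} a≡b (at e i)

  scale-congʳ : ∀ a {P Q} → P ≈ Q → scale a P ≈ scale a Q
  scale-congʳ a = scale-cong {a} {a} (≡⇒≡ₚ {a} ≡.refl)

  scale-add : ∀ a P Q → scale a (addP P Q) ≈ addP (scale a P) (scale a Q)
  scale-add a P Q = ≡⇒≈ λ i → let open ≡.≡-Reasoning in begin
    coeff (scale a (addP P Q)) i                     ≡⟨ coeff-scale a (addP P Q) i ⟩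
    a ℕ.* coeff (addP P Q) i                         ≡⟨ ≡.cong (a ℕ.*_) (coeff-add P Q i) ⟩
    a ℕ.* (coeff P i ℕ.+ coeff Q i)                  ≡⟨ ℕ.*-distribˡ-+ a _ _ ⟩
    a ℕ.* coeff P i ℕ.+ a ℕ.* coeff Q i              ≡⟨ ≡.cong₂ ℕ._+_ (coeff-scale a P i) (coeff-scale a Q i) ⟨
    coeff (scale a P) i ℕ.+ coeff (scale a Q) i      ≡⟨ coeff-add (scale a P) (scale a Q) i ⟨
    coeff (addP (scale a P) (scale a Q)) i           ∎

  scale-+ : ∀ a b P → scale (a ℕ.+ b) P ≈ addP (scale a P) (scale b P)
  scale-+ a b P = ≡⇒≈ λ i → let open ≡.≡-Reasoning in begin
    coeff (scale (a ℕ.+ b) P) i                      ≡⟨ coeff-scale (a ℕ.+ b) P i ⟩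
    (a ℕ.+ b) ℕ.* coeff P i                          ≡⟨ ℕ.*-distribʳ-+ (coeff P i) a b ⟩
    a ℕ.* coeff P i ℕ.+ b ℕ.* coeff P i              ≡⟨ ≡.cong₂ ℕ._+_ (coeff-scale a P i) (coeff-scale b P i) ⟨
    coeff (scale a P) i ℕ.+ coeff (scale b P) i      ≡⟨ coeff-add (scale a P) (scale b P) i ⟨
    coeff (addP (scale a P) (scale b P)) i           ∎

  scale-scale : ∀ a b P → scale (a ℕ.* b) P ≈ scale a (scale b P)
  scale-scale a b P = ≡⇒≈ λ i → let open ≡.≡-Reasoning in begin
    coeff (scale (a ℕ.* b) P) i      ≡⟨ coeff-scale (a ℕ.* b) P i ⟩
    a ℕ.* b ℕ.* coeff P i            ≡⟨ ℕ.*-assoc a b _ ⟩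
    a ℕ.* (b ℕ.* coeff P i)          ≡⟨ ≡.cong (a ℕ.*_) (coeff-scale b P i) ⟨
    a ℕ.* coeff (scale b P) i        ≡⟨ coeff-scale a (scale b P) i ⟨
    coeff (scale a (scale b P)) i    ∎

  scale-0∷ : ∀ a P → scale a (0 ∷ P) ≈ 0 ∷ scale a P
  scale-0∷ a P = ∷-cong (≡⇒≡ₚ {a ℕ.* 0} (ℕ.*-zeroʳ a)) refl

  scale-1 : ∀ P → scale 1 P ≈ P
  scale-1 P = ≡⇒≈ λ i → ≡.trans (coeff-scale 1 P i) (ℕ.*-identityˡ _)

  scale-p∣ : ∀ {a} P → p ℕ.∣ a → scale a P ≈ []
  scale-p∣ {a} P p∣a = by-coeff _ _ (coeff-scale a P) (λ i → ≡.refl) λ i → ∣⇒≡ₚ0 (ℕ.∣m⇒∣m*n (coeff P i) p∣a)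

  scale-0 : ∀ P → scale 0 P ≈ []
  scale-0 P = scale-p∣ P (p ℕ.∣0)

  ∷≈ : ∀ a P → a ∷ P ≈ addP (a ∷ []) (0 ∷ P)
  ∷≈ a P = ∷-cong (≡⇒≡ₚ {a} (≡.sym (ℕ.+-identityʳ a))) refl

  mul-congʳ : ∀ P {Q Q′} → Q ≈ Q′ → mulP P Q ≈ mulP P Q′
  mul-congʳ []      e = refl
  mul-congʳ (a ∷ P) e = add-cong (scale-congʳ a e) (0∷-cong (mul-congʳ P e))

  mul-[] : ∀ P → mulP P [] ≈ []
  mul-[] []      = refl
  mul-[] (a ∷ P) = trans (0∷-cong (mul-[] P)) 0∷[]≈[]

  mul-distribˡ : ∀ P Q R → mulP P (addP Q R) ≈ addP (mulP P Q) (mulP P R)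
  mul-distribˡ []      Q R = refl
  mul-distribˡ (a ∷ P) Q R = trans (add-cong (scale-add a Q R) (0∷-cong (mul-distribˡ P Q R)))
    (interchange (scale a Q) (scale a R) (0 ∷ mulP P Q) (0 ∷ mulP P R))

  mul-distribʳ : ∀ R P Q → mulP (addP P Q) R ≈ addP (mulP P R) (mulP Q R)
  mul-distribʳ R []      Q       = refl
  mul-distribʳ R (a ∷ P) []      = sym (add-[] _)
  mul-distribʳ R (a ∷ P) (b ∷ Q) = trans (add-cong (scale-+ a b R) (0∷-cong (mul-distribʳ R P Q)))
    (interchange (scale a R) (scale b R) (0 ∷ mulP P R) (0 ∷ mulP Q R))

  mul-scaleˡ : ∀ a P Q → mulP (scale a P) Q ≈ scale a (mulP P Q)
  mul-scaleˡ a []      Q = refl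
  mul-scaleˡ a (b ∷ P) Q = trans (add-cong (scale-scale a b Q) (trans (0∷-cong (mul-scaleˡ a P Q)) (sym (scale-0∷ a _))))
    (sym (scale-add a (scale b Q) (0 ∷ mulP P Q)))

  mul-0∷ˡ : ∀ P Q → mulP (0 ∷ P) Q ≈ 0 ∷ mulP P Q
  mul-0∷ˡ P Q = add-cong (scale-0 Q) refl

  mul-0∷ʳ : ∀ P Q → mulP P (0 ∷ Q) ≈ 0 ∷ mulP P Q
  mul-0∷ʳ []      Q = sym 0∷[]≈[]
  mul-0∷ʳ (a ∷ P) Q = add-cong (scale-0∷ a Q) (0∷-cong (mul-0∷ʳ P Q))

  mul-constʳ : ∀ P a → mulP P (a ∷ []) ≈ scale a P
  mul-constʳ []      a = refl
  mul-constʳ (b ∷ P) a = ∷-cong (≡⇒≡ₚ {b ℕ.* a ℕ.+ 0} (≡.trans (ℕ.+-identityʳ _) (ℕ.*-comm b a))) (mul-constʳ P a)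

  mul-comm : ∀ P Q → mulP P Q ≈ mulP Q P
  mul-comm []      Q = sym (mul-[] Q)
  mul-comm (a ∷ P) Q = let open ≈-Reasoning in begin
    addP (scale a Q) (0 ∷ mulP P Q)              ≈⟨ add-cong (sym (mul-constʳ Q a)) (trans (0∷-cong (mul-comm P Q)) (sym (mul-0∷ʳ Q P))) ⟩
    addP (mulP Q (a ∷ [])) (mulP Q (0 ∷ P))      ≈⟨ mul-distribˡ Q (a ∷ []) (0 ∷ P) ⟨
    mulP Q (addP (a ∷ []) (0 ∷ P))               ≈⟨ mul-congʳ Q (∷≈ a P) ⟨
    mulP Q (a ∷ P)                               ∎

  mul-cong : ∀ {P P′ Q Q′} → P ≈ P′ → Q ≈ Q′ → mulP P Q ≈ mulP P′ Q′
  mul-cong {P} {P′} {Q} {Q′} e e′ = trans (mul-congʳ P e′) (trans (mul-comm P Q′) (trans (mul-congʳ Q′ e) (mul-comm Q′ P′)))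

  mul-assoc : ∀ P Q R → mulP (mulP P Q) R ≈ mulP P (mulP Q R)
  mul-assoc []      Q R = refl
  mul-assoc (a ∷ P) Q R = trans (mul-distribʳ R (scale a Q) (0 ∷ mulP P Q))
    (add-cong (mul-scaleˡ a Q R) (trans (mul-0∷ˡ (mulP P Q) R) (0∷-cong (mul-assoc P Q R))))

  mul-one : ∀ P → mulP oneP P ≈ P
  mul-one P = trans (add-cong (scale-1 P) 0∷[]≈[]) (add-[] P)

  -- m = p - 1 represents -1.
  neg : Poly → Poly
  neg = scale m

  neg-inverse : ∀ P → addP P (neg P) ≈ []
  neg-inverse P = trans (add-cong (sym (scale-1 P)) refl) (trans (sym (scale-+ 1 m P)) (scale-p∣ P ℕ.∣-refl))

  commutativeRing : CommutativeRing 0ℓ 0ℓ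
  commutativeRing = record
    { Carrier = Poly ; _≈_ = _≈_ ; _+_ = addP ; _*_ = mulP ; -_ = neg ; 0# = [] ; 1# = oneP
    ; isCommutativeRing = record
      { isRing = record
        { +-isAbelianGroup = record
          { isGroup = record
            { isMonoid = CommutativeMonoid.isMonoid +-commutativeMonoid
            ; inverse = (λ P → trans (add-comm (neg P) P) (neg-inverse P)) , neg-inverse
            ; ⁻¹-cong = scale-congʳ m }
          ; comm = add-comm }
        ; *-cong = mul-cong
        ; *-assoc = mul-assoc
        ; *-identity = mul-one , (λ P → trans (mul-comm P oneP) (mul-one P))
        ; distrib = mul-distribˡ , mul-distribʳ }
      ; *-comm = mul-comm } }

  ≈[]⇒∣ : ∀ {P} → P ≈ [] → ∀ i → p ℕ.∣ coeff P i
  ≈[]⇒∣ {P} e i = ≡ₚ0⇒∣ {coeff P i} (at e i)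

  ∣⇒≈[] : ∀ {P} → (∀ i → p ℕ.∣ coeff P i) → P ≈ []
  ∣⇒≈[] {P} h = mk≈ λ i → ∣⇒≡ₚ0 {coeff P i} (h i)

  All∣⇒ : ∀ {P} → All (p ℕ.∣_) P → ∀ i → p ℕ.∣ coeff P i
  All∣⇒ []       i       = p ℕ.∣0
  All∣⇒ (d ∷ ds) zero    = d
  All∣⇒ (d ∷ ds) (suc i) = All∣⇒ ds i

  ⇒All∣ : ∀ {P} → (∀ i → p ℕ.∣ coeff P i) → All (p ℕ.∣_) P
  ⇒All∣ {[]}    h = []
  ⇒All∣ {a ∷ P} h = h 0 ∷ ⇒All∣ (h ∘ suc)

  ≈[]? : ∀ P → Dec (P ≈ [])
  ≈[]? P = Dec.map′ (∣⇒≈[] ∘ All∣⇒) (⇒All∣ ∘ ≈[]⇒∣) (All.all? (p ℕ.∣?_) P)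

  -- The zero polynomial has degree 0.
  degree : Poly → ℕ
  degree []      = 0
  degree (a ∷ P) with ≈[]? P
  ... | yes _ = 0
  ... | no  _ = suc (degree P)

  -- List entries may be divisible by p, so a degree is characterised by coefficients modulo p; the
  -- predicate also excludes the zero polynomial.
  record HasDegree (P : Poly) (n : ℕ) : Set where
    constructor hasDegree
    field
      leading : ¬ p ℕ.∣ coeff P n
      above   : ∀ {i} → n < i → p ℕ.∣ coeff P i

  degree-correct : ∀ P → ¬ P ≈ [] → HasDegree P (degree P)
  degree-correct []      P≉0 = contradiction refl P≉0
  degree-correct (a ∷ P) P≉0 with ≈[]? P
  ... | yes P≈0 = hasDegree (λ p∣a → P≉0 (∣⇒≈[] λ { zero → p∣a ; (suc i) → ≈[]⇒∣ P≈0 i }))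
                            (λ { {suc i} _ → ≈[]⇒∣ P≈0 i })
  ... | no  P≉0′ with degree-correct P P≉0′
  ...   | hasDegree leading above = hasDegree leading (λ { {suc i} (s≤s lt) → above lt })

  HasDegree-unique : ∀ {P k n} → HasDegree P k → HasDegree P n → k ≡ n
  HasDegree-unique {P} {k} {n} (hasDegree l a) (hasDegree l′ a′) = ℕ.≤-antisym
    (ℕ.≮⇒≥ λ n<k → l (a′ n<k)) (ℕ.≮⇒≥ λ k<n → l′ (a k<n))

  HasDegree-resp : ∀ {P Q n} → P ≈ Q → HasDegree P n → HasDegree Q n
  HasDegree-resp {P} {Q} e (hasDegree l a) = hasDegree
    (λ d → l (∣-resp-≡ₚ {coeff Q _} {coeff P _} (at (sym e) _) d))
    (λ {i} lt → ∣-resp-≡ₚ {coeff P i} {coeff Q i} (at e i) (a lt))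

  HasDegree⇒≉0 : ∀ {P n} → HasDegree P n → ¬ P ≈ []
  HasDegree⇒≉0 (hasDegree l _) P≈0 = l (≈[]⇒∣ P≈0 _)

  degree-unique : ∀ {P n} → HasDegree P n → degree P ≡ n
  degree-unique {P} h = HasDegree-unique (degree-correct P (HasDegree⇒≉0 h)) h

  degree-0 : ∀ {P} → P ≈ [] → degree P ≡ 0
  degree-0 {[]}    e = ≡.refl
  degree-0 {a ∷ P} e with ≈[]? P
  ... | yes _  = ≡.refl
  ... | no  ne = contradiction (∣⇒≈[] (≈[]⇒∣ e ∘ suc)) ne

  degree-cong : ∀ {P Q} → P ≈ Q → degree P ≡ degree Q
  degree-cong {P} {Q} e = by (≈[]? P)
    where
    by : Dec (P ≈ []) → degree P ≡ degree Q
    by (yes P≈0) = ≡.trans (degree-0 P≈0) (≡.sym (degree-0 (trans (sym e) P≈0)))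
    by (no  P≉0) = ≡.sym (degree-unique (HasDegree-resp e (degree-correct P P≉0)))

  above-degree : ∀ P {i} → degree P < i → p ℕ.∣ coeff P i
  above-degree P {i} lt = by (≈[]? P)
    where
    by : Dec (P ≈ []) → p ℕ.∣ coeff P i
    by (yes P≈0) = ≈[]⇒∣ P≈0 i
    by (no  P≉0) = HasDegree.above (degree-correct P P≉0) lt

  degree-add : ∀ P Q → degree (addP P Q) ≤ degree P ℕ.⊔ degree Q
  degree-add P Q = by (≈[]? (addP P Q))
    where
    by : Dec (addP P Q ≈ []) → degree (addP P Q) ≤ degree P ℕ.⊔ degree Q
    by (yes e) = ≡.subst (_≤ degree P ℕ.⊔ degree Q) (≡.sym (degree-0 e)) z≤n
    by (no ne) = ℕ.≮⇒≥ λ lt → HasDegree.leading (degree-correct (addP P Q) ne)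
      (≡.subst (p ℕ.∣_) (≡.sym (coeff-add P Q _)) (ℕ.∣m∣n⇒∣m+n
        (above-degree P (ℕ.m⊔n<o⇒m<o _ _ lt)) (above-degree Q (ℕ.m⊔n<o⇒n<o _ _ lt))))

  coeff-mul-suc : ∀ a P Q i → coeff (mulP (a ∷ P) Q) (suc i) ≡ a ℕ.* coeff Q (suc i) ℕ.+ coeff (mulP P Q) i
  coeff-mul-suc a P Q i = ≡.trans (coeff-add (scale a Q) _ (suc i)) (≡.cong (ℕ._+ coeff (mulP P Q) i) (coeff-scale a Q (suc i)))

  -- The leading term of a + t P comes from t P, except in degree 0, where only the constant a
  -- survives modulo p. There Euclid's lemma keeps the product of leading coefficients nonzero.
  HasDegree-mul : ∀ P {Q k n} → HasDegree P k → HasDegree Q n → HasDegree (mulP P Q) (k ℕ.+ n)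
  HasDegree-mul []      (hasDegree l _) _ = contradiction (p ℕ.∣0) l
  HasDegree-mul (a ∷ P) {Q} {zero} {n} (hasDegree p∤a above) (hasDegree l′ above′) = HasDegree-resp (sym aQ≈) (hasDegree
      (λ d → [ p∤a , l′ ]′ (euclidsLemma a _ pp (≡.subst (p ℕ.∣_) (coeff-scale a Q n) d)))
      (λ {i} lt → ≡.subst (p ℕ.∣_) (≡.sym (coeff-scale a Q i)) (ℕ.∣n⇒∣m*n a (above′ lt))))
    where
    aQ≈ : mulP (a ∷ P) Q ≈ scale a Q
    aQ≈ = trans (add-cong refl (trans (0∷-cong (mul-cong {P} {[]} {Q} (∣⇒≈[] (λ i → above (s≤s z≤n))) refl)) 0∷[]≈[])) (add-[] _)
  HasDegree-mul (a ∷ P) {Q} {suc k} {n} (hasDegree l above) h′@(hasDegree l′ above′)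
    with HasDegree-mul P {Q} {k} {n} (hasDegree l (λ lt → above (s≤s lt))) h′
  ... | hasDegree l″ above″ = hasDegree
      (λ d → l″ (ℕ.∣m+n∣m⇒∣n (≡.subst (p ℕ.∣_) (coeff-mul-suc a P Q (k ℕ.+ n)) d)
        (ℕ.∣n⇒∣m*n a (above′ (s≤s (ℕ.m≤n+m n k))))))
      (λ { {suc i} (s≤s lt) → ≡.subst (p ℕ.∣_) (≡.sym (coeff-mul-suc a P Q i)) (ℕ.∣m∣n⇒∣m+n
        (ℕ.∣n⇒∣m*n a (above′ (ℕ.≤-<-trans (ℕ.m≤n+m n k) (ℕ.<-trans lt (ℕ.n<1+n i))))) (above″ lt)) })

  mul-degree : ∀ {P Q} → ¬ P ≈ [] → ¬ Q ≈ [] → HasDegree (mulP P Q) (degree P ℕ.+ degree Q)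
  mul-degree {P} {Q} P≉0 Q≉0 = HasDegree-mul P (degree-correct P P≉0) (degree-correct Q Q≉0)

  integral : ∀ {P Q} → mulP P Q ≈ [] → P ≈ [] ⊎ Q ≈ []
  integral {P} {Q} PQ≈0 = by (≈[]? P) (≈[]? Q)
    where
    by : Dec (P ≈ []) → Dec (Q ≈ []) → P ≈ [] ⊎ Q ≈ []
    by (yes e) _       = inj₁ e
    by (no _)  (yes e) = inj₂ e
    by (no ne) (no ne′) = contradiction PQ≈0 (HasDegree⇒≉0 (mul-degree ne ne′))

  one≉0 : ¬ oneP ≈ []
  one≉0 e = ℕ.>⇒∤ (ℕ.nonTrivial⇒n>1 p {{prime⇒nonTrivial pp}}) (≈[]⇒∣ e 0)

  inverse : ∀ {c} → ¬ p ℕ.∣ c → ∃[ d ] (d ℕ.* c ≡ₚ 1)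
  inverse {c} p∤c with ℕ.coprime-Bézout (prime⇒coprime′ pp p∤c)
  ... | Bézout.+- x y eq = x , from% {x ℕ.* c} {1} (≡.trans (≡.cong (ℕ._% p) (≡.sym eq)) (ℕ.[m+kn]%n≡m%n 1 y p))
  -- Here 1 + x c = y p, so x is minus an inverse of c; the factor m = p - 1 corrects the sign.
  ... | Bézout.-+ x y eq = m ℕ.* x , from% {m ℕ.* x ℕ.* c} {1} (let open ≡.≡-Reasoning in begin
    (m ℕ.* x ℕ.* c) ℕ.% p                         ≡⟨ ℕ.[m+kn]%n≡m%n (m ℕ.* x ℕ.* c) 1 p ⟨
    (m ℕ.* x ℕ.* c ℕ.+ 1 ℕ.* p) ℕ.% p             ≡⟨ ≡.cong (ℕ._% p) rearranged ⟩
    (1 ℕ.+ m ℕ.* y ℕ.* p) ℕ.% p                   ≡⟨ ℕ.[m+kn]%n≡m%n 1 (m ℕ.* y) p ⟩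
    1 ℕ.% p                                       ∎)
    where
    rearranged : m ℕ.* x ℕ.* c ℕ.+ 1 ℕ.* p ≡ 1 ℕ.+ m ℕ.* y ℕ.* p
    rearranged = let open ≡.≡-Reasoning in begin
      m ℕ.* x ℕ.* c ℕ.+ 1 ℕ.* p        ≡⟨ ≡.cong₂ ℕ._+_ (ℕ.*-assoc m x c) (ℕ.*-identityˡ p) ⟩
      m ℕ.* (x ℕ.* c) ℕ.+ suc m        ≡⟨ ℕ.+-suc _ m ⟩
      suc (m ℕ.* (x ℕ.* c) ℕ.+ m)      ≡⟨ ≡.cong suc (≡.trans (ℕ.+-comm _ m) (≡.sym (ℕ.*-suc m (x ℕ.* c)))) ⟩
      suc (m ℕ.* suc (x ℕ.* c))        ≡⟨ ≡.cong (λ w → suc (m ℕ.* w)) eq ⟩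
      suc (m ℕ.* (y ℕ.* p))            ≡⟨ ≡.cong suc (ℕ.*-assoc m y p) ⟨
      suc (m ℕ.* y ℕ.* p)              ∎

  -- Recursion on the coefficient list, not on the degree: if F = q G + r, then a + t F = t q G + (a
  -- + t r), and as a + t r has no terms above degree n, one multiple k G removes its coefficient at
  -- n.
  divMod : ∀ F {G} → ¬ G ≈ [] → ∃[ q ] ∃[ r ] (F ≈ addP (mulP q G) r × (r ≈ [] ⊎ degree r < degree G))
  divMod F {G} G≉0 = finish (division F)
    where
    n = degree G
    c = coeff G n
    c⁻¹ = proj₁ (inverse (HasDegree.leading (degree-correct G G≉0)))
    c⁻¹*c≡1 : c⁻¹ ℕ.* c ≡ₚ 1
    c⁻¹*c≡1 = proj₂ (inverse (HasDegree.leading (degree-correct G G≉0)))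
    -- Smallness is phrased through coefficients, since `degree r < n` fails for r = 0 when n = 0.
    Division : Poly → Set
    Division F = ∃[ q ] ∃[ r ] (F ≈ addP (mulP q G) r × (∀ i → n ≤ i → p ℕ.∣ coeff r i))
    finish : Division F → ∃[ q ] ∃[ r ] (F ≈ addP (mulP q G) r × (r ≈ [] ⊎ degree r < degree G))
    finish (q , r , eq , small) = q , r , eq , by (≈[]? r)
      where
      by : Dec (r ≈ []) → r ≈ [] ⊎ degree r < degree G
      by (yes e) = inj₁ e
      by (no ne) = inj₂ (ℕ.≰⇒> λ le → HasDegree.leading (degree-correct r ne) (small _ le))
    step : ∀ a F → Division F → Division (a ∷ F)
    step a F (q , r , eq , small) = addP (0 ∷ q) (k ∷ []) , r″ , eq″ , small″
      where
      r′ = a ∷ r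
      b = coeff r′ n
      k = b ℕ.* c⁻¹
      r″ = addP r′ (scale (m ℕ.* k) G)
      cancelled : addP (scale k G) (scale (m ℕ.* k) G) ≈ []
      cancelled = trans (sym (scale-+ k (m ℕ.* k) G)) (scale-p∣ G (ℕ.m∣m*n {p} k))
      eq″ : a ∷ F ≈ addP (mulP (addP (0 ∷ q) (k ∷ [])) G) r″
      eq″ = let open ≈-Reasoning in begin
        a ∷ F                                             ≈⟨ ∷-cong (≡⇒≡ₚ {a} ≡.refl) eq ⟩
        addP (0 ∷ mulP q G) r′                            ≈⟨ add-cong (sym (add-[] (0 ∷ mulP q G))) (sym (add-[] r′)) ⟩
        addP (addP (0 ∷ mulP q G) []) (addP r′ [])        ≈⟨ interchange (0 ∷ mulP q G) [] r′ [] ⟩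
        addP (addP (0 ∷ mulP q G) r′) []                  ≈⟨ add-cong (refl {addP (0 ∷ mulP q G) r′}) (sym cancelled) ⟩
        addP (addP (0 ∷ mulP q G) r′) (addP (scale k G) (scale (m ℕ.* k) G))
          ≈⟨ interchange (0 ∷ mulP q G) r′ (scale k G) (scale (m ℕ.* k) G) ⟩
        addP (addP (0 ∷ mulP q G) (scale k G)) r″
          ≈⟨ add-cong (add-cong (sym (mul-0∷ˡ q G)) (sym (trans (mul-comm (k ∷ []) G) (mul-constʳ G k)))) refl ⟩
        addP (addP (mulP (0 ∷ q) G) (mulP (k ∷ []) G)) r″
          ≈⟨ add-cong (sym (mul-distribʳ G (0 ∷ q) (k ∷ []))) refl ⟩
        addP (mulP (addP (0 ∷ q) (k ∷ [])) G) r″          ∎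
      small-r′ : ∀ i → n < i → p ℕ.∣ coeff r′ i
      small-r′ (suc i) (s≤s n≤i) = small i n≤i
      coeff-r″ : ∀ i → coeff r″ i ≡ coeff r′ i ℕ.+ m ℕ.* k ℕ.* coeff G i
      coeff-r″ i = ≡.trans (coeff-add r′ (scale (m ℕ.* k) G) i) (≡.cong (coeff r′ i ℕ.+_) (coeff-scale (m ℕ.* k) G i))
      -- k c is b modulo p, so this is b + (p - 1) b = p b.
      at-n : p ℕ.∣ b ℕ.+ m ℕ.* k ℕ.* c
      at-n = ∣-resp-≡ₚ {p ℕ.* b} {b ℕ.+ m ℕ.* k ℕ.* c} (≡ₚ-sym {b ℕ.+ m ℕ.* k ℕ.* c} {p ℕ.* b}
        (+-congₚ {b} {b} {m ℕ.* k ℕ.* c} {m ℕ.* b} (≡⇒≡ₚ {b} ≡.refl)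
          (≡.subst₂ _≡ₚ_ regroup (≡.cong (m ℕ.*_) (ℕ.*-identityʳ b))
            (*-congₚ {m} {m} {b ℕ.* (c⁻¹ ℕ.* c)} {b ℕ.* 1} (≡⇒≡ₚ {m} ≡.refl)
              (*-congₚ {b} {b} {c⁻¹ ℕ.* c} {1} (≡⇒≡ₚ {b} ≡.refl) c⁻¹*c≡1)))))
        (ℕ.m∣m*n b)
        where
        regroup : m ℕ.* (b ℕ.* (c⁻¹ ℕ.* c)) ≡ m ℕ.* k ℕ.* c
        regroup = ≡.trans (≡.cong (m ℕ.*_) (≡.sym (ℕ.*-assoc b c⁻¹ c))) (≡.sym (ℕ.*-assoc m k c))
      small″ : ∀ i → n ≤ i → p ℕ.∣ coeff r″ i
      small″ i n≤i = by (ℕ.m≤n⇒m<n∨m≡n n≤i)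
        where
        by : n < i ⊎ n ≡ i → p ℕ.∣ coeff r″ i
        by (inj₁ n<i) = ≡.subst (p ℕ.∣_) (≡.sym (coeff-r″ i)) (ℕ.∣m∣n⇒∣m+n (small-r′ i n<i)
          (ℕ.∣n⇒∣m*n (m ℕ.* k) (above-degree G n<i)))
        by (inj₂ ≡.refl) = ≡.subst (p ℕ.∣_) (≡.sym (coeff-r″ n)) at-n
    division : ∀ F → Division F
    division []      = [] , [] , refl , λ i _ → p ℕ.∣0
    division (a ∷ F) = step a F (division F)

  derivative : Poly → Poly
  derivative []      = []
  derivative (a ∷ P) = addP P (0 ∷ derivative P)

  coeff-derivative : ∀ P i → coeff (derivative P) i ≡ suc i ℕ.* coeff P (suc i)
  coeff-derivative []      i       = ≡.sym (ℕ.*-zeroʳ i)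
  coeff-derivative (a ∷ P) zero    = coeff-add P (0 ∷ derivative P) 0
  coeff-derivative (a ∷ P) (suc i) = ≡.trans (coeff-add P (0 ∷ derivative P) (suc i))
    (≡.cong (coeff P (suc i) ℕ.+_) (coeff-derivative P i))

  derivative-cong : ∀ {P Q} → P ≈ Q → derivative P ≈ derivative Q
  derivative-cong {P} {Q} e = by-coeff _ _ (coeff-derivative P) (coeff-derivative Q)
    λ i → *-congₚ {suc i} {suc i} {coeff P (suc i)} {coeff Q (suc i)} (≡⇒≡ₚ {suc i} ≡.refl) (at e (suc i))

  derivative-add : ∀ P Q → derivative (addP P Q) ≈ addP (derivative P) (derivative Q)
  derivative-add P Q = ≡⇒≈ λ i → let open ≡.≡-Reasoning in begin
    coeff (derivative (addP P Q)) i                              ≡⟨ coeff-derivative (addP P Q) i ⟩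
    suc i ℕ.* coeff (addP P Q) (suc i)                           ≡⟨ ≡.cong (suc i ℕ.*_) (coeff-add P Q (suc i)) ⟩
    suc i ℕ.* (coeff P (suc i) ℕ.+ coeff Q (suc i))              ≡⟨ ℕ.*-distribˡ-+ (suc i) (coeff P (suc i)) _ ⟩
    suc i ℕ.* coeff P (suc i) ℕ.+ suc i ℕ.* coeff Q (suc i)      ≡⟨ ≡.cong₂ ℕ._+_ (coeff-derivative P i) (coeff-derivative Q i) ⟨
    coeff (derivative P) i ℕ.+ coeff (derivative Q) i            ≡⟨ coeff-add (derivative P) (derivative Q) i ⟨
    coeff (addP (derivative P) (derivative Q)) i                 ∎

  derivative-scale : ∀ a P → derivative (scale a P) ≈ scale a (derivative P)
  derivative-scale a []      = refl
  derivative-scale a (b ∷ P) = trans (add-cong (refl {scale a P}) (trans (0∷-cong (derivative-scale a P)) (sym (scale-0∷ a _))))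
    (sym (scale-add a P (0 ∷ derivative P)))

  derivative-mul : ∀ P Q → derivative (mulP P Q) ≈ addP (mulP (derivative P) Q) (mulP P (derivative Q))
  derivative-mul []      Q = refl
  derivative-mul (a ∷ P) Q = let open ≈-Reasoning in begin
    derivative (addP (scale a Q) (0 ∷ mulP P Q))
      ≈⟨ derivative-add (scale a Q) (0 ∷ mulP P Q) ⟩
    addP (derivative (scale a Q)) (addP (mulP P Q) (0 ∷ derivative (mulP P Q)))
      ≈⟨ add-cong (derivative-scale a Q) (add-cong (refl {mulP P Q}) (0∷-cong (derivative-mul P Q))) ⟩
    addP (scale a (derivative Q)) (addP (mulP P Q) (addP (0 ∷ mulP (derivative P) Q) (0 ∷ mulP P (derivative Q))))
      ≈⟨ add-cong (refl {scale a (derivative Q)}) (sym (add-assoc (mulP P Q) _ _)) ⟩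
    addP (scale a (derivative Q)) (addP (addP (mulP P Q) (0 ∷ mulP (derivative P) Q)) (0 ∷ mulP P (derivative Q)))
      ≈⟨ x∙yz≈y∙xz (scale a (derivative Q)) (addP (mulP P Q) (0 ∷ mulP (derivative P) Q)) (0 ∷ mulP P (derivative Q)) ⟩
    addP (addP (mulP P Q) (0 ∷ mulP (derivative P) Q)) (addP (scale a (derivative Q)) (0 ∷ mulP P (derivative Q)))
      ≈⟨ add-cong (trans (add-cong (refl {mulP P Q}) (sym (mul-0∷ˡ (derivative P) Q))) (sym (mul-distribʳ Q P (0 ∷ derivative P)))) refl ⟩
    addP (mulP (addP P (0 ∷ derivative P)) Q) (mulP (a ∷ P) (derivative Q)) ∎

  derivative-degree : ∀ P → derivative P ≈ [] ⊎ degree (derivative P) < degree P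
  derivative-degree P = by (≈[]? (derivative P))
    where
    by : Dec (derivative P ≈ []) → derivative P ≈ [] ⊎ degree (derivative P) < degree P
    by (yes e) = inj₁ e
    by (no ne) = inj₂ (ℕ.≰⇒> λ le → HasDegree.leading (degree-correct (derivative P) ne)
      (≡.subst (p ℕ.∣_) (≡.sym (coeff-derivative P _)) (ℕ.∣n⇒∣m*n (suc (degree (derivative P))) (above-degree P (s≤s le)))))

  open Operations commutativeRing public using (_^_; _×ₙ_)

  coeff-× : ∀ n P i → coeff (n ×ₙ P) i ≡ n ℕ.* coeff P i
  coeff-× zero    P i = ≡.refl
  coeff-× (suc n) P i = ≡.trans (coeff-add P (n ×ₙ P) i) (≡.cong (coeff P i ℕ.+_) (coeff-× n P i))

  characteristic : p ×ₙ oneP ≈ []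
  characteristic = ∣⇒≈[] λ i → ≡.subst (p ℕ.∣_) (≡.sym (coeff-× p oneP i)) (ℕ.m∣m*n _)

  open Frobenius commutativeRing pp using (frobenius-+)
  open import Algebra.Properties.CommutativeSemiring.Exp (CommutativeRing.commutativeSemiring commutativeRing)
    using (^-congˡ; ^-distrib-*)

  shiftBy : ℕ → Poly → Poly
  shiftBy n P = replicate n 0 ++ P

  t : Poly
  t = 0 ∷ 1 ∷ []

  t*≈ : ∀ P → mulP t P ≈ 0 ∷ P
  t*≈ P = trans (mul-0∷ˡ oneP P) (0∷-cong (mul-one P))

  t^*≈ : ∀ n P → mulP (t ^ n) P ≈ shiftBy n P
  t^*≈ zero    P = mul-one P
  t^*≈ (suc n) P = trans (mul-assoc t (t ^ n) P) (trans (t*≈ (mulP (t ^ n) P)) (0∷-cong (t^*≈ n P)))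

  one^≈ : ∀ n → oneP ^ n ≈ oneP
  one^≈ zero    = refl
  one^≈ (suc n) = trans (mul-one _) (one^≈ n)

  -- Fermat's little theorem, by induction on a from the additivity of Frobenius.
  constant^p : ∀ a → (a ∷ []) ^ p ≈ a ∷ []
  constant^p zero    = trans (^-congˡ p 0∷[]≈[]) (sym 0∷[]≈[])
  constant^p (suc a) = trans (frobenius-+ characteristic oneP (a ∷ [])) (add-cong (one^≈ p) (constant^p a))

  -- Frobenius is additive and fixes constants, so taking p-th powers only replaces t by t^p.
  ^p≈expand : ∀ P → P ^ p ≈ expandP p P
  ^p≈expand []      = refl
  ^p≈expand (a ∷ P) = let open ≈-Reasoning in begin
    (a ∷ P) ^ p                                      ≈⟨ ^-congˡ p (trans (∷≈ a P) (add-cong (refl {a ∷ []}) (sym (t*≈ P)))) ⟩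
    addP (a ∷ []) (mulP t P) ^ p                     ≈⟨ frobenius-+ characteristic (a ∷ []) (mulP t P) ⟩
    addP ((a ∷ []) ^ p) (mulP t P ^ p)               ≈⟨ add-cong (constant^p a) (^-distrib-* t P p) ⟩
    addP (a ∷ []) (mulP (t ^ p) (P ^ p))             ≈⟨ add-cong (refl {a ∷ []}) (trans (mul-cong (refl {t ^ p}) (^p≈expand P)) (t^*≈ p (expandP p P))) ⟩
    addP (a ∷ []) (0 ∷ shiftBy m (expandP p P))      ≈⟨ ∷≈ a _ ⟨
    a ∷ shiftBy m (expandP p P)                      ∎

  coeff-shift< : ∀ n P {i} → i < n → coeff (shiftBy n P) i ≡ 0
  coeff-shift< (suc n) P {zero}  lt       = ≡.refl
  coeff-shift< (suc n) P {suc i} (s≤s lt) = coeff-shift< n P lt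

  coeff-shift+ : ∀ n P i → coeff (shiftBy n P) (n ℕ.+ i) ≡ coeff P i
  coeff-shift+ zero    P i = ≡.refl
  coeff-shift+ (suc n) P i = coeff-shift+ n P i

  coeff-expand-* : ∀ P j → coeff (expandP p P) (j ℕ.* p) ≡ coeff P j
  coeff-expand-* []      j       = ≡.refl
  coeff-expand-* (a ∷ P) zero    = ≡.refl
  coeff-expand-* (a ∷ P) (suc j) = ≡.trans (coeff-shift+ m (expandP p P) (j ℕ.* p)) (coeff-expand-* P j)

  coeff-expand-∤ : ∀ P {i} → ¬ p ℕ.∣ i → coeff (expandP p P) i ≡ 0
  coeff-expand-∤ []      p∤i = ≡.refl
  coeff-expand-∤ (a ∷ P) {zero}  p∤i = contradiction (p ℕ.∣0) p∤i
  coeff-expand-∤ (a ∷ P) {suc i} p∤i with i ℕ.<? m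
  ... | yes i<m = coeff-shift< m (expandP p P) i<m
  ... | no  i≮m = ≡.trans (≡.cong (coeff (shiftBy m (expandP p P))) (≡.sym m+[i∸m]≡i))
      (≡.trans (coeff-shift+ m (expandP p P) (i ℕ.∸ m)) (coeff-expand-∤ P (λ d → p∤i
        (≡.subst (p ℕ.∣_) (≡.cong suc m+[i∸m]≡i) (ℕ.∣m∣n⇒∣m+n ℕ.∣-refl d)))))
    where
    m+[i∸m]≡i : m ℕ.+ (i ℕ.∸ m) ≡ i
    m+[i∸m]≡i = ℕ.m+[n∸m]≡n (ℕ.≮⇒≥ i≮m)

  coeff-applyUpTo : ∀ (f : ℕ → ℕ) n {i} → i < n → coeff (applyUpTo f n) i ≡ f i
  coeff-applyUpTo f (suc n) {zero}  lt       = ≡.refl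
  coeff-applyUpTo f (suc n) {suc i} (s≤s lt) = coeff-applyUpTo (f ∘ suc) n lt

  coeff-applyUpTo-≥ : ∀ (f : ℕ → ℕ) n {i} → n ≤ i → coeff (applyUpTo f n) i ≡ 0
  coeff-applyUpTo-≥ f zero            le       = ≡.refl
  coeff-applyUpTo-≥ f (suc n) {suc i} (s≤s le) = coeff-applyUpTo-≥ (f ∘ suc) n le

  coeff-≥length : ∀ P {i} → length P ≤ i → coeff P i ≡ 0
  coeff-≥length []              le       = ≡.refl
  coeff-≥length (a ∷ P) {suc i} (s≤s le) = coeff-≥length P le

  -- `length P` entries are enough because j ≤ j p; the surplus ones are zero.
  contract : Poly → Poly
  contract P = applyUpTo (λ j → coeff P (j ℕ.* p)) (length P)

  coeff-contract : ∀ P j → coeff (contract P) j ≡ coeff P (j ℕ.* p)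
  coeff-contract P j with j ℕ.<? length P
  ... | yes lt = coeff-applyUpTo _ (length P) lt
  ... | no  ge = ≡.trans (coeff-applyUpTo-≥ _ (length P) (ℕ.≮⇒≥ ge))
    (≡.sym (coeff-≥length P (ℕ.≤-trans (ℕ.≮⇒≥ ge) (ℕ.m≤m*n j p))))

  -- The coefficient at i becomes zero modulo p when multiplied by i, so it vanishes modulo p unless
  -- p ∣ i.
  ≈expand-contract : ∀ {P} → derivative P ≈ [] → P ≈ expandP p (contract P)
  ≈expand-contract {P} DP≈0 = mk≈ λ i → at-i i (p ℕ.∣? i)
    where
    at-i : ∀ i → Dec (p ℕ.∣ i) → coeff P i ≡ₚ coeff (expandP p (contract P)) i
    at-i i       (yes (ℕ.divides j ≡.refl)) = ≡⇒≡ₚ {coeff P (j ℕ.* p)}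
      (≡.sym (≡.trans (coeff-expand-* (contract P) j) (coeff-contract P j)))
    at-i zero    (no p∤i) = contradiction (p ℕ.∣0) p∤i
    at-i (suc i) (no p∤i) = ≡.subst (coeff P (suc i) ≡ₚ_) (≡.sym (coeff-expand-∤ (contract P) p∤i))
      (∣⇒≡ₚ0 ([ (λ d → contradiction d p∤i) , (λ d → d) ]′ (euclidsLemma (suc i) (coeff P (suc i)) pp
        (≡.subst (p ℕ.∣_) (coeff-derivative P i) (≈[]⇒∣ DP≈0 i)))))

  polynomialRing : PolynomialRing p
  polynomialRing = record
    { commutativeRing = commutativeRing
    ; ≈0?      = ≈[]?
    ; 1≉0      = one≉0
    ; integral = integral
    ; char     = characteristic
    ; deg      = degree
    ; deg-cong = degree-cong
    ; deg-*    = λ P≉0 Q≉0 → degree-unique (mul-degree P≉0 Q≉0)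
    ; deg-+    = degree-add
    ; divMod   = divMod
    ; D        = derivative
    ; D-cong   = derivative-cong
    ; D-+      = derivative-add
    ; D-*      = derivative-mul
    ; D-deg    = derivative-degree
    ; D-root   = λ {P} DP≈0 → contract P , trans (≈expand-contract DP≈0) (sym (^p≈expand (contract P)))
    }

-- From rational functions to the equation in four polynomials.

module FermatEquation {p : ℕ} (pp : Prime p) (R : PolynomialRing p) where
  open FermatSum pp R public
  open ≈-Reasoning

  -- n / d = (n d^(p-1)) / d^p, where the new numerator has vanishing derivative.
  W≈0⇒D≈0 : ∀ {m n d} → suc m ×ₙ 1# ≈ 0# → d ≉ 0# → W n d ≈ 0# → D (n * d ^ m) ≈ 0#
  W≈0⇒D≈0 {m} {n} {d} char d≉0 W≈0 = *-cancelˡ d d≉0 (begin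
    d * D (n * d ^ m)                                      ≈⟨ *-congˡ {d} (D-* n (d ^ m)) ⟩
    d * (D n * d ^ m + n * D (d ^ m))                      ≈⟨ solve 5 (λ d n x y z → d :* (y :* x :+ n :* z) := y :* d :* x :+ n :* (d :* z)) refl d n (d ^ m) (D n) (D (d ^ m)) ⟩
    D n * d * d ^ m + n * (d * D (d ^ m))                  ≈⟨ +-cong (*-congʳ {d ^ m} (sym (x-y≈0⇒x≈y W≈0))) (*-congˡ {n} (f*D-^ d m)) ⟩
    n * D d * d ^ m + n * ((m ×ₙ 1#) * d ^ m * D d)        ≈⟨ +-congʳ (*-identityˡ _) ⟨
    1# * (n * D d * d ^ m) + n * ((m ×ₙ 1#) * d ^ m * D d)
      ≈⟨ solve 5 (λ o n y x c → o :* (n :* y :* x) :+ n :* (c :* x :* y) := (o :+ c) :* (n :* x :* y)) refl 1# n (D d) (d ^ m) (m ×ₙ 1#) ⟩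
    (suc m ×ₙ 1#) * (n * d ^ m * D d)                          ≈⟨ *-congʳ {n * d ^ m * D d} char ⟩
    0# * (n * d ^ m * D d)                                 ≈⟨ zeroˡ (n * d ^ m * D d) ⟩
    0#                                                     ≈⟨ zeroʳ d ⟨
    d * 0#                                                 ∎)

  -- Up to a square factor the Wronskian depends on the ratio alone, so the hypotheses on x, y, z
  -- and their quotients survive clearing denominators.
  W-scale : ∀ n d g → W (n * g) (d * g) ≈ g * g * W n d
  W-scale n d g = begin
    n * g * D (d * g) - D (n * g) * (d * g)
      ≈⟨ +-cong (*-congˡ (D-* d g)) (-‿cong (*-congʳ (D-* n g))) ⟩
    n * g * (D d * g + d * D g) - (D n * g + n * D g) * (d * g)
      ≈⟨ solve 6 (λ n d g x y z → n :* g :* (y :* g :+ d :* z) :- (x :* g :+ n :* z) :* (d :* g) := g :* g :* (n :* y :- x :* d)) refl n d g (D n) (D d) (D g) ⟩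
    g * g * W n d ∎

  W-nonzero : ∀ {f f′} n d g → g ≉ 0# → f ≈ n * g → f′ ≈ d * g → W n d ≉ 0# → W f f′ ≉ 0#
  W-nonzero n d g g≉0 f≈ f′≈ W≉0 W≈0 = [ *-≉0 g≉0 g≉0 , W≉0 ]′
    (integral (trans (sym (W-scale n d g)) (trans (sym (W-cong f≈ f′≈)) W≈0)))

  W-flip : ∀ {f g} → W f g ≉ 0# → W g f ≉ 0#
  W-flip {f} {g} W≉0 Wgf≈0 = W≉0 (trans (W-antisym g f) (trans (-‿cong Wgf≈0) -0#≈0#))

  module ClearedEquation
    {n : ℕ} (N⊥p : Coprime (suc n) p) {X : ℕ} (156<X : 156 < X) (good : Good X p (suc n))
    (a₁ b₁ a₂ b₂ a₃ b₃ : Carrier)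
    (a₁≉0 : a₁ ≉ 0#) (b₁≉0 : b₁ ≉ 0#) (a₂≉0 : a₂ ≉ 0#) (b₂≉0 : b₂ ≉ 0#) (a₃≉0 : a₃ ≉ 0#) (b₃≉0 : b₃ ≉ 0#)
    (W-x : W a₁ b₁ ≉ 0#) (W-y : W a₂ b₂ ≉ 0#) (W-z : W a₃ b₃ ≉ 0#)
    (W-x/y : W (a₁ * b₂) (b₁ * a₂) ≉ 0#) (W-x/z : W (a₁ * b₃) (b₁ * a₃) ≉ 0#) (W-y/z : W (a₂ * b₃) (b₂ * a₃) ≉ 0#)
    (cleared : ((a₁ ^ suc n * b₂ ^ suc n + a₂ ^ suc n * b₁ ^ suc n) * b₃ ^ suc n + a₃ ^ suc n * (b₁ ^ suc n * b₂ ^ suc n)) * 1#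
               ≈ 1# * (b₁ ^ suc n * b₂ ^ suc n * b₃ ^ suc n)) where

    N : ℕ
    N = suc n

    -- The common denominator stands for the constant 1, with sign -1 to bring the right-hand side
    -- over. Up to inversion the ratios of the `f i` are x, y, z, x/y, x/z and y/z.
    f ε : Fin 4 → Carrier
    f 0F = b₁ * (b₂ * b₃)
    f 1F = a₁ * (b₂ * b₃)
    f 2F = a₂ * (b₁ * b₃)
    f 3F = a₃ * (b₁ * b₂)
    ε 0F = - 1#
    ε 1F = 1#
    ε 2F = 1#
    ε 3F = 1#

    ε∣1 : ∀ i → ε i ∣ 1#
    ε∣1 0F = - 1# , -1*-1≈1
    ε∣1 1F = ∣ʳ-refl
    ε∣1 2F = ∣ʳ-refl
    ε∣1 3F = ∣ʳ-refl

    Dε≈0 : ∀ i → D (ε i) ≈ 0#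
    Dε≈0 0F = trans (D-neg 1#) (trans (-‿cong D-1) -0#≈0#)
    Dε≈0 1F = D-1
    Dε≈0 2F = D-1
    Dε≈0 3F = D-1

    f≉0 : ∀ i → f i ≉ 0#
    f≉0 0F = *-≉0 b₁≉0 (*-≉0 b₂≉0 b₃≉0)
    f≉0 1F = *-≉0 a₁≉0 (*-≉0 b₂≉0 b₃≉0)
    f≉0 2F = *-≉0 a₂≉0 (*-≉0 b₁≉0 b₃≉0)
    f≉0 3F = *-≉0 a₃≉0 (*-≉0 b₁≉0 b₂≉0)

    W₁₀ : W (f 1F) (f 0F) ≉ 0#
    W₁₀ = W-nonzero a₁ b₁ (b₂ * b₃) (*-≉0 b₂≉0 b₃≉0) refl refl W-x
    W₂₀ : W (f 2F) (f 0F) ≉ 0#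
    W₂₀ = W-nonzero a₂ b₂ (b₁ * b₃) (*-≉0 b₁≉0 b₃≉0) refl
      (solve 3 (λ b₁ b₂ b₃ → b₁ :* (b₂ :* b₃) := b₂ :* (b₁ :* b₃)) refl b₁ b₂ b₃) W-y
    W₃₀ : W (f 3F) (f 0F) ≉ 0#
    W₃₀ = W-nonzero a₃ b₃ (b₁ * b₂) (*-≉0 b₁≉0 b₂≉0) refl
      (solve 3 (λ b₁ b₂ b₃ → b₁ :* (b₂ :* b₃) := b₃ :* (b₁ :* b₂)) refl b₁ b₂ b₃) W-z
    W₁₂ : W (f 1F) (f 2F) ≉ 0#
    W₁₂ = W-nonzero (a₁ * b₂) (b₁ * a₂) b₃ b₃≉0 (sym (*-assoc a₁ b₂ b₃))
      (solve 3 (λ a₂ b₁ b₃ → a₂ :* (b₁ :* b₃) := b₁ :* a₂ :* b₃) refl a₂ b₁ b₃) W-x/y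
    W₁₃ : W (f 1F) (f 3F) ≉ 0#
    W₁₃ = W-nonzero (a₁ * b₃) (b₁ * a₃) b₂ b₂≉0
      (solve 3 (λ a₁ b₂ b₃ → a₁ :* (b₂ :* b₃) := a₁ :* b₃ :* b₂) refl a₁ b₂ b₃)
      (solve 3 (λ a₃ b₁ b₂ → a₃ :* (b₁ :* b₂) := b₁ :* a₃ :* b₂) refl a₃ b₁ b₂) W-x/z
    W₂₃ : W (f 2F) (f 3F) ≉ 0#
    W₂₃ = W-nonzero (a₂ * b₃) (b₂ * a₃) b₁ b₁≉0
      (solve 3 (λ a₂ b₁ b₃ → a₂ :* (b₁ :* b₃) := a₂ :* b₃ :* b₁) refl a₂ b₁ b₃)
      (solve 3 (λ a₃ b₁ b₂ → a₃ :* (b₁ :* b₂) := b₂ :* a₃ :* b₁) refl a₃ b₁ b₂) W-y/z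

    W≉0 : ∀ {i j} → i ≢ j → W (f i) (f j) ≉ 0#
    W≉0 {0F} {0F} i≢j = contradiction ≡.refl i≢j
    W≉0 {0F} {1F} _   = W-flip W₁₀
    W≉0 {0F} {2F} _   = W-flip W₂₀
    W≉0 {0F} {3F} _   = W-flip W₃₀
    W≉0 {1F} {0F} _   = W₁₀
    W≉0 {1F} {1F} i≢j = contradiction ≡.refl i≢j
    W≉0 {1F} {2F} _   = W₁₂
    W≉0 {1F} {3F} _   = W₁₃
    W≉0 {2F} {0F} _   = W₂₀
    W≉0 {2F} {1F} _   = W-flip W₁₂
    W≉0 {2F} {2F} i≢j = contradiction ≡.refl i≢j
    W≉0 {2F} {3F} _   = W₂₃
    W≉0 {3F} {0F} _   = W₃₀
    W≉0 {3F} {1F} _   = W-flip W₁₃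
    W≉0 {3F} {2F} _   = W-flip W₂₃
    W≉0 {3F} {3F} i≢j = contradiction ≡.refl i≢j

    power₃ : ∀ a b c → (a * (b * c)) ^ N ≈ a ^ N * (b ^ N * c ^ N)
    power₃ a b c = trans (^-distrib-* a (b * c) N) (*-congˡ (^-distrib-* b c N))

    sum≈0 : ε 0F * f 0F ^ N + (ε 1F * f 1F ^ N + (ε 2F * f 2F ^ N + (ε 3F * f 3F ^ N + 0#))) ≈ 0#
    sum≈0 = begin
      - 1# * f 0F ^ N + (1# * f 1F ^ N + (1# * f 2F ^ N + (1# * f 3F ^ N + 0#)))
        ≈⟨ +-cong (trans (-1*x≈-x _) (-‿cong (power₃ b₁ b₂ b₃))) (+-cong (trans (*-identityˡ _) (power₃ a₁ b₂ b₃))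
          (+-cong (trans (*-identityˡ _) (power₃ a₂ b₁ b₃)) (trans (+-identityʳ _) (trans (*-identityˡ _) (power₃ a₃ b₁ b₂))))) ⟩
      - (B₁ * (B₂ * B₃)) + (A₁ * (B₂ * B₃) + (A₂ * (B₁ * B₃) + A₃ * (B₁ * B₂)))
        ≈⟨ solve 6 (λ A₁ A₂ A₃ B₁ B₂ B₃ → (:- (B₁ :* (B₂ :* B₃))) :+ (A₁ :* (B₂ :* B₃) :+ (A₂ :* (B₁ :* B₃) :+ A₃ :* (B₁ :* B₂)))
             := ((A₁ :* B₂ :+ A₂ :* B₁) :* B₃ :+ A₃ :* (B₁ :* B₂)) :- B₁ :* B₂ :* B₃) refl A₁ A₂ A₃ B₁ B₂ B₃ ⟩
      ((A₁ * B₂ + A₂ * B₁) * B₃ + A₃ * (B₁ * B₂)) - B₁ * B₂ * B₃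
        ≈⟨ +-congʳ (trans (sym (*-identityʳ _)) (trans cleared (*-identityˡ _))) ⟩
      B₁ * B₂ * B₃ - B₁ * B₂ * B₃
        ≈⟨ -‿inverseʳ _ ⟩
      0# ∎
      where
      A₁ = a₁ ^ N
      A₂ = a₂ ^ N
      A₃ = a₃ ^ N
      B₁ = b₁ ^ N
      B₂ = b₂ ^ N
      B₃ = b₃ ^ N

    no-solution : ⊥
    no-solution = Equation.absurd N⊥p 156<X good ε f ε∣1 Dε≈0 f≉0 W≉0 sum≈0

module Fractions (m : ℕ) (pp : Prime (suc m)) where
  open PolynomialsModulo m pp
    using (p; mk≈; at; ≈[]⇒∣; HasDegree; degree; degree-correct; contract; ≈expand-contract; ^p≈expand; characteristic; polynomialRing)
  open FermatEquation pp polynomialRing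
  open ≈-Reasoning

  PNonZero⇒≉0 : ∀ {f} → PNonZero p f → f ≉ 0#
  PNonZero⇒≉0 (i , p∤) f≈0 = p∤ (≈[]⇒∣ f≈0 i)

  ≉0⇒PNonZero : ∀ {f} → f ≉ 0# → PNonZero p f
  ≉0⇒PNonZero {f} f≉0 = degree f , HasDegree.leading (degree-correct f f≉0)

  -- Over the denominator d^p = d(t^p), the numerator n d^(p-1) has derivative zero and is therefore
  -- a polynomial in t^p.
  W≈0⇒InFtp : ∀ n d → d ≉ 0# → W n d ≈ 0# → InFtp p (n , d)
  W≈0⇒InFtp n d d≉0 W≈0 = contract (n * d ^ m) , d , ≉0⇒PNonZero d≉0 , at (begin
    n * expandP p d                            ≈⟨ *-congˡ {n} (^p≈expand d) ⟨
    n * (d * d ^ m)                            ≈⟨ solve 3 (λ n d x → n :* (d :* x) := n :* x :* d) refl n d (d ^ m) ⟩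
    n * d ^ m * d                              ≈⟨ *-congʳ {d} (≈expand-contract {n * d ^ m} (W≈0⇒D≈0 {m} {n} {d} characteristic d≉0 W≈0)) ⟩
    expandP p (contract (n * d ^ m)) * d       ∎)

  ¬InFtp⇒W≉0 : ∀ n d → d ≉ 0# → ¬ InFtp p (n , d) → W n d ≉ 0#
  ¬InFtp⇒W≉0 n d d≉0 ∉ W≈0 = ∉ (W≈0⇒InFtp n d d≉0 W≈0)

  -- Zero is 0 / 1 and lies in F_p(t^p).
  ¬InFtp⇒num≉0 : ∀ x → ¬ InFtp p x → num x ≉ 0#
  ¬InFtp⇒num≉0 x x∉ num≈0 = x∉ ([] , oneP , ≉0⇒PNonZero 1≉0 , at (trans (*-congʳ {expandP p oneP} num≈0) (zeroˡ (expandP p oneP))))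

  num-pow : ∀ x n → num (powF x n) ≡ num x ^ n
  num-pow x zero    = ≡.refl
  num-pow x (suc n) = ≡.cong (num x *_) (num-pow x n)

  den-pow : ∀ x n → den (powF x n) ≡ den x ^ n
  den-pow x zero    = ≡.refl
  den-pow x (suc n) = ≡.cong (den x *_) (den-pow x n)

  no-solution : ∀ {n X} → Coprime (suc n) p → 156 < X → Good X p (suc n) →
    ∀ x y z → ValidF p x → ValidF p y → ValidF p z →
    FEq p (addF (addF (powF x (suc n)) (powF y (suc n))) (powF z (suc n))) oneF →
    ¬ InFtp p x → ¬ InFtp p y → ¬ InFtp p z →
    ¬ InFtp p (divF x y) → ¬ InFtp p (divF x z) → ¬ InFtp p (divF y z) → ⊥
  no-solution {n} N⊥p 156<X good x y z x-valid y-valid z-valid equation x∉ y∉ z∉ x/y∉ x/z∉ y/z∉ =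
    ClearedEquation.no-solution N⊥p 156<X good a₁ b₁ a₂ b₂ a₃ b₃ a₁≉0 b₁≉0 a₂≉0 b₂≉0 a₃≉0 b₃≉0
      (¬InFtp⇒W≉0 a₁ b₁ b₁≉0 x∉) (¬InFtp⇒W≉0 a₂ b₂ b₂≉0 y∉) (¬InFtp⇒W≉0 a₃ b₃ b₃≉0 z∉)
      (¬InFtp⇒W≉0 (a₁ * b₂) (b₁ * a₂) (*-≉0 b₁≉0 a₂≉0) x/y∉) (¬InFtp⇒W≉0 (a₁ * b₃) (b₁ * a₃) (*-≉0 b₁≉0 a₃≉0) x/z∉)
      (¬InFtp⇒W≉0 (a₂ * b₃) (b₂ * a₃) (*-≉0 b₂≉0 a₃≉0) y/z∉) (mk≈ cleared)
    where
    N = suc n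
    a₁ = num x
    b₁ = den x
    a₂ = num y
    b₂ = den y
    a₃ = num z
    b₃ = den z
    b₁≉0 = PNonZero⇒≉0 {b₁} x-valid
    b₂≉0 = PNonZero⇒≉0 {b₂} y-valid
    b₃≉0 = PNonZero⇒≉0 {b₃} z-valid
    a₁≉0 = ¬InFtp⇒num≉0 x x∉
    a₂≉0 = ¬InFtp⇒num≉0 y y∉
    a₃≉0 = ¬InFtp⇒num≉0 z z∉
    Cleared : (A₁ B₁ A₂ B₂ A₃ B₃ : Poly) → Set
    Cleared A₁ B₁ A₂ B₂ A₃ B₃ = FEq p (addF (addF (A₁ , B₁) (A₂ , B₂)) (A₃ , B₃)) oneF
    cleared : Cleared (a₁ ^ N) (b₁ ^ N) (a₂ ^ N) (b₂ ^ N) (a₃ ^ N) (b₃ ^ N)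
    cleared = ≡.subst₂ (λ A₁ B₁ → Cleared A₁ B₁ (a₂ ^ N) (b₂ ^ N) (a₃ ^ N) (b₃ ^ N)) (num-pow x N) (den-pow x N)
      (≡.subst₂ (λ A₂ B₂ → Cleared (num (powF x N)) (den (powF x N)) A₂ B₂ (a₃ ^ N) (b₃ ^ N)) (num-pow y N) (den-pow y N)
        (≡.subst₂ (λ A₃ B₃ → Cleared (num (powF x N)) (den (powF x N)) (num (powF y N)) (den (powF y N)) A₃ B₃)
          (num-pow z N) (den-pow z N) equation))

theorem1p3 : (p N : ℕ) → Prime p → 480 < p → 0 < N → Coprime N p → Good 480 p N →
    ¬ (∃[ x ] ∃[ y ] ∃[ z ]
    (ValidF p x × ValidF p y × ValidF p z
    × FEq p (addF (addF (powF x N) (powF y N)) (powF z N)) oneF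
    × ¬ InFtp p x × ¬ InFtp p y × ¬ InFtp p z
    × ¬ InFtp p (divF x y) × ¬ InFtp p (divF x z) × ¬ InFtp p (divF y z)))
theorem1p3 zero    N       pp _ _ _ _ _ = ¬prime[0] pp
theorem1p3 (suc m) zero    pp _ () _ _ _
theorem1p3 (suc m) (suc n) pp _ _ N⊥p good (x , y , z , vx , vy , vz , eq , x∉ , y∉ , z∉ , x/y∉ , x/z∉ , y/z∉) =
  -- 157 + 323 = 480 gives the inequality 156 < 480 on which the final contradiction rests.
  Fractions.no-solution m pp N⊥p (ℕ.m≤m+n 157 323) good x y z vx vy vz eq x∉ y∉ z∉ x/y∉ x/z∉ y/z∉
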